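{- Let $D$ be a prime. An eta quotient $E(z)$ of level $D$ is half the difference of two theta functions of level $D$ if and only if $D\equiv 23\pmod{24}$ and $E(z)=\eta(z)\eta(Dz)$. Moreover, for a prime $D\equiv 23\pmod{24}$, we have $$\eta(z)\eta(Dz)=\frac12\left(\sum_{a,b\in\mathbb{Z}}q^{Q_{s_0}(a,b)}-\sum_{a,b\in\mathbb{Z}}q^{Q_{r_0}(a,b)}\right),$$ where $(Q_{s_0}(x,y),Q_{r_0}(x,y))$ is the Schoeneberg pair of discriminant $-D$, and this representation of $\eta(z)\eta(Dz)$ as half the difference of two theta functions of level $D$ is unique up to proper equivalence and conjugation of the forms $Q_{s_0}(x,y)$ and $Q_{r_0}(x,y)$.
   Context: Here $q=e^{2\pi iz}$ with $z$ in the upper half-plane, $\eta(z)=q^{1/24}\prod_{n\ge1}(1-q^n)$, and an eta quotient of level $N$ is a function $\prod_{\delta\mid N}\eta(\delta z)^{r_\delta}$ with integer exponents $r_\delta$. Binary quadratic forms $Q(x,y)=ax^2+bxy+cy^2$ are integral, primitive and positive definite, with discriminant $b^2-4ac$. The theta function of $Q$ is $\Theta_Q(z)=\sum_{a,b\in\mathbb{Z}}q^{Q(a,b)}$; it is a theta function of level $D$ if $Q$ has discriminant $-D$. Thus "half the difference of two theta functions of level $D$" means a function $\frac12(\Theta_{Q_s}-\Theta_{Q_r})$ with $Q_s,Q_r$ distinct reduced forms of discriminant $-D$, where $ax^2+bxy+cy^2$ is reduced if $|b|\le a\le c$, and $b\ge0$ whenever $|b|=a$ or $a=c$. (Every primitive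 positive definite form is properly equivalent to a unique reduced form, and properly equivalent forms have the same theta function.) Two forms $Q_1,Q_2$ are properly equivalent if $Q_1(x,y)=Q_2(px+qy,rx+sy)$ for integers $p,q,r,s$ with $ps-qr=1$. The conjugate of $ax^2+bxy+cy^2$ is $ax^2-bxy+cy^2$. Uniqueness up to proper equivalence and conjugation means: if $\eta(z)\eta(Dz)=\frac12(\Theta_{Q_s}-\Theta_{Q_r})$ with $Q_s,Q_r$ of discriminant $-D$, then $Q_s$ is properly equivalent to $Q_{s_0}$ or to its conjugate, and $Q_r$ is properly equivalent to $Q_{r_0}$ or to its conjugate. The Schoeneberg pair $(Q_{s_0},Q_{r_0})$ of discriminant $-D$, for $D\equiv 23\pmod{24}$, is defined as follows. If $(D+1)/24\ge 6$, then $$Q_{s_0}(x,y)=6x^2+xy+\tfrac{D+1}{24}y^2,\qquad Q_{r_0}(x,y)=6x^2+5xy+\tfrac{D+25}{24}y^2.$$ If $(D+1)/24<6$, then $(Q_{s_0},Q_{r_0})$ is: for $D=23$: $(x^2+xy+6y^2,\ 2x^2+xy+3y^2)$; for $D=47$: $(2x^2+xy+6y^2,\ 3x^2+xy+4y^2)$; for $D=71$: $(3x^2+xy+6y^2,\ 4x^2+3xy+5y^2)$; for $D=95$: $(4x^2+xy+6y^2,\ 5x^2+5xy+6y^2)$; for $D=119$: $(5x^2+xy+6y^2,\ 6x^2+5xy+6y^2)$. -}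

module Defs where

open import Data.Integer as ℤ using (ℤ; +_; -[1+_]; 0ℤ; 1ℤ; -1ℤ; ∣_∣; -_; _+_; _-_; _*_; _≤_; _<_; +≤+; +<+)
open import Data.Integer.GCD using (gcd)
import Data.Integer.Properties as ℤ
open import Data.Integer.Tactic.RingSolver using (solve-∀)
open import Data.Fin using (Fin; toℕ)
open import Data.List using (List; map; upTo; filter; foldr; length; cartesianProduct)
open import Data.List.Membership.Propositional using (_∈_)
open import Data.List.Membership.Propositional.Properties using (∈-map⁺; ∈-upTo⁺; ∈-cartesianProduct⁺)
open import Data.List.Relation.Unary.Unique.Propositional using (Unique)
import Data.List.Relation.Unary.Unique.Propositional.Properties as Unique
open import Data.Nat as ℕ using (ℕ; zero; suc; s≤s; z≤n)
open import Data.Nat.Divisibility using (_∣?_; divides)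
import Data.Nat.Properties as ℕ
open import Data.Product using (∃-syntax; _×_; _,_)
open import Data.Rational as ℚ using ()
open import Data.Sum using (_⊎_)
open import Data.Vec using (Vec; []; _∷_; lookup; head)
open import Relation.Binary.PropositionalEquality using (_≡_; _≢_; refl; sym; trans; cong; cong₂; subst; module ≡-Reasoning)
open import Relation.Nullary using (¬_; yes; no)

open import Algebra.Properties.AbelianGroup ℤ.+-0-abelianGroup using (∙-cancelʳ)
open import Algebra.Properties.Monoid.Sum ℤ.+-0-monoid using (sum; sum-syntax; sum-cong-≗)

-- Formal power series in q, as coefficient sequences.
Series : Set
Series = ℕ → ℤ

infixl 7 _⊛_
infixr 8 _^ˢ_

monomial : ℕ → Series
monomial m n with n ℕ.≟ m
... | yes _ = 1ℤ
... | no  _ = 0ℤ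

oneˢ : Series
oneˢ = monomial 0

_⊛_ : Series → Series → Series
(f ⊛ g) n = ∑[ i < suc n ] (f (toℕ i) * g (n ℕ.∸ toℕ i))

_^ˢ_ : Series → ℕ → Series
f ^ˢ zero  = oneˢ
f ^ˢ suc k = f ⊛ f ^ˢ k

-- The coefficients of 1/f in degrees n, n-1, …, 0, when f has constant term 1
-- (the only case in which it is used), solved degree by degree from f · 1/f = 1.
inverseCoeffs : Series → ∀ n → Vec ℤ (suc n)
inverseCoeffs f zero    = 1ℤ ∷ []
inverseCoeffs f (suc n) =
  - (∑[ i < suc n ] (f (suc (toℕ i)) * lookup (inverseCoeffs f n) i)) ∷ inverseCoeffs f n

inverse : Series → Series
inverse f n = head (inverseCoeffs f n)

lookup-inverseCoeffs : ∀ f n (i : Fin (suc n)) →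
  lookup (inverseCoeffs f n) i ≡ inverse f (n ℕ.∸ toℕ i)
lookup-inverseCoeffs f zero    Fin.zero    = refl
lookup-inverseCoeffs f (suc n) Fin.zero    = refl
lookup-inverseCoeffs f (suc n) (Fin.suc i) = lookup-inverseCoeffs f n i

⊛-inverseʳ : ∀ f → f 0 ≡ 1ℤ → ∀ n → (f ⊛ inverse f) n ≡ oneˢ n
⊛-inverseʳ f f₀≡1 zero    rewrite f₀≡1 = refl
⊛-inverseʳ f f₀≡1 (suc n) = begin
  f 0 * inverse f (suc n) + S   ≡⟨ cong (λ z → z * inverse f (suc n) + S) f₀≡1 ⟩
  1ℤ * - T + S                  ≡⟨ cong₂ _+_ (ℤ.*-identityˡ (- T)) (sym T≡S) ⟩
  - T + T                       ≡⟨ ℤ.+-inverseˡ T ⟩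
  0ℤ                            ∎
  where
  open ≡-Reasoning
  S T : ℤ
  S = ∑[ i < suc n ] (f (suc (toℕ i)) * inverse f (n ℕ.∸ toℕ i))
  T = ∑[ i < suc n ] (f (suc (toℕ i)) * lookup (inverseCoeffs f n) i)
  T≡S : T ≡ S
  T≡S = sum-cong-≗ (λ i → cong (f (suc (toℕ i)) *_) (lookup-inverseCoeffs f n i))

-- f(q) ↦ f(q^δ), for δ ≥ 1
dilate : ℕ → Series → Series
dilate δ f n with δ ∣? n
... | yes (divides k _) = f k
... | no  _             = 0ℤ

-- ∏_{1≤m≤M} (1 - q^m)
eulerPartial : ℕ → Series
eulerPartial zero    = oneˢ
eulerPartial (suc M) = eulerPartial M ⊛ (λ n → oneˢ n - monomial (suc M) n)

-- ∏_{m≥1} (1 - q^m): the factors with m > n do not affect the coefficient of q^n.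
euler : Series
euler n = eulerPartial n n

-- Functions of z are represented by their expansions in q = e^{2πiz}, with
-- exponents in (1/24)ℤ: order m and series f stand for q^{m/24} f(q).
record QSeries : Set where
  constructor q^_/24·_
  field
    order  : ℤ
    series : Series

open QSeries public

-- the coefficient of q^{k/24}
coeff : QSeries → ℤ → ℤ
coeff E k with k - order E
... | + j      = dilate 24 (series E) j
... | -[1+ _ ] = 0ℤ

infix  4 _≈_
infixl 7 _⊗_
infixr 8 _^ᶻ_

_≈_ : QSeries → QSeries → Set
E ≈ F = ∀ k → coeff E k ≡ coeff F k

_⊗_ : QSeries → QSeries → QSeries
E ⊗ F = q^ (order E + order F) /24· (series E ⊛ series F)

oneQ : QSeries
oneQ = q^ 0ℤ /24· oneˢ

-- for E whose series has constant term 1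
_^ᶻ_ : QSeries → ℤ → QSeries
E ^ᶻ r@(+ k)      = q^ (r * order E) /24· (series E ^ˢ k)
E ^ᶻ r@(-[1+ k ]) = q^ (r * order E) /24· (inverse (series E) ^ˢ suc k)

-- η(δz)
η⟨_⟩ : ℕ → QSeries
η⟨ δ ⟩ = q^ (+ δ) /24· dilate δ euler

divisors : ℕ → List ℕ
divisors N = filter (_∣? N) (map suc (upTo N))

etaQuotient : ℕ → (ℕ → ℤ) → QSeries
etaQuotient N r = foldr _⊗_ oneQ (map (λ δ → η⟨ δ ⟩ ^ᶻ r δ) (divisors N))

IsEtaQuotient : ℕ → QSeries → Set
IsEtaQuotient N E = ∃[ r ] E ≈ etaQuotient N r

record Form : Set where
  constructor form
  field
    a b c : ℤ

eval : Form → ℤ → ℤ → ℤ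
eval (form a b c) x y = a * (x * x) + b * (x * y) + c * (y * y)

discriminant : Form → ℤ
discriminant (form a b c) = b * b - + 4 * (a * c)

Primitive : Form → Set
Primitive (form a b c) = gcd (gcd a b) c ≡ 1ℤ

PositiveDefinite : Form → Set
PositiveDefinite Q = ∀ x y → ¬ (x ≡ 0ℤ × y ≡ 0ℤ) → 0ℤ < eval Q x y

-- the forms whose theta functions have level D
record HasLevel (D : ℕ) (Q : Form) : Set where
  field
    isPrimitive      : Primitive Q
    positiveDefinite : PositiveDefinite Q
    discriminant≡-D  : discriminant Q ≡ - (+ D)

record Reduced (Q : Form) : Set where
  open Form Q
  field
    ∣b∣≤a     : + ∣ b ∣ ≤ a
    a≤c       : a ≤ c
    ∣b∣≡a⇒0≤b : + ∣ b ∣ ≡ a → 0ℤ ≤ b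
    a≡c⇒0≤b   : a ≡ c → 0ℤ ≤ b

conjugate : Form → Form
conjugate (form a b c) = form a (- b) c

ProperlyEquivalent : Form → Form → Set
ProperlyEquivalent Q₁ Q₂ = ∃[ p ] ∃[ q ] ∃[ r ] ∃[ s ]
  (p * s - q * r ≡ 1ℤ × (∀ x y → eval Q₁ x y ≡ eval Q₂ (p * x + q * y) (r * x + s * y)))

EquivalentUpToConjugation : Form → Form → Set
EquivalentUpToConjugation Q Q₀ = ProperlyEquivalent Q Q₀ ⊎ ProperlyEquivalent Q (conjugate Q₀)

interval : ℕ → List ℤ
interval B = map (λ i → + i - + B) (upTo (suc (B ℕ.+ B)))

-- For positive definite Q, 4a·Q(x,y) = (2ax+by)² + (4ac-b²)y² bounds the
-- solutions of Q(x,y) = n; see box-complete and box-unique.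
box : Form → ℕ → List (ℤ × ℤ)
box (form a b c) n = cartesianProduct (interval B) (interval B)
  where B = 4 ℕ.* (∣ a ∣ ℕ.+ ∣ c ∣) ℕ.* n

-- #{(x,y) ∈ ℤ² : Q(x,y) = n}, for positive definite Q
representations : Form → ℕ → ℕ
representations Q n = length (filter (λ (x , y) → eval Q x y ℤ.≟ + n) (box Q n))

Θ : Form → QSeries
Θ Q = q^ 0ℤ /24· (λ n → + representations Q n)

-- E = ½ (F - G)
IsHalfDifference : QSeries → QSeries → QSeries → Set
IsHalfDifference E F G = ∀ k → coeff E k ℚ./ 1 ≡ (coeff F k - coeff G k) ℚ./ 2

record IsHalfThetaDifference (D : ℕ) (E : QSeries) (Qₛ Qᵣ : Form) : Set where
  field
    levelₛ         : HasLevel D Qₛ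
    levelᵣ         : HasLevel D Qᵣ
    reducedₛ       : Reduced Qₛ
    reducedᵣ       : Reduced Qᵣ
    distinct       : Qₛ ≢ Qᵣ
    halfDifference : IsHalfDifference E (Θ Qₛ) (Θ Qᵣ)

module _ where
  private
    square-nonNeg : ∀ i → 0ℤ ≤ i * i
    square-nonNeg i@(+ n)    = subst (0ℤ ≤_) (ℤ.pos-* n n) (+≤+ z≤n)
    square-nonNeg (-[1+ n ]) = +≤+ z≤n

    *-nonNeg : ∀ {i j} → 0ℤ ≤ i → 0ℤ ≤ j → 0ℤ ≤ i * j
    *-nonNeg {+ m} {+ n} _ _ = subst (0ℤ ≤_) (ℤ.pos-* m n) (+≤+ z≤n)

    +-nonNeg : ∀ {i j} → 0ℤ ≤ i → 0ℤ ≤ j → 0ℤ ≤ i + j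
    +-nonNeg {+ m} {+ n} _ _ = +≤+ z≤n

    m≤m*m : ∀ m → m ℕ.≤ m ℕ.* m
    m≤m*m zero    = z≤n
    m≤m*m (suc m) = ℕ.m≤m*n (suc m) (suc m)

    complete-square : ∀ a b c x y →
      + 4 * (a * (a * (x * x) + b * (x * y) + c * (y * y))) - y * y
      ≡ (+ 2 * a * x + b * y) * (+ 2 * a * x + b * y)
        + (+ 4 * (a * c) - b * b - + 1) * (y * y)
    complete-square = solve-∀

    eval-swap : ∀ a b c x y →
      a * (x * x) + b * (x * y) + c * (y * y) ≡ c * (y * y) + b * (y * x) + a * (x * x)
    eval-swap = solve-∀

    disc-swap : ∀ a b c → + 4 * (a * c) - b * b - + 1 ≡ + 4 * (c * a) - b * b - + 1
    disc-swap = solve-∀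

    eval-e₁ : ∀ a b c → a * (+ 1 * + 1) + b * (+ 1 * + 0) + c * (+ 0 * + 0) ≡ a
    eval-e₁ = solve-∀

    eval-e₂ : ∀ a b c → a * (+ 0 * + 0) + b * (+ 0 * + 1) + c * (+ 1 * + 1) ≡ c
    eval-e₂ = solve-∀

    eval-vertex : ∀ a b c →
      a * ((- b) * (- b)) + b * ((- b) * (+ 2 * a)) + c * (+ 2 * a * (+ 2 * a))
      ≡ a * (+ 4 * (a * c) - b * b)
    eval-vertex = solve-∀

    bound : ∀ a b c x y n → 0ℤ ≤ a → 0ℤ ≤ + 4 * (a * c) - b * b - + 1 →
            eval (form a b c) x y ≡ + n → ∣ y ∣ ℕ.≤ 4 ℕ.* ∣ a ∣ ℕ.* n
    bound (+ a) b c x y n _ 0≤d eq = ℕ.≤-trans (m≤m*m ∣ y ∣) (ℤ.drop‿+≤+ (begin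
      + (∣ y ∣ ℕ.* ∣ y ∣)   ≡⟨ cong +_ (sym (ℤ.abs-* y y)) ⟩
      + ∣ y * y ∣           ≡⟨ ℤ.0≤i⇒+∣i∣≡i (square-nonNeg y) ⟩
      y * y                 ≤⟨ ℤ.0≤i-j⇒j≤i 0≤diff ⟩
      + 4 * (+ a * + n)     ≡⟨ cong (+ 4 *_) (sym (ℤ.pos-* a n)) ⟩
      + 4 * + (a ℕ.* n)     ≡⟨ sym (ℤ.pos-* 4 (a ℕ.* n)) ⟩
      + (4 ℕ.* (a ℕ.* n))   ≡⟨ cong +_ (sym (ℕ.*-assoc 4 a n)) ⟩
      + (4 ℕ.* a ℕ.* n)     ∎))
      where
      open ℤ.≤-Reasoning
      0≤diff : 0ℤ ≤ + 4 * (+ a * + n) - y * y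
      0≤diff = subst (λ z → 0ℤ ≤ + 4 * (+ a * z) - y * y) eq
        (subst (0ℤ ≤_) (sym (complete-square (+ a) b c x y))
          (+-nonNeg (square-nonNeg (+ 2 * + a * x + b * y)) (*-nonNeg 0≤d (square-nonNeg y))))

    ∈-interval : ∀ {B} i → ∣ i ∣ ℕ.≤ B → i ∈ interval B
    ∈-interval {B} i ∣i∣≤B = subst (_∈ interval B) j-B≡i
      (∈-map⁺ _ (∈-upTo⁺ (s≤s (ℤ.drop‿+≤+ (ℤ.≤-trans (ℤ.≤-reflexive +∣j∣≡j) j≤2B)))))
      where
      j : ℤ
      j = i + + B
      -B≤i : 0ℤ ≤ j
      -B≤i = go i ∣i∣≤B
        where
        go : ∀ i → ∣ i ∣ ℕ.≤ B → 0ℤ ≤ i + + B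
        go (+ n)      _ = +≤+ z≤n
        go (-[1+ n ]) p = subst (0ℤ ≤_) (sym (ℤ.⊖-≥ p)) (+≤+ z≤n)
      +∣j∣≡j : + ∣ j ∣ ≡ j
      +∣j∣≡j = ℤ.0≤i⇒+∣i∣≡i -B≤i
      i≤∣i∣ : ∀ i → i ≤ + ∣ i ∣
      i≤∣i∣ (+ n)      = ℤ.≤-refl
      i≤∣i∣ (-[1+ n ]) = ℤ.-≤+
      j≤2B : j ≤ + (B ℕ.+ B)
      j≤2B = ℤ.+-monoˡ-≤ (+ B) (ℤ.≤-trans (i≤∣i∣ i) (+≤+ ∣i∣≤B))
      cancel : ∀ i b → i + b - b ≡ i
      cancel = solve-∀
      j-B≡i : + ∣ j ∣ - + B ≡ i
      j-B≡i = trans (cong (_- + B) +∣j∣≡j) (cancel i (+ B))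

    interval-unique : ∀ B → Unique (interval B)
    interval-unique B = Unique.map⁺
      (λ {x} {y} eq → ℤ.+-injective (∙-cancelʳ (- + B) (+ x) (+ y) eq))
      (Unique.upTo⁺ (suc (B ℕ.+ B)))

  box-complete : ∀ Q → PositiveDefinite Q → ∀ n x y → eval Q x y ≡ + n → (x , y) ∈ box Q n
  box-complete Q@(form a b c) pd n x y eq =
    ∈-cartesianProduct⁺ (∈-interval x ∣x∣≤B) (∈-interval y ∣y∣≤B)
    where
    0<a : 0ℤ < a
    0<a = subst (0ℤ <_) (eval-e₁ a b c) (pd (+ 1) (+ 0) (λ ()))
    0<c : 0ℤ < c
    0<c = subst (0ℤ <_) (eval-e₂ a b c) (pd (+ 0) (+ 1) (λ ()))
    2a≢0 : ∀ {a} → 0ℤ < a → + 2 * a ≢ 0ℤ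
    2a≢0 {+ zero} (+<+ ()) _
    2a≢0 {ℤ.+[1+ _ ]} _ ()
    0<d : 0ℤ < + 4 * (a * c) - b * b
    0<d = ℤ.*-cancelˡ-<-nonNeg a ⦃ ℤ.nonNegative (ℤ.<⇒≤ 0<a) ⦄
      (subst (ℤ._< a * (+ 4 * (a * c) - b * b)) (sym (ℤ.*-zeroʳ a))
        (subst (0ℤ <_) (eval-vertex a b c) (pd (- b) (+ 2 * a) (λ (_ , e) → 2a≢0 0<a e))))
    0≤d-1 : 0ℤ ≤ + 4 * (a * c) - b * b - + 1
    0≤d-1 = ℤ.i≤j⇒0≤j-i (ℤ.i<j⇒suc[i]≤j 0<d)
    B : ℕ
    B = 4 ℕ.* (∣ a ∣ ℕ.+ ∣ c ∣) ℕ.* n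
    ∣y∣≤B : ∣ y ∣ ℕ.≤ B
    ∣y∣≤B = ℕ.≤-trans (bound a b c x y n (ℤ.<⇒≤ 0<a) 0≤d-1 eq)
      (ℕ.*-monoˡ-≤ n (ℕ.*-monoʳ-≤ 4 (ℕ.m≤m+n ∣ a ∣ ∣ c ∣)))
    ∣x∣≤B : ∣ x ∣ ℕ.≤ B
    ∣x∣≤B = ℕ.≤-trans
      (bound c b a y x n (ℤ.<⇒≤ 0<c) (subst (0ℤ ≤_) (disc-swap a b c) 0≤d-1)
        (trans (sym (eval-swap a b c x y)) eq))
      (ℕ.*-monoˡ-≤ n (ℕ.*-monoʳ-≤ 4 (ℕ.m≤n+m ∣ c ∣ ∣ a ∣)))

  box-unique : ∀ Q n → Unique (box Q n)
  box-unique (form a b c) n = Unique.cartesianProduct⁺ (interval-unique B) (interval-unique B)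
    where B = 4 ℕ.* (∣ a ∣ ℕ.+ ∣ c ∣) ℕ.* n

-- SchoenebergPair D Qₛ Qᵣ has exactly one solution (Qₛ , Qᵣ) for each
-- D ≡ 23 (mod 24), since (D+1)/24 < 6 leaves only D = 23, 47, 71, 95, 119.
data SchoenebergPair : ℕ → Form → Form → Set where
  generic : ∀ {D} → D ℕ.% 24 ≡ 23 → 6 ℕ.≤ (D ℕ.+ 1) ℕ./ 24 →
    SchoenebergPair D (form (+ 6) (+ 1) (+ ((D ℕ.+ 1) ℕ./ 24)))
                      (form (+ 6) (+ 5) (+ ((D ℕ.+ 25) ℕ./ 24)))
  D=23  : SchoenebergPair 23  (form (+ 1) (+ 1) (+ 6)) (form (+ 2) (+ 1) (+ 3))
  D=47  : SchoenebergPair 47  (form (+ 2) (+ 1) (+ 6)) (form (+ 3) (+ 1) (+ 4))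
  D=71  : SchoenebergPair 71  (form (+ 3) (+ 1) (+ 6)) (form (+ 4) (+ 3) (+ 5))
  D=95  : SchoenebergPair 95  (form (+ 4) (+ 1) (+ 6)) (form (+ 5) (+ 5) (+ 6))
  D=119 : SchoenebergPair 119 (form (+ 5) (+ 1) (+ 6)) (form (+ 6) (+ 5) (+ 6))

{-# OPTIONS --safe #-}

-- Existence.  By Euler's pentagonal number theorem η(24z) = Σ_{n≥1} χ(n) q^{n²} with χ = (12/·), so the
-- coefficients of η(z)η(Dz) sum χ(X)χ(Y) over the solutions X, Y ≥ 1 of X² + DY² = 24n.  As
-- 24(6x² + κxy + ky²) = (12x + κy)² + Dy² for κ = 1, 5, the two theta functions count the integral solutions with
-- X ≡ Y and X ≡ 5Y (mod 12), and after summing over the sign of X these indicators differ by χ(X)χ(Y).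
--
-- Uniqueness.  Besides the numbers ax², a reduced form (a, b, c) with b ≥ 0 represents below min(3c, a + b + c)
-- only c and a - b + c, each once up to sign.  The coefficients of η(z)^r η(Dz)^s less than D steps past the leading
-- one are those of ∏(1 - q^n)^r.  If r = 0, the two forms represent the same numbers in that range, which their
-- discriminants exclude.  Otherwise the next few coefficients and the equality of the discriminants leave r = 1 and
-- the Schoeneberg pairs, apart from two candidates in which D is 623 or 815 and hence not prime.

module Submission where

open import Defs
open import Data.Empty using (⊥)
open import Data.Fin using (Fin; toℕ)
import Data.Fin.Properties as Fin
open import Data.List using (List; []; _∷_; _++_; applyUpTo; cartesianProduct; filter; foldr; length; map; upTo)
open import Data.List.Membership.Propositional using (_∈_)
open import Data.List.Membership.Propositional.Properties using (∈-++⁺ˡ; ∈-++⁺ʳ; ∈-++⁻; ∈-cartesianProduct⁺; ∈-filter⁺; ∈-filter⁻; ∈-map⁺; ∈-map⁻; ∈-upTo⁺; ∈-∃++)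
open import Data.List.Properties using (applyUpTo-∷ʳ; filter-++; filter-accept; filter-none; filter-reject; length-++; length-map; map-upTo)
open import Data.List.Relation.Unary.All as All using ([]; _∷_)
import Data.List.Relation.Unary.All.Properties as All
open import Data.List.Relation.Unary.AllPairs using ([]; _∷_)
open import Data.List.Relation.Unary.Any using (here; there)
open import Data.List.Relation.Unary.Unique.Propositional using (Unique)
import Data.List.Relation.Unary.Unique.Propositional.Properties as Unique
open import Data.Nat using (ℕ; _%_)
open import Data.Nat.Divisibility using (divides)
open import Data.Nat.GCD using (gcd-zeroˡ)
open import Data.Nat.Induction using (<-wellFounded; Acc; acc)
open import Data.Nat.Primality using (Prime; prime⇒irreducible; prime⇒nonTrivial; prime⇒nonZero)
open import Data.Product using (_×_; _,_; ∃-syntax; proj₁; proj₂)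
import Data.Rational as ℚ
import Data.Rational.Properties as ℚ
open import Data.Rational.Unnormalised using (mkℚᵘ; *≡*)
open import Data.Sum using (_⊎_; inj₁; inj₂; [_,_]′)
open import Data.Unit using (tt)
open import Function using (_∘_)
open import Function.Bundles using (_⇔_; mk⇔)
open import Relation.Binary.Definitions using (tri<; tri≈; tri>)
open import Relation.Binary.PropositionalEquality using (_≡_; _≢_; refl; sym; trans; cong; cong₂; subst; subst₂; module ≡-Reasoning)
open import Relation.Nullary using (¬_; Dec; yes; no; contradiction)
open import Relation.Nullary.Decidable using (_×-dec_; toWitness; toWitnessFalse)
open import Relation.Unary using (Decidable)

-- No modularity is used: existence is an identity of all coefficients, while uniqueness needs only
-- the finitely many coefficients in which a reduced form has very few vectors. The sign of the
-- difference carries much of the argument. An eta quotient starts with the coefficient +1, so at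
-- the first exponent `m` the form `Qₛ` has exactly two representations more than `Qᵣ`, and this
-- settles which of the two forms may be the first to represent a new number. Primality of `D`
-- enters in several ways: an eta quotient has just two exponents; `4ac - b² = D` forces `b > 0`,
-- and `b < a < c` unless `a = 1`, so that `a`, `c` and `a - b + c` are different numbers when
-- `a > 1`; and it rejects the stray solutions `D = 44, 76, 623, 815` of the discriminant equations.
-- Since conjugate forms have the same theta function, the middle coefficient is replaced by its
-- absolute value, and the comparison of the two forms takes place in natural numbers.

-- The discriminant equation `D + b² = 4ac` in natural numbers

module Arithmetic where

  open import Data.Nat using (zero; suc; _+_; _∸_; _*_; _≤_; _<_; _≤?_; s≤s; z≤n; s≤s⁻¹; NonZero; >-nonZero; nonTrivial⇒n>1)
  open import Data.Nat.Divisibility using (_∣_; _∣?_; ∣m+n∣m⇒∣n; m∣m*n)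
  open import Data.Nat.Properties
  open import Data.Nat.Tactic.RingSolver using (solve-∀)
  open import Data.Integer using (+_)

  -- Polynomial inequalities are proved by exhibiting the difference as a polynomial with
  -- nonnegative coefficients, after `slack` has replaced each variable by its lower bound plus an
  -- excess. This is the origin of the long explicit witnesses below.
  ≤-slack : ∀ {m n} k → n ≡ m + k → m ≤ n
  ≤-slack {m} k e = subst (m ≤_) (sym e) (m≤m+n m k)

  slack : ∀ {m n} → m ≤ n → ∃[ k ] n ≡ m + k
  slack {m} {n} m≤n = n ∸ m , sym (m+[n∸m]≡n m≤n)

  ≢-slack : ∀ {m n} k → n ≡ m + suc k → m ≢ n
  ≢-slack {m} k e refl = m≢1+m+n m (trans e (+-suc m k))

  prime⇒2≤ : ∀ {p} → Prime p → 2 ≤ p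
  prime⇒2≤ {p} pr = nonTrivial⇒n>1 p {{prime⇒nonTrivial pr}}

  composite : ∀ m n → 2 ≤ m → 2 ≤ n → ¬ Prime (m * n)
  composite m n 2≤m 2≤n p with prime⇒irreducible p (m∣m*n {m} n)
  ... | inj₁ refl = contradiction 2≤m λ { (s≤s ()) }
  ... | inj₂ e    = contradiction 2≤n
    (<⇒≱ (s≤s (≤-reflexive (*-cancelˡ-≡ n 1 m {{>-nonZero (<⇒≤ 2≤m)}} (trans (sym e) (sym (*-identityʳ m)))))))

  module _ {D : ℕ} (p : Prime D) where

    private instance
      D-nonZero : NonZero D
      D-nonZero = prime⇒nonZero p

    module _ {a b c : ℕ} (b≤a : b ≤ a) (a≤c : a ≤ c) (disc : D + b * b ≡ 4 * (a * c)) where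

      -- With `b = 0` the equation makes `D` equal to `2 (2ac)`, which is 0 or composite.
      1≤b : 1 ≤ b
      1≤b = go b disc
        where
        2D : D + 0 ≡ 4 * (a * c) → D ≡ 2 * (2 * (a * c))
        2D e = trans (sym (+-identityʳ D)) (trans e (*-assoc 2 2 (a * c)))
        go : ∀ b → D + b * b ≡ 4 * (a * c) → 1 ≤ b
        go (suc b) _ = s≤s z≤n
        go zero    e with a * c | 2D e
        ... | zero  | e′ = contradiction e′ (λ e″ → contradiction (subst (2 ≤_) e″ (prime⇒2≤ p)) λ ())
        ... | suc k | e′ = contradiction (subst Prime e′ p) (composite 2 (2 * suc k) ≤-refl (≤-slack {2} (2 * k)
          (eq k)))
          where
          eq : ∀ k → 2 * suc k ≡ 2 + 2 * k
          eq = solve-∀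

      -- If `b = a`, then `a` divides `4ac - b² = D`, so it is 1 or `D`; and `a = D` would give
      -- `D + 1 = 4c ≥ 4D`.
      b≡a⇒a≡1 : b ≡ a → a ≡ 1
      b≡a⇒a≡1 refl with prime⇒irreducible p (∣m+n∣m⇒∣n {m = b * b} (divides (4 * c) (trans (+-comm (b * b) D)
        (trans disc (eq b c)))) (m∣m*n b))
        where
        eq : ∀ b c → 4 * (b * c) ≡ 4 * c * b
        eq = solve-∀
      ... | inj₁ e    = e
      ... | inj₂ refl = contradiction (*-cancelˡ-≡ (suc D) (4 * c) D (trans (eq D c) (trans disc (eq′ D c)))) (<⇒≢ lt)
        where
        eq : ∀ D c → D * suc D ≡ D + D * D
        eq = solve-∀
        eq′ : ∀ D c → 4 * (D * c) ≡ D * (4 * c)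
        eq′ = solve-∀
        lt : suc D < 4 * c
        lt with k , refl ← slack a≤c with j , refl ← slack (prime⇒2≤ p) = ≤-slack {suc (3 + j)} (4 + 3 * j + 4 * k)
          (eq″ j k)
          where
          eq″ : ∀ j k → 4 * (2 + j + k) ≡ suc (3 + j) + (4 + 3 * j + 4 * k)
          eq″ = solve-∀

      -- For `a = c` the equation factors as `D = (2a + b)(2a - b)`, that is `(3b + 2t)(b + 2t)`
      -- with `a = b + t`. The smaller factor has to be 1.
      a≡c⇒a≡1 : a ≡ c → a ≡ 1
      a≡c⇒a≡1 refl with t , refl ← slack b≤a = go (prime⇒irreducible p (divides (3 * b + 2 * t) D≡))
        where
        eq : ∀ b t → 4 * ((b + t) * (b + t)) ≡ (3 * b + 2 * t) * (b + 2 * t) + b * b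
        eq = solve-∀
        D≡ : D ≡ (3 * b + 2 * t) * (b + 2 * t)
        D≡ = +-cancelʳ-≡ (b * b) D _ (trans disc (eq b t))
        go : b + 2 * t ≡ 1 ⊎ b + 2 * t ≡ D → b + t ≡ 1
        go (inj₁ e) = ≤-antisym (≤-trans (+-monoʳ-≤ b (m≤n*m t 2)) (≤-reflexive e)) (≤-trans 1≤b (m≤m+n b t))
        go (inj₂ e) = contradiction (*-cancelʳ-≡ 1 (3 * b + 2 * t) D (trans (*-identityˡ D)
          (trans D≡ (cong ((3 * b + 2 * t) *_) e))))
          (<⇒≢ (≤-trans (≤-trans (s≤s (s≤s z≤n)) (*-monoʳ-≤ 3 1≤b)) (m≤m+n (3 * b) (2 * t))))

    -- As `γ ≥ α + 1` and `β ≤ α - 1`, `4αγ - β²` is at least `3α² + 6α - 1`. This places all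
    -- numbers up to `4α` within the first `D` coefficients of the eta quotient.
    discriminant-large : ∀ {α β γ} → β < α → α < γ → 1 ≤ β → D + β * β ≡ 4 * (α * γ) → 3 * (α * α) + 4 * α < D
    discriminant-large {α} {β} {γ} β<α α<γ 1≤β disc with k , refl ← slack β<α with l , refl ← slack α<γ with b , refl ←
      slack 1≤β =
      +-cancelʳ-< (β * β) _ D (subst (3 * (α * α) + 4 * α + β * β <_) (sym disc)
        (≤-slack (2 + 2 * b + 4 * k + 2 * b * k + k * k + 4 * ((suc (1 + b) + k) * l)) (eq b k l)))
      where
      eq : ∀ b k l → 4 * ((suc (1 + b) + k) * (suc (suc (1 + b) + k) + l)) ≡
        suc (3 * ((suc (1 + b) + k) * (suc (1 + b) + k)) + 4 * (suc (1 + b) + k) + (1 + b) * (1 + b)) +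
          (2 + 2 * b + 4 * k + 2 * b * k + k * k + 4 * ((suc (1 + b) + k) * l))
      eq = solve-∀

  -- Equality of the discriminants of (a, b, c) and (a, a - 1, c + 1), where a = b + s + 1.
  equalLeading : ∀ b s → 4 * (b + s + 1) + b * b ≡ (b + s) * (b + s) → b ≡ 1 × s ≡ 4
  equalLeading b 0 e = contradiction (sym e) (≢-slack (3 + 4 * b) (eq b))
    where
    eq : ∀ b → 4 * (b + 0 + 1) + b * b ≡ (b + 0) * (b + 0) + suc (3 + 4 * b)
    eq = solve-∀
  equalLeading b 1 e = contradiction (sym e) (≢-slack (6 + 2 * b) (eq b))
    where
    eq : ∀ b → 4 * (b + 1 + 1) + b * b ≡ (b + 1) * (b + 1) + suc (6 + 2 * b)
    eq = solve-∀
  equalLeading b 2 e = contradiction (sym e) (≢-slack 7 (eq b))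
    where
    eq : ∀ b → 4 * (b + 2 + 1) + b * b ≡ (b + 2) * (b + 2) + 8
    eq = solve-∀
  -- The equation reads `2b (s - 2) = 4s + 4 - s²`. The right side is positive for `s ≤ 2`, odd for
  -- `s = 3`, yields `b = 1` for `s = 4`, and is negative from `s = 5` on.
  equalLeading b 3 e = contradiction (+-cancelˡ-≡ (b * b + 4 * b + 9) (2 * b) 7 (trans (eq b) (trans (sym e) (eq′ b))))
    (even≢odd b 3)
    where
    eq : ∀ b → b * b + 4 * b + 9 + 2 * b ≡ (b + 3) * (b + 3)
    eq = solve-∀
    eq′ : ∀ b → 4 * (b + 3 + 1) + b * b ≡ b * b + 4 * b + 9 + 7
    eq′ = solve-∀
  equalLeading b 4 e = *-cancelˡ-≡ b 1 4 (+-cancelˡ-≡ (b * b + 4 * b + 16) (4 * b) 4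
    (trans (eq b) (trans (sym e) (eq′ b)))) , refl
    where
    eq : ∀ b → b * b + 4 * b + 16 + 4 * b ≡ (b + 4) * (b + 4)
    eq = solve-∀
    eq′ : ∀ b → 4 * (b + 4 + 1) + b * b ≡ b * b + 4 * b + 16 + 4
    eq′ = solve-∀
  equalLeading b (suc (suc (suc (suc (suc t))))) e = contradiction e (≢-slack (6 * b + 2 * b * t + 6 * t + t * t)
    (eq b t))
    where
    eq : ∀ b t → (b + (5 + t)) * (b + (5 + t)) ≡ 4 * (b + (5 + t) + 1) + b * b + suc (6 * b + 2 * b * t + 6 * t + t * t)
    eq = solve-∀

  -- Equality of the discriminants of (a, b, a + 3 + t) and (a + 1, β, a + 2), where a = b + d.
  ConsecutiveLeading : ℕ → ℕ → ℕ → ℕ → Set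
  ConsecutiveLeading b d t β = 4 * ((b + d) * t) + β * β ≡ b * b + 8

  -- With `β = a = b + d` the equation is `d (2b + d) = 8`: parity excludes `d = 1`, `d = 2` gives
  -- `b = 1` and `a = 3`, and for `d ≥ 3` the left side is too large.
  consecutive-0 : ∀ b d → 1 ≤ d → 4 ≤ b + d → 1 ≤ b → ¬ ConsecutiveLeading b d 0 (b + d)
  consecutive-0 b 1 _ _ _ e = even≢odd b 3 (+-cancelˡ-≡ (b * b + 1) (2 * b) 7
    (trans (eq b) (trans e (sym (+-assoc (b * b) 1 7)))))
    where
    eq : ∀ b → b * b + 1 + 2 * b ≡ 4 * ((b + 1) * 0) + (b + 1) * (b + 1)
    eq = solve-∀
  consecutive-0 b 2 _ 4≤b+2 _ e with k , refl ← slack (+-cancelʳ-≤ 2 2 b 4≤b+2) = ≢-slack (3 + 4 * k) (eq k) (sym e)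
    where
    eq : ∀ k → 4 * ((2 + k + 2) * 0) + (2 + k + 2) * (2 + k + 2) ≡ (2 + k) * (2 + k) + 8 + suc (3 + 4 * k)
    eq = solve-∀
  consecutive-0 b (suc (suc (suc d))) _ _ _ e = ≢-slack (d * 6 + d * d + 2 * b * (3 + d)) (eq b d) (sym e)
    where
    eq : ∀ b d → 4 * ((b + (3 + d)) * 0) + (b + (3 + d)) * (b + (3 + d)) ≡ b * b + 8 + suc (d * 6 + d * d + 2 * b *
      (3 + d))
    eq = solve-∀

  -- Here `β = a - 1` is at least `b`, and `4a ≥ 16` exceeds 8.
  consecutive-1 : ∀ b d → 3 ≤ b + d → ¬ ConsecutiveLeading b (suc d) 1 (b + d)
  consecutive-1 b d 3≤b+d e with k , b+d≡ ← slack 3≤b+d =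
    ≢-slack (7 + 4 * k + 2 * b * d + d * d) (trans (eq₁ b d) (trans (cong (λ s → 4 * s + 4 + 2 * b * d + d * d + b * b)
      b+d≡) (eq₂ b d k))) (sym e)
    where
    eq₁ : ∀ b d → 4 * ((b + suc d) * 1) + (b + d) * (b + d) ≡ 4 * (b + d) + 4 + 2 * b * d + d * d + b * b
    eq₁ = solve-∀
    eq₂ : ∀ b d k → 4 * (3 + k) + 4 + 2 * b * d + d * d + b * b ≡ b * b + 8 + suc (7 + 4 * k + 2 * b * d + d * d)
    eq₂ = solve-∀

  consecutive-2-1 : ∀ β → ¬ ConsecutiveLeading (β + 2) 1 2 β
  consecutive-2-1 β e = ≢-slack (11 + 4 * β) (eq β) (sym e)
    where
    eq : ∀ β → 4 * ((β + 2 + 1) * 2) + β * β ≡ (β + 2) * (β + 2) + 8 + suc (11 + 4 * β)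
    eq = solve-∀

  -- The equation reads `2β (k - 4) = 8k + 8 - k²`. For `k ≤ 4` the two sides have different signs,
  -- `k = 5` and `k = 7` fail by parity, `k = 6` and `k = 8` give the two solutions, and from
  -- `k = 9` on the right side is negative.
  consecutive-2-2 : ∀ β k → 3 ≤ k → ConsecutiveLeading (β + k) 2 2 β → (β ≡ 5 × k ≡ 6) ⊎ (β ≡ 1 × k ≡ 8)
  consecutive-2-2 β 1 (s≤s ()) _
  consecutive-2-2 β 2 (s≤s (s≤s ())) _
  consecutive-2-2 β 3 _ e = contradiction (sym e) (≢-slack (22 + 2 * β) (eq β))
    where
    eq : ∀ β → 4 * ((β + 3 + 2) * 2) + β * β ≡ (β + 3) * (β + 3) + 8 + suc (22 + 2 * β)
    eq = solve-∀
  consecutive-2-2 β 4 _ e = contradiction (sym e) (≢-slack 23 (eq β))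
    where
    eq : ∀ β → 4 * ((β + 4 + 2) * 2) + β * β ≡ (β + 4) * (β + 4) + 8 + 24
    eq = solve-∀
  consecutive-2-2 β 5 _ e = contradiction (+-cancelˡ-≡ (β * β + 8 * β + 33) (2 * β) 23
    (trans (eq₁ β) (trans (sym e) (eq₂ β)))) (even≢odd β 11)
    where
    eq₁ : ∀ β → β * β + 8 * β + 33 + 2 * β ≡ (β + 5) * (β + 5) + 8
    eq₁ = solve-∀
    eq₂ : ∀ β → 4 * ((β + 5 + 2) * 2) + β * β ≡ β * β + 8 * β + 33 + 23
    eq₂ = solve-∀
  consecutive-2-2 β 6 _ e = inj₁ (*-cancelˡ-≡ β 5 4 (+-cancelˡ-≡ (β * β + 8 * β + 44) (4 * β) 20
    (trans (eq₁ β) (trans (sym e) (eq₂ β)))) , refl)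
    where
    eq₁ : ∀ β → β * β + 8 * β + 44 + 4 * β ≡ (β + 6) * (β + 6) + 8
    eq₁ = solve-∀
    eq₂ : ∀ β → 4 * ((β + 6 + 2) * 2) + β * β ≡ β * β + 8 * β + 44 + 20
    eq₂ = solve-∀
  consecutive-2-2 β 7 _ e = contradiction (+-cancelˡ-≡ (β * β + 8 * β + 57) (2 * (3 * β)) 15
    (trans (eq₁ β) (trans (sym e) (eq₂ β)))) (even≢odd (3 * β) 7)
    where
    eq₁ : ∀ β → β * β + 8 * β + 57 + 2 * (3 * β) ≡ (β + 7) * (β + 7) + 8
    eq₁ = solve-∀
    eq₂ : ∀ β → 4 * ((β + 7 + 2) * 2) + β * β ≡ β * β + 8 * β + 57 + 15
    eq₂ = solve-∀
  consecutive-2-2 β 8 _ e = inj₂ (*-cancelˡ-≡ β 1 8 (+-cancelˡ-≡ (β * β + 8 * β + 72) (8 * β) 8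
    (trans (eq₁ β) (trans (sym e) (eq₂ β)))) , refl)
    where
    eq₁ : ∀ β → β * β + 8 * β + 72 + 8 * β ≡ (β + 8) * (β + 8) + 8
    eq₁ = solve-∀
    eq₂ : ∀ β → 4 * ((β + 8 + 2) * 2) + β * β ≡ β * β + 8 * β + 72 + 8
    eq₂ = solve-∀
  consecutive-2-2 β (suc (suc (suc (suc (suc (suc (suc (suc (suc t))))))))) _ e =
    contradiction e (≢-slack (10 * β + 2 * β * t + 10 * t + t * t) (eq β t))
    where
    eq : ∀ β t → (β + (9 + t)) * (β + (9 + t)) + 8 ≡ 4 * ((β + (9 + t) + 2) * 2) + β * β + suc (10 * β + 2 * β * t + 10
      * t + t * t)
    eq = solve-∀

  private
    SmallPair : ℕ → ℕ → ℕ → ℕ → ℕ → Set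
    SmallPair D a b c β = D + 1 ≡ 24 * a × SchoenebergPair D (form (+ a) (+ b) (+ c)) (form (+ (a + 1)) (+ β)
      (+ (a + 2)))

    transport : ∀ {D D₀ a b b₀ c c₀ β β₀} → D₀ ≡ D → b₀ ≡ b → c₀ ≡ c → β₀ ≡ β → SmallPair D₀ a b₀ c₀ β₀ → SmallPair D a
      b c β
    transport refl refl refl refl s = s

    one-two : ∀ {n} → 1 ≤ n → n ≤ 2 → n ≡ 1 ⊎ n ≡ 2
    one-two {1} _ _ = inj₁ refl
    one-two {2} _ _ = inj₂ refl
    one-two {suc (suc (suc _))} _ (s≤s (s≤s ()))

    one-two-three : ∀ {n} → 1 ≤ n → n ≤ 3 → (n ≡ 1 ⊎ n ≡ 2) ⊎ n ≡ 3
    one-two-three {1} _ _ = inj₁ (inj₁ refl)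
    one-two-three {2} _ _ = inj₁ (inj₂ refl)
    one-two-three {3} _ _ = inj₂ refl
    one-two-three {suc (suc (suc (suc _)))} _ (s≤s (s≤s (s≤s ())))

    level : ∀ {D x} x₀ D₀ {N} → D + x * x ≡ N → x ≡ x₀ → N ≡ D₀ + x₀ * x₀ → D ≡ D₀
    level {D} x₀ D₀ e refl e′ = +-cancelʳ-≡ (x₀ * x₀) D D₀ (trans e e′)

    last : ∀ {D b} b₀ D₀ k c₀ c .{{_ : NonZero k}} → D + b * b ≡ k * c → D ≡ D₀ → b ≡ b₀ → D₀ + b₀ * b₀ ≡ k * c₀ → c ≡
      c₀
    last b₀ D₀ k c₀ c e refl refl e′ = *-cancelˡ-≡ c c₀ k (trans (sym e) e′)

    indivisible : ∀ {D b} b₀ D₀ k c → D + b * b ≡ k * c → D ≡ D₀ → b ≡ b₀ → ¬ k ∣ D₀ + b₀ * b₀ → ∀ {A : Set} → A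
    indivisible b₀ D₀ k c e refl refl k∤ = contradiction (divides c (trans e (*-comm k c))) k∤

    small₁ : ∀ {D b c β} → 1 ≤ b → b ≤ 1 → 1 ≤ β → β ≤ 1 → D + b * b ≡ 4 * c → D + β * β ≡ 24 → SmallPair D 1 b c β
    small₁ {c = c} 1≤b b≤1 1≤β β≤1 e e′ = transport (sym D≡) (sym b≡) (sym (last 1 23 4 6 c e D≡ b≡ refl)) (sym β≡)
      (refl , D=23)
      where
      b≡ = ≤-antisym b≤1 1≤b
      β≡ = ≤-antisym β≤1 1≤β
      D≡ = level 1 23 e′ β≡ refl

    small₂ : ∀ {D b c β} → Prime D → 1 ≤ b → b < 2 → 1 ≤ β → β ≤ 2 → D + b * b ≡ 8 * c → D + β * β ≡ 48 → SmallPair D 2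
      b c β
    small₂ {c = c} p 1≤b (s≤s b≤1) 1≤β β≤2 e e′ with one-two 1≤β β≤2
    ... | inj₁ β≡ = transport (sym D≡) (sym b≡) (sym (last 1 47 8 6 c e D≡ b≡ refl)) (sym β≡) (refl , D=47)
      where
      b≡ = ≤-antisym b≤1 1≤b
      D≡ = level 1 47 e′ β≡ refl
    ... | inj₂ β≡ = contradiction (subst Prime (level 2 44 e′ β≡ refl) p) (composite 2 22 (s≤s (s≤s z≤n))
      (s≤s (s≤s z≤n)))

    small₃ : ∀ {D b c β} → Prime D → 1 ≤ b → b < 3 → 1 ≤ β → β ≤ 3 → D + b * b ≡ 12 * c → D + β * β ≡ 80 → SmallPair D 3
      b c β
    small₃ {c = c} p 1≤b (s≤s b≤2) 1≤β β≤3 e e′ with one-two 1≤b b≤2 | one-two-three 1≤β β≤3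
    ... | inj₁ b≡ | inj₂ β≡        = transport (sym D≡) (sym b≡) (sym (last 1 71 12 6 c e D≡ b≡ refl)) (sym β≡)
      (refl , D=71)
      where
      D≡ = level 3 71 e′ β≡ refl
    ... | inj₂ b≡ | inj₂ β≡        = indivisible 2 71 12 c e (level 3 71 e′ β≡ refl) b≡ (toWitnessFalse {a? = 12 ∣? 75}
      tt)
    ... | inj₁ b≡ | inj₁ (inj₁ β≡) = indivisible 1 79 12 c e (level 1 79 e′ β≡ refl) b≡ (toWitnessFalse {a? = 12 ∣? 80}
      tt)
    ... | inj₂ b≡ | inj₁ (inj₁ β≡) = indivisible 2 79 12 c e (level 1 79 e′ β≡ refl) b≡ (toWitnessFalse {a? = 12 ∣? 83}
      tt)
    ... | _       | inj₁ (inj₂ β≡) = contradiction (subst Prime (level 2 76 e′ β≡ refl) p)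
      (composite 2 38 (s≤s (s≤s z≤n)) (s≤s (s≤s z≤n)))

  -- The second equation computes `D` from `a` and `β`, and the first then asks that `4a` divide
  -- `D + b²`. The values `D = 44` and `D = 76` are not prime, and 12 does not divide `71 + 4`,
  -- `79 + 1` or `79 + 4`; what remains is `D = 23, 47, 71`.
  smallPair : ∀ {D} → Prime D → ∀ a b c β → 1 ≤ a → a ≤ 3 → 1 ≤ b → b ≤ a → (b ≡ a → a ≡ 1) → 1 ≤ β → β ≤ a →
    D + b * b ≡ 4 * (a * c) → D + β * β ≡ 4 * ((a + 1) * (a + 2)) →
    D + 1 ≡ 24 * a × SchoenebergPair D (form (+ a) (+ b) (+ c)) (form (+ (a + 1)) (+ β) (+ (a + 2)))
  smallPair p a b c β 1≤a a≤3 1≤b b≤a b≡a⇒ 1≤β β≤a e e′ with one-two-three 1≤a a≤3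
  ... | inj₁ (inj₁ refl) = small₁ {c = c} 1≤b b≤a 1≤β β≤a (trans e (cong (4 *_) (*-identityˡ c))) e′
  ... | inj₁ (inj₂ refl) = small₂ {c = c} p 1≤b (≤∧≢⇒< b≤a (λ b≡ → contradiction (b≡a⇒ b≡) λ ())) 1≤β β≤a
    (trans e (sym (*-assoc 4 2 c))) e′
  ... | inj₂ refl        = small₃ {c = c} p 1≤b (≤∧≢⇒< b≤a (λ b≡ → contradiction (b≡a⇒ b≡) λ ())) 1≤β β≤a
    (trans e (sym (*-assoc 4 3 c))) e′

  -- The discriminant equation in the configurations left when the coefficient of q after the leading term vanishes.
  gap-0 : ∀ {a b α β γ} → 4 * (a * α) + β * β ≡ 4 * (α * γ) + b * b → β < α → α ≤ 4 * a → ¬ 4 * a ≤ γ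
  gap-0 {a} {b} {α} {β} disc β<α α≤4a 4a≤γ with v , refl ← slack 4a≤γ = <⇒≱ (*-mono-< β<α β<α)
    (≤-trans (*-monoʳ-≤ α α≤4a)
    (≤-slack (8 * (a * α) + 4 * (α * v) + b * b) (+-cancelˡ-≡ (4 * (a * α)) _ _ (trans disc (eq a b α v)))))
    where
    eq : ∀ a b α v → 4 * (α * (4 * a + v)) + b * b ≡ 4 * (a * α) + (α * (4 * a) + (8 * (a * α) + 4 * (α * v) + b * b))
    eq = solve-∀

  -- With `a = b + d`, the equation gives `β² = 4α (γ - a) + b² ≥ 4α (α - b) + b² = (2α - b)² ≥ α²`.
  gap-1 : ∀ {b d α β γ} → 4 * ((b + d) * α) + β * β ≡ 4 * (α * γ) + b * b → β < α → b ≤ α → ¬ α + d ≤ γ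
  gap-1 {b} {d} {α} {β} disc β<α b≤α α+d≤γ with v , refl ← slack α+d≤γ with k , refl ← slack b≤α = <⇒≱
    (*-mono-< β<α β<α)
    (≤-slack (2 * (b * k) + 3 * (k * k) + 4 * ((b + k) * v)) (+-cancelˡ-≡ (4 * ((b + d) * (b + k))) _ _
      (trans disc (eq b d k v))))
    where
    eq : ∀ b d k v → 4 * ((b + k) * (b + k + d + v)) + b * b ≡ 4 * ((b + d) * (b + k)) + ((b + k) * (b + k) +
      (2 * (b * k) + 3 * (k * k) + 4 * ((b + k) * v)))
    eq = solve-∀

  gap-2 : ∀ {a b c β γ} → 4 * (a * c) + β * β ≡ 4 * (4 * a * γ) + b * b → β < 4 * a → 4 * a < c → ¬ c ≤ γ
  gap-2 {a} {b} {c} {β} disc β<4a 4a<c c≤γ with v , refl ← slack c≤γ with w , refl ← slack 4a<c = <⇒≱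
    (*-mono-< β<4a β<4a)
    (≤-slack (32 * (a * a) + 12 * a * suc w + 16 * (a * v) + b * b) (+-cancelˡ-≡ (4 * (a * (suc (4 * a) + w))) _ _
      (trans disc (eq a b v w))))
    where
    eq : ∀ a b v w → 4 * (4 * a * (suc (4 * a) + w + v)) + b * b ≡ 4 * (a * (suc (4 * a) + w)) +
      (4 * a * (4 * a) + (32 * (a * a) + 12 * a * suc w + 16 * (a * v) + b * b))
    eq = solve-∀

  -- For `α = 4a` and `γ = 9a` the equation gives `β² ≥ 144a² - 4ac`, far beyond `16a²` if
  -- `c ≤ 13a`. The constant 13 is `9 + 4`, from the bound `γ + δ < 9a + 4a` on the corner of the
  -- second form.
  gap-3 : ∀ {a b c β} → 4 * (a * c) + β * β ≡ 4 * (4 * a * (9 * a)) + b * b → β < 4 * a → ¬ c ≤ 13 * a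
  gap-3 {a} {b} {c} {β} disc β<4a c≤13a = <⇒≱ (+-mono-≤-< (*-monoʳ-≤ 4 (*-monoʳ-≤ a c≤13a)) (*-mono-< β<4a β<4a))
    (≤-trans (≤-slack (76 * (a * a) + b * b) (eq a b)) (≤-reflexive (sym disc)))
    where
    eq : ∀ a b → 4 * (4 * a * (9 * a)) + b * b ≡ 4 * (a * (13 * a)) + 4 * a * (4 * a) + (76 * (a * a) + b * b)
    eq = solve-∀

  square-≥2 : ∀ a n k → a < n → a * (k * k) ≡ n → 4 * a ≤ n
  square-≥2 a n 0 a<n e = contradiction (subst (_≤ a) (trans (sym (*-zeroʳ a)) e) z≤n) (<⇒≱ a<n)
  square-≥2 a n 1 a<n e = contradiction (trans (sym (*-identityʳ a)) e) (<⇒≢ a<n)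
  square-≥2 a n (suc (suc k)) _ e = ≤-slack (a * (k * 4 + k * k)) (trans (sym e) (eq a k))
    where
    eq : ∀ a k → a * (suc (suc k) * suc (suc k)) ≡ 4 * a + a * (k * 4 + k * k)
    eq = solve-∀

  square-≥3 : ∀ a n k → 4 * a < n → a * (k * k) ≡ n → 9 * a ≤ n
  square-≥3 a n 2 4a<n e = contradiction (trans (*-comm 4 a) e) (<⇒≢ 4a<n)
  square-≥3 a n 0 4a<n e = contradiction (subst (_≤ 4 * a) (trans (sym (*-zeroʳ a)) e) z≤n) (<⇒≱ 4a<n)
  square-≥3 a n 1 4a<n e = contradiction (subst (_≤ 4 * a) (trans (sym (*-identityʳ a)) e) (m≤n*m a 4)) (<⇒≱ 4a<n)
  square-≥3 a n (suc (suc (suc k))) _ e = ≤-slack (a * (k * 6 + k * k)) (trans (sym e) (eq a k))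
    where
    eq : ∀ a k → a * (suc (suc (suc k)) * suc (suc (suc k))) ≡ 9 * a + a * (k * 6 + k * k)
    eq = solve-∀

  square-≥4 : ∀ a n k → 9 * a < n → a * (k * k) ≡ n → 16 * a ≤ n
  square-≥4 a n k 9a<n e with k ≤? 3
  ... | yes k≤3 = contradiction (subst (_≤ 9 * a) e (≤-trans (*-monoʳ-≤ a (*-mono-≤ k≤3 k≤3))
    (≤-reflexive (*-comm a 9)))) (<⇒≱ 9a<n)
  ... | no k≰3 = subst (16 * a ≤_) e (≤-trans (≤-reflexive (*-comm 16 a)) (*-monoʳ-≤ a (*-mono-≤ (≰⇒> k≰3) (≰⇒> k≰3))))

  -- The remaining candidates a = 11, 13 have D = 7·89 and D = 5·163.
  lastCandidates : ∀ {D} → Prime D → ∀ β k → 3 ≤ k → D + (β + k) * (β + k) ≡ 4 * ((β + k + 2) * (β + k + 2 + 5)) → ¬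
    ConsecutiveLeading (β + k) 2 2 β
  lastCandidates {D} p β k 3≤k disc e with consecutive-2-2 β k 3≤k e
  ... | inj₁ (refl , refl) = contradiction (subst Prime (+-cancelʳ-≡ 121 D 815 disc) p) (composite 5 163 (s≤s (s≤s z≤n))
    (s≤s (s≤s z≤n)))
  ... | inj₂ (refl , refl) = contradiction (subst Prime (+-cancelʳ-≡ 81 D 623 disc) p) (composite 7 89 (s≤s (s≤s z≤n))
    (s≤s (s≤s z≤n)))

open Arithmetic

open import Data.Integer as ℤ using (ℤ; +_; -[1+_]; 0ℤ; 1ℤ; -1ℤ; ∣_∣; -_; _+_; _-_; _*_; +<+; +≤+)
import Data.Integer.DivMod as ℤ
import Data.Integer.Divisibility.Signed as Signed
import Data.Integer.Properties as ℤ
import Data.Integer.Tactic.RingSolver as ℤRing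
open import Data.Nat as ℕ using (zero; suc; s≤s; z≤n)
import Data.Nat.DivMod as ℕ
open import Data.Nat.Divisibility using (_∣_; _∣?_; ∣-refl; ∣⇒≤; 1∣_)
import Data.Nat.Properties as ℕ
import Data.Nat.Tactic.RingSolver as ℕRing
open import Algebra.Properties.Semiring.Sum ℤ.+-*-semiring using (sum; ∑-comm; *-distribˡ-sum; *-distribʳ-sum)

-- Finite sums and Euler’s pentagonal number theorem

Σ< : ℕ → (ℕ → ℤ) → ℤ
Σ< n f = sum {n} (λ i → f (toℕ i))

Σ-cong : ∀ n {f g : ℕ → ℤ} → (∀ i → i ℕ.< n → f i ≡ g i) → Σ< n f ≡ Σ< n g
Σ-cong zero    f≗g = refl
Σ-cong (suc n) f≗g = cong₂ _+_ (f≗g 0 (s≤s z≤n)) (Σ-cong n (λ i i<n → f≗g (suc i) (s≤s i<n)))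

Σ-zero : ∀ n {f : ℕ → ℤ} → (∀ i → i ℕ.< n → f i ≡ 0ℤ) → Σ< n f ≡ 0ℤ
Σ-zero zero    f≗0 = refl
Σ-zero (suc n) f≗0 = cong₂ _+_ (f≗0 0 (s≤s z≤n)) (Σ-zero n (λ i i<n → f≗0 (suc i) (s≤s i<n)))

Σ-single : ∀ n {f : ℕ → ℤ} i → i ℕ.< n → (∀ j → j ℕ.< n → j ≢ i → f j ≡ 0ℤ) → Σ< n f ≡ f i
Σ-single (suc n) {f} zero    _         f≗0 = trans
  (cong (_+_ (f 0)) (Σ-zero n (λ j j<n → f≗0 (suc j) (s≤s j<n) (λ ())))) (ℤ.+-identityʳ (f 0))
Σ-single (suc n) {f} (suc i) (s≤s i<n) f≗0 = trans
  (cong₂ _+_ (f≗0 0 (s≤s z≤n) (λ ()))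
    (Σ-single n i i<n (λ j j<n j≢i → f≗0 (suc j) (s≤s j<n) (λ e → j≢i (ℕ.suc-injective e)))))
  (ℤ.+-identityˡ (f (suc i)))

Σ-++ : ∀ m n (f : ℕ → ℤ) → Σ< (m ℕ.+ n) f ≡ Σ< m f + Σ< n (λ i → f (m ℕ.+ i))
Σ-++ zero    n f = sym (ℤ.+-identityˡ _)
Σ-++ (suc m) n f = trans (cong (_+_ (f 0)) (Σ-++ m n (λ i → f (suc i)))) (sym (ℤ.+-assoc (f 0) _ _))

Σ-last : ∀ n (f : ℕ → ℤ) → Σ< (suc n) f ≡ Σ< n f + f n
Σ-last zero    f = ℤ.+-comm (f 0) 0ℤ
Σ-last (suc n) f = trans (cong (_+_ (f 0)) (Σ-last n (λ i → f (suc i)))) (sym (ℤ.+-assoc (f 0) _ _))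

Σ-truncate : ∀ {m n} (f : ℕ → ℤ) → m ℕ.≤ n → (∀ i → m ℕ.≤ i → f i ≡ 0ℤ) → Σ< n f ≡ Σ< m f
Σ-truncate {m} {n} f m≤n f≗0 = begin
  Σ< n f                                    ≡⟨ cong (λ k → Σ< k f) (sym (ℕ.m+[n∸m]≡n m≤n)) ⟩
  Σ< (m ℕ.+ (n ℕ.∸ m)) f                    ≡⟨ Σ-++ m (n ℕ.∸ m) f ⟩
  Σ< m f + Σ< (n ℕ.∸ m) (λ i → f (m ℕ.+ i)) ≡⟨ cong (_+_ (Σ< m f)) (Σ-zero (n ℕ.∸ m) (λ i _ → f≗0 (m ℕ.+ i)
    (ℕ.m≤m+n m i))) ⟩
  Σ< m f + 0ℤ                               ≡⟨ ℤ.+-identityʳ _ ⟩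
  Σ< m f                                    ∎
  where open ≡-Reasoning

𝟙 : ∀ {p} {P : Set p} → Dec P → ℤ
𝟙 (yes _) = 1ℤ
𝟙 (no _)  = 0ℤ

𝟙-yes : ∀ {p} {P : Set p} (P? : Dec P) → P → 𝟙 P? ≡ 1ℤ
𝟙-yes (yes _) _ = refl
𝟙-yes (no ¬p) p = contradiction p ¬p

𝟙-no : ∀ {p} {P : Set p} (P? : Dec P) → ¬ P → 𝟙 P? ≡ 0ℤ
𝟙-no (yes p) ¬p = contradiction p ¬p
𝟙-no (no _)  _  = refl

𝟙-cong : ∀ {p q} {P : Set p} {Q : Set q} (P? : Dec P) (Q? : Dec Q) → (P → Q) → (Q → P) → 𝟙 P? ≡ 𝟙 Q?
𝟙-cong (yes p) Q? f g = sym (𝟙-yes Q? (f p))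
𝟙-cong (no ¬p) Q? f g = sym (𝟙-no Q? (λ q → ¬p (g q)))

monomial-𝟙 : ∀ m n → monomial m n ≡ 𝟙 (n ℕ.≟ m)
monomial-𝟙 m n with n ℕ.≟ m
... | yes _ = refl
... | no  _ = refl

monomial-≡ : ∀ m → monomial m m ≡ 1ℤ
monomial-≡ m = trans (monomial-𝟙 m m) (𝟙-yes (m ℕ.≟ m) refl)

monomial-≢ : ∀ {m n} → n ≢ m → monomial m n ≡ 0ℤ
monomial-≢ {m} {n} n≢m = trans (monomial-𝟙 m n) (𝟙-no (n ℕ.≟ m) n≢m)

⊛-monomial : ∀ f k n → k ℕ.≤ n → (f ⊛ monomial k) n ≡ f (n ℕ.∸ k)
⊛-monomial f k n k≤n = begin
  Σ< (suc n) (λ i → f i * monomial k (n ℕ.∸ i))      ≡⟨ Σ-single (suc n) (n ℕ.∸ k) (s≤s (ℕ.m∸n≤m n k)) off ⟩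
  f (n ℕ.∸ k) * monomial k (n ℕ.∸ (n ℕ.∸ k))         ≡⟨ cong (λ j → f (n ℕ.∸ k) * monomial k j) (ℕ.m∸[m∸n]≡n k≤n) ⟩
  f (n ℕ.∸ k) * monomial k k                         ≡⟨ cong (f (n ℕ.∸ k) *_) (monomial-≡ k) ⟩
  f (n ℕ.∸ k) * 1ℤ                                   ≡⟨ ℤ.*-identityʳ _ ⟩
  f (n ℕ.∸ k)                                        ∎
  where
  open ≡-Reasoning
  off : ∀ j → j ℕ.< suc n → j ≢ n ℕ.∸ k → f j * monomial k (n ℕ.∸ j) ≡ 0ℤ
  off j (s≤s j≤n) j≢ = trans (cong (f j *_) (monomial-≢ {k} (λ e →
    j≢ (trans (sym (ℕ.m∸[m∸n]≡n j≤n)) (cong (n ℕ.∸_) e))))) (ℤ.*-zeroʳ (f j))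

⊛-monomial-> : ∀ f k n → n ℕ.< k → (f ⊛ monomial k) n ≡ 0ℤ
⊛-monomial-> f k n n<k = Σ-zero (suc n) (λ i _ → trans
  (cong (f i *_) (monomial-≢ {k} (λ e → ℕ.<⇒≱ n<k (subst (ℕ._≤ n) e (ℕ.m∸n≤m n i))))) (ℤ.*-zeroʳ (f i)))

⊛-identityʳ : ∀ f n → (f ⊛ oneˢ) n ≡ f n
⊛-identityʳ f n = ⊛-monomial f 0 n z≤n

⊛-distribˡ-minus : ∀ f g h n → (f ⊛ (λ k → g k - h k)) n ≡ (f ⊛ g) n - (f ⊛ h) n
⊛-distribˡ-minus f g h n = go (suc n) (λ i → f i) (λ i → g (n ℕ.∸ i)) (λ i → h (n ℕ.∸ i))
  where
  step : ∀ a b c s t → a * (b - c) + (s - t) ≡ (a * b + s) - (a * c + t)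
  step = ℤRing.solve-∀
  go : ∀ N (a b c : ℕ → ℤ) → Σ< N (λ i → a i * (b i - c i)) ≡ Σ< N (λ i → a i * b i) - Σ< N (λ i → a i * c i)
  go zero    a b c = refl
  go (suc N) a b c = trans (cong (_+_ (a 0 * (b 0 - c 0))) (go N (λ i → a (suc i)) (λ i → b (suc i)) (λ i → c (suc i))))
    (step (a 0) (b 0) (c 0) _ _)

sgn : ℕ → ℤ
sgn zero    = 1ℤ
sgn (suc n) = - sgn n

tri : ℕ → ℕ
tri zero    = 0
tri (suc n) = suc n ℕ.+ tri n

2*tri : ∀ n → 2 ℕ.* tri n ≡ n ℕ.* suc n
2*tri zero    = refl
2*tri (suc n) = trans (ℕ.*-distribˡ-+ 2 (suc n) (tri n)) (trans (cong (ℕ._+_ (2 ℕ.* suc n)) (2*tri n)) (id n))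
  where
  id : ∀ n → 2 ℕ.* suc n ℕ.+ n ℕ.* suc n ≡ suc n ℕ.* suc (suc n)
  id = ℕRing.solve-∀

-- The generalized pentagonal numbers `n (3n - 1) / 2` at `n = s + 1` and at `n = -s`, in the shape
-- in which they appear as the last exponents of the telescoping sum.
pent₁ pent₂ : ℕ → ℕ
pent₁ s = tri s ℕ.+ suc s ℕ.* suc s
pent₂ s = tri s ℕ.+ s ℕ.* s

24pent₁+1 : ∀ s → suc (24 ℕ.* pent₁ s) ≡ (5 ℕ.+ 6 ℕ.* s) ℕ.* (5 ℕ.+ 6 ℕ.* s)
24pent₁+1 s = trans (id₁ s (tri s)) (trans (cong (λ t → suc (12 ℕ.* t ℕ.+ 24 ℕ.* (suc s ℕ.* suc s))) (2*tri s)) (id₂ s))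
  where
  id₁ : ∀ s t → suc (24 ℕ.* (t ℕ.+ suc s ℕ.* suc s)) ≡ suc (12 ℕ.* (2 ℕ.* t) ℕ.+ 24 ℕ.* (suc s ℕ.* suc s))
  id₁ = ℕRing.solve-∀
  id₂ : ∀ s → suc (12 ℕ.* (s ℕ.* suc s) ℕ.+ 24 ℕ.* (suc s ℕ.* suc s)) ≡ (5 ℕ.+ 6 ℕ.* s) ℕ.* (5 ℕ.+ 6 ℕ.* s)
  id₂ = ℕRing.solve-∀

24pent₂+1 : ∀ s → suc (24 ℕ.* pent₂ s) ≡ (1 ℕ.+ 6 ℕ.* s) ℕ.* (1 ℕ.+ 6 ℕ.* s)
24pent₂+1 s = trans (id₁ s (tri s)) (trans (cong (λ t → suc (12 ℕ.* t ℕ.+ 24 ℕ.* (s ℕ.* s))) (2*tri s)) (id₂ s))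
  where
  id₁ : ∀ s t → suc (24 ℕ.* (t ℕ.+ s ℕ.* s)) ≡ suc (12 ℕ.* (2 ℕ.* t) ℕ.+ 24 ℕ.* (s ℕ.* s))
  id₁ = ℕRing.solve-∀
  id₂ : ∀ s → suc (12 ℕ.* (s ℕ.* suc s) ℕ.+ 24 ℕ.* (s ℕ.* s)) ≡ (1 ℕ.+ 6 ℕ.* s) ℕ.* (1 ℕ.+ 6 ℕ.* s)
  id₂ = ℕRing.solve-∀

δ : ℤ → ℤ
δ (+ zero)  = 1ℤ
δ (+ suc _) = 0ℤ
δ -[1+ _ ]  = 0ℤ

-- The coefficient of q^m in ∏_{s<k≤s+d} (1 - q^k), with m ranging over ℤ so that shifting is subtraction.
rangeProduct : ℕ → ℕ → ℤ → ℤ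
rangeProduct s zero    m = δ m
rangeProduct s (suc d) m = rangeProduct s d m - rangeProduct s d (m - + (suc (s ℕ.+ d)))

-- The definition splits off the largest factor; comparing the quotients over `P_s` and `P_{s+1}`
-- requires splitting off the smallest one.
rangeProduct-head : ∀ s d m → rangeProduct s (suc d) m ≡ rangeProduct (suc s) d m - rangeProduct (suc s) d (m - + suc s)
rangeProduct-head s zero    m = cong (λ k → δ m - δ (m - + suc k)) (ℕ.+-identityʳ s)
rangeProduct-head s (suc d) m = trans
  (cong₂ _-_ (rangeProduct-head s d m) (rangeProduct-head s d (m - + suc (s ℕ.+ suc d))))
  (trans (cong₂ (λ k z → (rangeProduct′ m - rangeProduct′ (m - + suc s)) - (rangeProduct′ (m - + suc k) - rangeProduct′
    z)) (ℕ.+-suc s d) (swap m (+ suc (s ℕ.+ suc d)) (+ suc s)))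
    (trans (rearrange (rangeProduct′ m) (rangeProduct′ (m - + suc s)) (rangeProduct′ (m - + suc (suc s ℕ.+ d))) _)
      (cong (λ k → (rangeProduct′ m - rangeProduct′ (m - + suc (suc s ℕ.+ d))) - (rangeProduct′ (m - + suc s) -
        rangeProduct′ (m - + suc s - + suc k))) (ℕ.+-suc s d))))
  where
  rangeProduct′ : ℤ → ℤ
  rangeProduct′ = rangeProduct (suc s) d
  rearrange : ∀ a b c e → (a - b) - (c - e) ≡ (a - c) - (b - e)
  rearrange = ℤRing.solve-∀
  swap : ∀ a b c → a - b - c ≡ a - c - b
  swap = ℤRing.solve-∀

rangeProduct-neg : ∀ s d k → rangeProduct s d -[1+ k ] ≡ 0ℤ
rangeProduct-neg s zero    k = refl
rangeProduct-neg s (suc d) k = cong₂ _-_ (rangeProduct-neg s d k) (rangeProduct-neg s d (suc (k ℕ.+ (s ℕ.+ d))))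

-- Shanks's argument: Σ_s (-1)^s (P_n / P_s) q^{sn + s(s+1)/2}, where P_s = ∏_{k≤s} (1 - q^k), equals P_n up to
-- q^n, and increasing n changes it by two pentagonal terms, as all other differences telescope through G.
module Telescope (n : ℕ) (m : ℤ) where

  term term′ G : ℕ → ℤ
  term  s = sgn s * rangeProduct s (n ℕ.∸ s) (m - + (s ℕ.* n ℕ.+ tri s))
  term′ s = sgn s * rangeProduct s (suc n ℕ.∸ s) (m - + (s ℕ.* suc n ℕ.+ tri s))
  G     s = sgn s * rangeProduct s (n ℕ.∸ s) (m - + (tri s ℕ.+ suc s ℕ.* suc n))

  -- Both `G k` and `term′ (suc k)` split into two values of `rangeProduct (suc k) (n ∸ suc k)`, the
  -- former at its first factor, the latter at its last. The common value `x₁` cancels, `x₀`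
  -- supplies `term (suc k)` and `x₂` supplies `G (suc k)`.
  telescope : ∀ k → k ℕ.≤ n → Σ< (suc k) term′ ≡ Σ< (suc k) term - G k
  telescope zero    _   = base (rangeProduct 0 n (m - + 0)) (rangeProduct 0 n (m - + 0 - + suc n)) _
    (cong (rangeProduct 0 n) (trans (shift₀ m (+ suc n)) (cong (λ k → m - + k) (sym (ℕ.*-identityˡ (suc n))))))
    where
    shift₀ : ∀ m a → m - + 0 - a ≡ m - a
    shift₀ = ℤRing.solve-∀
    base : ∀ v w w′ → w ≡ w′ → 1ℤ * (v - w) + 0ℤ ≡ 1ℤ * v + 0ℤ - 1ℤ * w′
    base v w _ refl = id v w
      where
      id : ∀ v w → 1ℤ * (v - w) + 0ℤ ≡ 1ℤ * v + 0ℤ - 1ℤ * w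
      id = ℤRing.solve-∀
  telescope (suc k) k<n = begin
    Σ< (2 ℕ.+ k) term′                                ≡⟨ Σ-last (suc k) term′ ⟩
    Σ< (suc k) term′ + term′ (suc k)                  ≡⟨ cong₂ _+_ (telescope k (ℕ.<⇒≤ k<n)) term′-eq ⟩
    (Σ< (suc k) term - G k) + - σ * (x₁ - x₂)         ≡⟨ cong (λ z → (Σ< (suc k) term - z) + - σ * (x₁ - x₂)) G-eq ⟩
    (Σ< (suc k) term - σ * (x₀ - x₁)) + - σ * (x₁ - x₂) ≡⟨ rearrange (Σ< (suc k) term) σ x₀ x₁ x₂ ⟩
    (Σ< (suc k) term + - σ * x₀) - - σ * x₂           ≡⟨ cong (λ z → (Σ< (suc k) term + - σ * x₀) - - σ * z) x₂-eq ⟩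
    (Σ< (suc k) term + term (suc k)) - G (suc k)      ≡⟨ cong (_- G (suc k)) (sym (Σ-last (suc k) term)) ⟩
    Σ< (2 ℕ.+ k) term - G (suc k)                     ∎
    where
    open ≡-Reasoning
    d e₀ e₁ : ℕ
    d = n ℕ.∸ suc k
    e₀ = suc k ℕ.* n ℕ.+ tri (suc k)
    e₁ = suc k ℕ.* suc n ℕ.+ tri (suc k)
    σ x₀ x₁ x₂ : ℤ
    σ = sgn k
    x₀ = rangeProduct (suc k) d (m - + e₀)
    x₁ = rangeProduct (suc k) d (m - + e₁)
    x₂ = rangeProduct (suc k) d (m - + e₁ - + suc n)
    n∸k : n ℕ.∸ k ≡ suc d
    n∸k = ℕ.+-∸-assoc 1 k<n
    shift : ∀ p q {r} → p ℕ.+ q ≡ r → m - + p - + q ≡ m - + r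
    shift p q refl = trans (assoc m (+ p) (+ q)) (cong (_-_ m) (sym (ℤ.pos-+ p q)))
      where
      assoc : ∀ m p q → m - p - q ≡ m - (p + q)
      assoc = ℤRing.solve-∀
    term′-eq : term′ (suc k) ≡ - σ * (x₁ - x₂)
    term′-eq = cong (- σ *_) (trans (cong (λ j → rangeProduct (suc k) j (m - + e₁)) n∸k)
      (cong (λ j → x₁ - rangeProduct (suc k) d (m - + e₁ - + suc j)) (ℕ.m+[n∸m]≡n k<n)))
    eG : ∀ k n t → t ℕ.+ suc k ℕ.* suc n ≡ suc k ℕ.* n ℕ.+ (suc k ℕ.+ t)
    eG = ℕRing.solve-∀
    eG₁ : ∀ k n t → suc k ℕ.* n ℕ.+ (suc k ℕ.+ t) ℕ.+ suc k ≡ suc k ℕ.* suc n ℕ.+ (suc k ℕ.+ t)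
    eG₁ = ℕRing.solve-∀
    eG₂ : ∀ k n t → suc k ℕ.* suc n ℕ.+ t ℕ.+ suc n ≡ t ℕ.+ suc (suc k) ℕ.* suc n
    eG₂ = ℕRing.solve-∀
    G-eq : G k ≡ σ * (x₀ - x₁)
    G-eq = cong (σ *_) (trans (cong₂ (λ j e → rangeProduct k j (m - + e)) n∸k (eG k n (tri k)))
      (trans (rangeProduct-head k d (m - + e₀))
        (cong (λ z → x₀ - rangeProduct (suc k) d z) (shift e₀ (suc k) (eG₁ k n (tri k))))))
    x₂-eq : x₂ ≡ rangeProduct (suc k) d (m - + (tri (suc k) ℕ.+ suc (suc k) ℕ.* suc n))
    x₂-eq = cong (rangeProduct (suc k) d) (shift e₁ (suc n) (eG₂ k n (tri (suc k))))
    rearrange : ∀ s σ x₀ x₁ x₂ →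
      (s - σ * (x₀ - x₁)) + - σ * (x₁ - x₂) ≡ (s + - σ * x₀) - - σ * x₂
    rearrange = ℤRing.solve-∀

shanksSum : ℕ → ℤ → ℤ
shanksSum n m = Σ< (suc n) (Telescope.term n m)

shanksSum-suc : ∀ n m → shanksSum (suc n) m ≡ shanksSum n m + sgn (suc n) * (δ (m - + pent₁ n) + δ
  (m - + pent₂ (suc n)))
shanksSum-suc n m = begin
  shanksSum (suc n) m                                          ≡⟨ Σ-last (suc n) T.term′ ⟩
  Σ< (suc n) T.term′ + T.term′ (suc n)                 ≡⟨ cong₂ _+_ (T.telescope n ℕ.≤-refl)
    (cong₂ (λ j e → - sgn n * rangeProduct (suc n) j (m - + e)) (ℕ.n∸n≡0 n) (ℕ.+-comm _ (tri (suc n)))) ⟩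
  (shanksSum n m - T.G n) + - sgn n * δ (m - + pent₂ (suc n))  ≡⟨ cong (λ j → (shanksSum n m - sgn n * rangeProduct n j
    (m - + pent₁ n)) + - sgn n * δ (m - + pent₂ (suc n))) (ℕ.n∸n≡0 n) ⟩
  (shanksSum n m - sgn n * δ (m - + pent₁ n)) + - sgn n * δ (m - + pent₂ (suc n)) ≡⟨ rearrange (shanksSum n m) (sgn n) _
    _ ⟩
  shanksSum n m + sgn (suc n) * (δ (m - + pent₁ n) + δ (m - + pent₂ (suc n))) ∎
  where
  open ≡-Reasoning
  module T = Telescope n m
  rearrange : ∀ f s a b → (f - s * a) + - s * b ≡ f + - s * (a + b)
  rearrange = ℤRing.solve-∀

shanksSum-pentagonal : ∀ n m → shanksSum n m ≡ δ m + Σ< n (λ s → sgn (suc s) * (δ (m - + pent₁ s) + δ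
  (m - + pent₂ (suc s))))
shanksSum-pentagonal zero    m = trans (cong (λ z → 1ℤ * δ z + 0ℤ) (m-0 m)) (id (δ m))
  where
  m-0 : ∀ m → m - + 0 ≡ m
  m-0 = ℤRing.solve-∀
  id : ∀ x → 1ℤ * x + 0ℤ ≡ x + 0ℤ
  id = ℤRing.solve-∀
shanksSum-pentagonal (suc n) m = trans (shanksSum-suc n m) (trans (cong (_+ h n) (shanksSum-pentagonal n m))
  (trans (ℤ.+-assoc (δ m) _ _) (cong (_+_ (δ m)) (sym (Σ-last n h)))))
  where
  h : ℕ → ℤ
  h s = sgn (suc s) * (δ (m - + pent₁ s) + δ (m - + pent₂ (suc s)))

δ-minus : ∀ i j → δ (+ i - + j) ≡ 𝟙 (i ℕ.≟ j)
δ-minus i j with i ℕ.≟ j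
... | yes refl = cong δ (ℤ.+-inverseʳ (+ i))
... | no  i≢j  = go (+ i - + j) (λ e → i≢j (ℤ.+-injective (ℤ.i-j≡0⇒i≡j (+ i) (+ j) e)))
  where
  go : ∀ z → z ≢ 0ℤ → δ z ≡ 0ℤ
  go (+ zero)  z≢0 = contradiction refl z≢0
  go (+ suc _) _   = refl
  go -[1+ _ ]  _   = refl

-‿< : ∀ {i j} → i ℕ.< j → ∃[ k ] + i - + j ≡ -[1+ k ]
-‿< {i} {suc j} (s≤s i≤j) = j ℕ.∸ i , trans (ℤ.m-n≡m⊖n i (suc j)) (trans (ℤ.⊖-< (s≤s i≤j))
  (cong (λ k → - + k) (ℕ.+-∸-assoc 1 i≤j)))

-‿≥ : ∀ {i j} → j ℕ.≤ i → + i - + j ≡ + (i ℕ.∸ j)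
-‿≥ {i} {j} j≤i = trans (ℤ.m-n≡m⊖n i j) (ℤ.⊖-≥ j≤i)

eulerPartial≡rangeProduct : ∀ M n → eulerPartial M n ≡ rangeProduct 0 M (+ n)
eulerPartial≡rangeProduct zero    zero    = refl
eulerPartial≡rangeProduct zero    (suc n) = refl
eulerPartial≡rangeProduct (suc M) n = trans (⊛-distribˡ-minus (eulerPartial M) oneˢ (monomial (suc M)) n)
  (cong₂ _-_ (trans (⊛-identityʳ (eulerPartial M) n) (eulerPartial≡rangeProduct M n)) shifted)
  where
  shifted : (eulerPartial M ⊛ monomial (suc M)) n ≡ rangeProduct 0 M (+ n - + suc M)
  shifted with suc M ℕ.≤? n
  ... | yes M<n = trans (⊛-monomial (eulerPartial M) (suc M) n M<n)
                    (trans (eulerPartial≡rangeProduct M (n ℕ.∸ suc M)) (cong (rangeProduct 0 M) (sym (-‿≥ M<n))))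
  ... | no  M≮n with k , e ← -‿< (ℕ.≰⇒> M≮n) =
        trans (⊛-monomial-> (eulerPartial M) (suc M) n (ℕ.≰⇒> M≮n))
          (sym (trans (cong (rangeProduct 0 M) e) (rangeProduct-neg 0 M k)))

-- With `n = i`, every term with `s ≥ 1` starts at the exponent `s i + tri s > i`, so only `s = 0`
-- reaches the coefficient of `q^i`.
euler≡shanksSum : ∀ i → euler i ≡ shanksSum i (+ i)
euler≡shanksSum i = trans (eulerPartial≡rangeProduct i i) (sym (trans (Σ-single (suc i) 0 (s≤s z≤n) off)
  (trans (ℤ.*-identityˡ (rangeProduct 0 i (+ i - + 0))) (cong (rangeProduct 0 i) (ℤ.+-identityʳ (+ i))))))
  where
  open Telescope i (+ i)
  comm : ∀ i s t → suc (i ℕ.+ (s ℕ.* i ℕ.+ (s ℕ.+ t))) ≡ suc s ℕ.* i ℕ.+ (suc s ℕ.+ t)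
  comm = ℕRing.solve-∀
  off : ∀ s → s ℕ.< suc i → s ≢ 0 → term s ≡ 0ℤ
  off zero    _ 0≢0 = contradiction refl 0≢0
  off (suc s) _ _ with k , e ← -‿< {i} {suc s ℕ.* i ℕ.+ tri (suc s)}
                        (subst (i ℕ.<_) (comm i s (tri s)) (s≤s (ℕ.m≤m+n i (s ℕ.* i ℕ.+ (s ℕ.+ tri s))))) =
    trans (cong (sgn (suc s) *_) (trans (cong (rangeProduct (suc s) (i ℕ.∸ suc s)) e) (rangeProduct-neg (suc s)
      (i ℕ.∸ suc s) k))) (ℤ.*-zeroʳ (sgn (suc s)))

-- The Dirichlet character (12/·).
χ : ℕ → ℤ
χ 0 = 0ℤ
χ 1 = 1ℤ
χ 2 = 0ℤ
χ 3 = 0ℤ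
χ 4 = 0ℤ
χ 5 = -1ℤ
χ (suc (suc (suc (suc (suc (suc n)))))) = - χ n

-- `χ` lives on `k = 1 + 6s` and `k = 5 + 6s`, whose squares are `24p + 1` with `p` one of the two
-- pentagonal numbers of index `s`.
χ-support : ∀ k → χ k ≡ 0ℤ ⊎ ∃[ j ] k ℕ.* k ≡ suc (24 ℕ.* j)
χ-support k with go k
  where
  go : ∀ k → χ k ≡ 0ℤ ⊎ ∃[ s ] (k ≡ 1 ℕ.+ 6 ℕ.* s ⊎ k ≡ 5 ℕ.+ 6 ℕ.* s)
  go 0 = inj₁ refl
  go 1 = inj₂ (0 , inj₁ refl)
  go 2 = inj₁ refl
  go 3 = inj₁ refl
  go 4 = inj₁ refl
  go 5 = inj₂ (0 , inj₂ refl)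
  go (suc (suc (suc (suc (suc (suc k)))))) with go k
  ... | inj₁ e              = inj₁ (cong -_ e)
  ... | inj₂ (s , inj₁ e)   = inj₂ (suc s , inj₁ (trans (cong (ℕ._+_ 6) e) (id₁ s)))
    where
    id₁ : ∀ s → 6 ℕ.+ (1 ℕ.+ 6 ℕ.* s) ≡ 1 ℕ.+ 6 ℕ.* suc s
    id₁ = ℕRing.solve-∀
  ... | inj₂ (s , inj₂ e)   = inj₂ (suc s , inj₂ (trans (cong (ℕ._+_ 6) e) (id₂ s)))
    where
    id₂ : ∀ s → 6 ℕ.+ (5 ℕ.+ 6 ℕ.* s) ≡ 5 ℕ.+ 6 ℕ.* suc s
    id₂ = ℕRing.solve-∀
... | inj₁ e               = inj₁ e
... | inj₂ (s , inj₁ refl) = inj₂ (pent₂ s , sym (24pent₂+1 s))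
... | inj₂ (s , inj₂ refl) = inj₂ (pent₁ s , sym (24pent₁+1 s))

χ-5+6s : ∀ s → χ (5 ℕ.+ s ℕ.* 6) ≡ sgn (suc s)
χ-5+6s zero    = refl
χ-5+6s (suc s) = cong -_ (χ-5+6s s)

χ-periodic : ∀ {k} s → χ k ≡ 0ℤ → χ (s ℕ.* 6 ℕ.+ k) ≡ 0ℤ
χ-periodic zero    e = e
χ-periodic (suc s) e = cong -_ (χ-periodic s e)

-- The range of `k` is cut into `k = 0, 1` and blocks of six beginning at 2. In block `s` only
-- `k = 6s + 5` and `k = 6s + 7` survive `χ`, and they carry `pent₁ s` and `pent₂ (suc s)`. For
-- `k ≥ 6i + 2` already `k² > 24i + 1`, so every larger bound `B` gives the same sum.
pentagonalNumberTheorem : ∀ i {B} → 2 ℕ.+ i ℕ.* 6 ℕ.≤ B →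
  euler i ≡ Σ< B (λ k → 𝟙 (k ℕ.* k ℕ.≟ suc (24 ℕ.* i)) * χ k)
pentagonalNumberTheorem i {B} B≥ = begin
  euler i                         ≡⟨ euler≡shanksSum i ⟩
  shanksSum i (+ i)                       ≡⟨ shanksSum-pentagonal i (+ i) ⟩
  δ (+ i) + Σ< i (λ s → sgn (suc s) * (δ (+ i - + pent₁ s) + δ (+ i - + pent₂ (suc s))))
                                  ≡⟨ cong₂ _+_ constant-term (Σ-cong i (λ s _ → block-eq s)) ⟩
  h 0 + (h 1 + 0ℤ) + Σ< i block   ≡⟨ cong (_+_ (h 0 + (h 1 + 0ℤ))) (sym (blocks i 2)) ⟩
  h 0 + (h 1 + 0ℤ) + Σ< (i ℕ.* 6) (λ k → h (2 ℕ.+ k)) ≡⟨ sym (Σ-++ 2 (i ℕ.* 6) h) ⟩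
  Σ< (2 ℕ.+ i ℕ.* 6) h            ≡⟨ sym (Σ-truncate h B≥ large) ⟩
  Σ< B h                          ∎
  where
  open ≡-Reasoning
  h block : ℕ → ℤ
  h k = 𝟙 (k ℕ.* k ℕ.≟ suc (24 ℕ.* i)) * χ k
  block s = Σ< 6 (λ j → h (2 ℕ.+ (s ℕ.* 6 ℕ.+ j)))
  blocks : ∀ n o → Σ< (n ℕ.* 6) (λ k → h (o ℕ.+ k)) ≡ Σ< n (λ s → Σ< 6 (λ j → h (o ℕ.+ (s ℕ.* 6 ℕ.+ j))))
  blocks zero    o = refl
  blocks (suc n) o = trans (Σ-++ 6 (n ℕ.* 6) (λ k → h (o ℕ.+ k)))
    (cong (_+_ (Σ< 6 (λ k → h (o ℕ.+ k)))) (trans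
      (Σ-cong (n ℕ.* 6) (λ k _ → cong h (sym (ℕ.+-assoc o 6 k))))
      (trans (blocks n (o ℕ.+ 6)) (Σ-cong n (λ s _ → Σ-cong 6 (λ j _ → cong h (ℕ.+-assoc o 6 (s ℕ.* 6 ℕ.+ j))))))))
  constant-term : δ (+ i) ≡ h 0 + (h 1 + 0ℤ)
  constant-term = go i
    where
    go : ∀ i → δ (+ i) ≡ 𝟙 (0 ℕ.≟ suc (24 ℕ.* i)) * 0ℤ + (𝟙 (1 ℕ.≟ suc (24 ℕ.* i)) * 1ℤ + 0ℤ)
    go zero    = refl
    go (suc _) = refl
  large : ∀ k → 2 ℕ.+ i ℕ.* 6 ℕ.≤ k → h k ≡ 0ℤ
  large k k≥ = trans (cong (_* χ k) (𝟙-no (k ℕ.* k ℕ.≟ _) (λ e → ℕ.<⇒≢ lt (sym e)))) (ℤ.*-zeroˡ (χ k))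
    where
    expand : ∀ i → suc (suc (24 ℕ.* i)) ℕ.+ (2 ℕ.+ i ℕ.* (i ℕ.* 36)) ≡ (2 ℕ.+ i ℕ.* 6) ℕ.* (2 ℕ.+ i ℕ.* 6)
    expand = ℕRing.solve-∀
    lt : suc (24 ℕ.* i) ℕ.< k ℕ.* k
    lt = ℕ.≤-trans (ℕ.m+n≤o⇒m≤o _ (ℕ.≤-reflexive (expand i))) (ℕ.*-mono-≤ k≥ k≥)
  vanish : ∀ k → χ k ≡ 0ℤ → h k ≡ 0ℤ
  vanish k e = trans (cong (𝟙 (k ℕ.* k ℕ.≟ suc (24 ℕ.* i)) *_) e) (ℤ.*-zeroʳ (𝟙 (k ℕ.* k ℕ.≟ suc (24 ℕ.* i))))
  square : ∀ p k → suc (24 ℕ.* p) ≡ k ℕ.* k → δ (+ i - + p) ≡ 𝟙 (k ℕ.* k ℕ.≟ suc (24 ℕ.* i))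
  square p k e = trans (δ-minus i p) (𝟙-cong (i ℕ.≟ p) (k ℕ.* k ℕ.≟ suc (24 ℕ.* i))
    (λ i≡p → trans (sym e) (cong (λ z → suc (24 ℕ.* z)) (sym i≡p)))
    (λ e′ → ℕ.*-cancelˡ-≡ i p 24 (ℕ.suc-injective (trans (sym e′) (sym e)))))
  block-eq : ∀ s → sgn (suc s) * (δ (+ i - + pent₁ s) + δ (+ i - + pent₂ (suc s))) ≡ block s
  block-eq s = sym (trans (cong₂ _+_ (van 0 refl) (cong₂ _+_ (van 1 refl) (cong₂ _+_ (van 2 refl)
    (cong₂ _+_ five (cong₂ _+_ (van 4 refl) (cong (_+ 0ℤ) seven)))))) (id (δ (+ i - + pent₁ s))
      (δ (+ i - + pent₂ (suc s))) (sgn (suc s))))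
    where
    k₅ k₇ : ℕ
    k₅ = 5 ℕ.+ 6 ℕ.* s
    k₇ = 1 ℕ.+ 6 ℕ.* suc s
    re : ∀ r s → 2 ℕ.+ (s ℕ.* 6 ℕ.+ r) ≡ s ℕ.* 6 ℕ.+ (2 ℕ.+ r)
    re = ℕRing.solve-∀
    van : ∀ j → χ (2 ℕ.+ j) ≡ 0ℤ → h (2 ℕ.+ (s ℕ.* 6 ℕ.+ j)) ≡ 0ℤ
    van j e = vanish (2 ℕ.+ (s ℕ.* 6 ℕ.+ j)) (trans (cong χ (re j s)) (χ-periodic s e))
    five : h (2 ℕ.+ (s ℕ.* 6 ℕ.+ 3)) ≡ δ (+ i - + pent₁ s) * sgn (suc s)
    five = trans (cong h (eq s)) (cong₂ _*_ (sym (square (pent₁ s) k₅ (24pent₁+1 s)))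
      (trans (cong (λ z → χ (5 ℕ.+ z)) (ℕ.*-comm 6 s)) (χ-5+6s s)))
      where
      eq : ∀ s → 2 ℕ.+ (s ℕ.* 6 ℕ.+ 3) ≡ 5 ℕ.+ 6 ℕ.* s
      eq = ℕRing.solve-∀
    seven : h (2 ℕ.+ (s ℕ.* 6 ℕ.+ 5)) ≡ δ (+ i - + pent₂ (suc s)) * sgn (suc s)
    seven = trans (cong h (eq s)) (cong₂ _*_ (sym (square (pent₂ (suc s)) k₇ (24pent₂+1 (suc s))))
      (trans (cong (λ z → χ (1 ℕ.+ z)) (ℕ.*-comm 6 (suc s))) (χ-7 s)))
      where
      eq : ∀ s → 2 ℕ.+ (s ℕ.* 6 ℕ.+ 5) ≡ 1 ℕ.+ 6 ℕ.* suc s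
      eq = ℕRing.solve-∀
      χ-7 : ∀ s → χ (1 ℕ.+ suc s ℕ.* 6) ≡ sgn (suc s)
      χ-7 zero    = refl
      χ-7 (suc s) = cong -_ (χ-7 s)
    id : ∀ a b s → 0ℤ + (0ℤ + (0ℤ + (a * s + (0ℤ + (b * s + 0ℤ))))) ≡ s * (a + b)
    id = ℤRing.solve-∀

-- Among the exponents 3 to 7 only 5 and 7 are pentagonal; these values steer the case analysis in
-- `Large`.
euler-3 : euler 3 ≡ 0ℤ
euler-3 = pentagonalNumberTheorem 3 ℕ.≤-refl

euler-4 : euler 4 ≡ 0ℤ
euler-4 = pentagonalNumberTheorem 4 ℕ.≤-refl

euler-5 : euler 5 ≡ 1ℤ
euler-5 = pentagonalNumberTheorem 5 ℕ.≤-refl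

euler-6 : euler 6 ≡ 0ℤ
euler-6 = pentagonalNumberTheorem 6 ℕ.≤-refl

euler-7 : euler 7 ≡ 1ℤ
euler-7 = pentagonalNumberTheorem 7 ℕ.≤-refl

-- Counting lattice points

private variable
  X Y : Set

Σᴸ : List X → (X → ℤ) → ℤ
Σᴸ []       f = 0ℤ
Σᴸ (x ∷ xs) f = f x + Σᴸ xs f

Σᴸ-cong : ∀ (xs : List X) {f g : X → ℤ} → (∀ x → f x ≡ g x) → Σᴸ xs f ≡ Σᴸ xs g
Σᴸ-cong []       f≗g = refl
Σᴸ-cong (x ∷ xs) f≗g = cong₂ _+_ (f≗g x) (Σᴸ-cong xs f≗g)

Σᴸ-+ : ∀ (xs : List X) (f g : X → ℤ) → Σᴸ xs (λ x → f x + g x) ≡ Σᴸ xs f + Σᴸ xs g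
Σᴸ-+ []       f g = refl
Σᴸ-+ (x ∷ xs) f g = trans (cong (_+_ (f x + g x)) (Σᴸ-+ xs f g)) (swap (f x) (g x) (Σᴸ xs f) (Σᴸ xs g))
  where
  swap : ∀ a b c d → a + b + (c + d) ≡ a + c + (b + d)
  swap = ℤRing.solve-∀

Σᴸ-neg : ∀ (xs : List X) (f : X → ℤ) → Σᴸ xs (λ x → - f x) ≡ - Σᴸ xs f
Σᴸ-neg []       f = refl
Σᴸ-neg (x ∷ xs) f = trans (cong (_+_ (- f x)) (Σᴸ-neg xs f)) (sym (ℤ.neg-distrib-+ (f x) (Σᴸ xs f)))

Σᴸ-++ : ∀ (xs ys : List X) (f : X → ℤ) → Σᴸ (xs ++ ys) f ≡ Σᴸ xs f + Σᴸ ys f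
Σᴸ-++ []       ys f = sym (ℤ.+-identityˡ _)
Σᴸ-++ (x ∷ xs) ys f = trans (cong (_+_ (f x)) (Σᴸ-++ xs ys f)) (sym (ℤ.+-assoc (f x) _ _))

Σᴸ-map : ∀ (h : X → Y) (xs : List X) (f : Y → ℤ) → Σᴸ (map h xs) f ≡ Σᴸ xs (f ∘ h)
Σᴸ-map h []       f = refl
Σᴸ-map h (x ∷ xs) f = cong (_+_ (f (h x))) (Σᴸ-map h xs f)

Σᴸ-upTo : ∀ n (f : ℕ → ℤ) → Σᴸ (upTo n) f ≡ Σ< n f
Σᴸ-upTo n f = go n (λ i → i)
  where
  go : ∀ n (g : ℕ → ℕ) → Σᴸ (applyUpTo g n) f ≡ Σ< n (f ∘ g)
  go zero    g = refl
  go (suc n) g = cong (_+_ (f (g 0))) (go n (g ∘ suc))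

Σᴸ-cartesianProduct : ∀ (xs : List X) (ys : List Y) (f : X × Y → ℤ) →
  Σᴸ (cartesianProduct xs ys) f ≡ Σᴸ xs (λ x → Σᴸ ys (λ y → f (x , y)))
Σᴸ-cartesianProduct []       ys f = refl
Σᴸ-cartesianProduct (x ∷ xs) ys f = trans (Σᴸ-++ (map (x ,_) ys) (cartesianProduct xs ys) f)
  (cong₂ _+_ (Σᴸ-map (x ,_) ys f) (Σᴸ-cartesianProduct xs ys f))

count : {P : X → Set} → Decidable P → List X → ℕ
count P? xs = length (filter P? xs)

count-Σᴸ : {P : X → Set} (P? : Decidable P) (xs : List X) → + count P? xs ≡ Σᴸ xs (λ x → 𝟙 (P? x))
count-Σᴸ P? []       = refl
count-Σᴸ P? (x ∷ xs) = go (P? x) refl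
  where
  go : ∀ d → P? x ≡ d → + count P? (x ∷ xs) ≡ 𝟙 d + Σᴸ xs (λ x → 𝟙 (P? x))
  go (yes p) _ = trans (cong (λ ys → + length ys) (filter-accept P? p)) (trans (ℤ.pos-+ 1 (count P? xs))
    (cong (_+_ 1ℤ) (count-Σᴸ P? xs)))
  go (no ¬p) _ = trans (cong (λ ys → + length ys) (filter-reject P? ¬p)) (trans (count-Σᴸ P? xs)
    (sym (ℤ.+-identityˡ _)))

unique-⊆⇒length≤ : {xs ys : List X} → Unique xs → (∀ {v} → v ∈ xs → v ∈ ys) → length xs ℕ.≤ length ys
unique-⊆⇒length≤ {xs = []}     _          _     = z≤n
unique-⊆⇒length≤ {xs = x ∷ xs} (x∉xs ∷ u) xs⊆ys with as , bs , refl ← ∈-∃++ (xs⊆ys (here refl)) =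
  subst (suc (length xs) ℕ.≤_) (sym (trans (length-++ as) (ℕ.+-suc (length as) (length bs))))
    (s≤s (subst (length xs ℕ.≤_) (length-++ as) (unique-⊆⇒length≤ u sub)))
  where
  sub : ∀ {v} → v ∈ xs → v ∈ as ++ bs
  sub v∈xs with ∈-++⁻ as (xs⊆ys (there v∈xs))
  ... | inj₁ v∈as         = ∈-++⁺ˡ v∈as
  ... | inj₂ (here refl)  = contradiction refl (All.lookup x∉xs v∈xs)
  ... | inj₂ (there v∈bs) = ∈-++⁺ʳ as v∈bs

count-bijection : {P : X → Set} {R : Y → Set} (P? : Decidable P) (R? : Decidable R)
  {xs : List X} {ys : List Y} → Unique xs → Unique ys →
  (f : X → Y) → (∀ {u v} → f u ≡ f v → u ≡ v) →
  (∀ {x} → x ∈ xs → P x → f x ∈ ys × R (f x)) →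
  (∀ {y} → y ∈ ys → R y → ∃[ x ] (x ∈ xs × P x × f x ≡ y)) →
  count P? xs ≡ count R? ys
count-bijection P? R? {xs} {ys} ux uy f inj to from = ℕ.≤-antisym
  (subst (ℕ._≤ count R? ys) (length-map f (filter P? xs))
    (unique-⊆⇒length≤ (Unique.map⁺ inj (Unique.filter⁺ P? ux)) to′))
  (subst (count R? ys ℕ.≤_) (length-map f (filter P? xs))
    (unique-⊆⇒length≤ (Unique.filter⁺ R? uy) from′))
  where
  to′ : ∀ {v} → v ∈ map f (filter P? xs) → v ∈ filter R? ys
  to′ v∈ with x , x∈ , refl ← ∈-map⁻ f v∈ with x∈xs , px ← ∈-filter⁻ P? x∈ with fx∈ys , r ← to x∈xs px =
    ∈-filter⁺ R? fx∈ys r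
  from′ : ∀ {v} → v ∈ filter R? ys → v ∈ map f (filter P? xs)
  from′ v∈ with v∈ys , r ← ∈-filter⁻ R? {xs = ys} v∈ with x , x∈xs , px , refl ← from v∈ys r =
    ∈-map⁺ f (∈-filter⁺ P? x∈xs px)

-- The box serves only to make the count finite. By `box-complete` and `box-unique` it can be
-- exchanged, along an injection, for any duplicate-free list adapted to the problem.
representations-count : ∀ Q → PositiveDefinite Q → ∀ n {R : X → Set} (R? : Decidable R) {xs : List X} → Unique xs →
  (f : ℤ × ℤ → X) → (∀ {u v} → f u ≡ f v → u ≡ v) →
  (∀ x y → eval Q x y ≡ + n → f (x , y) ∈ xs × R (f (x , y))) →
  (∀ {v} → R v → ∃[ x ] ∃[ y ] (eval Q x y ≡ + n × f (x , y) ≡ v)) →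
  representations Q n ≡ count R? xs
representations-count Q pd n R? u f inj to from = count-bijection
  (λ (x , y) → eval Q x y ℤ.≟ + n) R? (box-unique Q n) u f inj
  (λ {(x , y)} _ e → to x y e)
  (λ _ r → let x , y , e , fx≡v = from r in (x , y) , box-complete Q pd n x y e , e , fx≡v)

representations-≡ : ∀ Q Q′ → PositiveDefinite Q → PositiveDefinite Q′ →
  (f g : ℤ × ℤ → ℤ × ℤ) → (∀ v → g (f v) ≡ v) → (∀ v → f (g v) ≡ v) →
  (∀ x y → eval Q′ (proj₁ (f (x , y))) (proj₂ (f (x , y))) ≡ eval Q x y) →
  ∀ n → representations Q n ≡ representations Q′ n
representations-≡ Q Q′ pd pd′ f g gf fg evalf n = representations-count Q pd n
  (λ (x , y) → eval Q′ x y ℤ.≟ + n) (box-unique Q′ n) f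
  (λ {u} {v} e → trans (sym (gf u)) (trans (cong g e) (gf v)))
  (λ x y e → box-complete Q′ pd′ n _ _ (trans (evalf x y) e) , trans (evalf x y) e)
  (λ {v} r → let (x , y) = g v in x , y ,
    trans (sym (evalf x y)) (trans (cong (λ w → eval Q′ (proj₁ w) (proj₂ w)) (fg v)) r) , fg v)

-- Nonnegative and negative integers are listed separately, so that the sum of an even function
-- folds onto natural numbers.
symmetricInterval : ℕ → List ℤ
symmetricInterval N = map +_ (upTo (suc N)) ++ map -[1+_] (upTo N)

∈-symmetricInterval : ∀ N i → ∣ i ∣ ℕ.≤ N → i ∈ symmetricInterval N
∈-symmetricInterval N (+ n)    n≤N = ∈-++⁺ˡ (∈-map⁺ +_ (∈-upTo⁺ (s≤s n≤N)))
∈-symmetricInterval N -[1+ n ] n<N = ∈-++⁺ʳ (map +_ (upTo (suc N))) (∈-map⁺ -[1+_] (∈-upTo⁺ n<N))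

symmetricInterval-unique : ∀ N → Unique (symmetricInterval N)
symmetricInterval-unique N = Unique.++⁺
  (Unique.map⁺ ℤ.+-injective (Unique.upTo⁺ (suc N)))
  (Unique.map⁺ ℤ.-[1+-injective (Unique.upTo⁺ N)) disjoint
  where
  disjoint : ∀ {v} → v ∈ map +_ (upTo (suc N)) × v ∈ map -[1+_] (upTo N) → _
  disjoint (p , q) with _ , _ , refl ← ∈-map⁻ +_ p with _ , _ , () ← ∈-map⁻ -[1+_] q

Σᴸ-symmetricInterval : ∀ N (f : ℤ → ℤ) → f 0ℤ ≡ 0ℤ → (∀ k → f -[1+ k ] ≡ f (+ suc k)) →
  Σᴸ (symmetricInterval N) f ≡ + 2 * Σ< (suc N) (λ k → f (+ k))
Σᴸ-symmetricInterval N f f0 even = begin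
  Σᴸ (symmetricInterval N) f ≡⟨ Σᴸ-++ (map +_ (upTo (suc N))) (map -[1+_] (upTo N)) f ⟩
  Σᴸ (map +_ (upTo (suc N))) f + Σᴸ (map -[1+_] (upTo N)) f
    ≡⟨ cong₂ _+_ (trans (Σᴸ-map +_ (upTo (suc N)) f) (Σᴸ-upTo (suc N) (λ k → f (+ k))))
                 (trans (Σᴸ-map -[1+_] (upTo N) f) (trans (Σᴸ-upTo N (λ k → f -[1+ k ]))
                   (Σ-cong N {g = λ k → f (+ suc k)} (λ k _ → even k)))) ⟩
  (f 0ℤ + S) + S ≡⟨ cong (λ z → (z + S) + S) f0 ⟩
  (0ℤ + S) + S   ≡⟨ double S ⟩
  + 2 * (0ℤ + S) ≡⟨ cong (λ z → + 2 * (z + S)) (sym f0) ⟩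
  + 2 * Σ< (suc N) (λ k → f (+ k)) ∎
  where
  open ≡-Reasoning
  S : ℤ
  S = Σ< N (λ k → f (+ suc k))
  double : ∀ s → (0ℤ + s) + s ≡ + 2 * (0ℤ + s)
  double = ℤRing.solve-∀

-- The character (12/·) as an alternating count of residues modulo 12

[12∣_] : ℤ → ℤ
[12∣ i ] = 𝟙 (+ 12 Signed.∣? i)

[12∣]-cong : ∀ i j q → j ≡ i + q * + 12 → [12∣ i ] ≡ [12∣ j ]
[12∣]-cong i j q eq = 𝟙-cong (+ 12 Signed.∣? i) (+ 12 Signed.∣? j)
  (λ { (Signed.divides p e) → Signed.divides (p + q)
    (trans eq (trans (cong (_+ q * + 12) e) (sym (ℤ.*-distribʳ-+ (+ 12) p q)))) })
  (λ { (Signed.divides p e) → Signed.divides (p - q) (trans (back i q) (trans (cong (_- q * + 12) (trans (sym eq) e))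
    (minus p q))) })
  where
  back : ∀ i q → i ≡ i + q * + 12 - q * + 12
  back = ℤRing.solve-∀
  minus : ∀ p q → p * + 12 - q * + 12 ≡ (p - q) * + 12
  minus = ℤRing.solve-∀

[12∣]-neg : ∀ i → [12∣ i ] ≡ [12∣ - i ]
[12∣]-neg i = 𝟙-cong (+ 12 Signed.∣? i) (+ 12 Signed.∣? (- i))
  (λ { (Signed.divides p e) → Signed.divides (- p) (trans (cong -_ e) (ℤ.neg-distribˡ-* p (+ 12))) })
  (λ { (Signed.divides p e) → Signed.divides (- p) (trans (sym (ℤ.neg-involutive i))
    (trans (cong -_ e) (ℤ.neg-distribˡ-* p (+ 12)))) })

-- The factors `1ℤ` and `-1ℤ` are the two values of the sign `ε`; they are kept so that the four
-- summands are literally the divisibility conditions of `fibre?`.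
ψ : ℤ → ℤ → ℤ
ψ X Y = ([12∣ 1ℤ * X - 1ℤ * Y ] + [12∣ -1ℤ * X - 1ℤ * Y ]) - ([12∣ 1ℤ * X - + 5 * Y ] + [12∣ -1ℤ * X - + 5 * Y ])

ψ-cong : ∀ {a b c d a′ b′ c′ d′ : ℤ} → a ≡ a′ → b ≡ b′ → c ≡ c′ → d ≡ d′ → (a + b) - (c + d) ≡ (a′ + b′) - (c′ + d′)
ψ-cong refl refl refl refl = refl

ψ-negˡ : ∀ X Y → ψ (- X) Y ≡ ψ X Y
ψ-negˡ X Y = trans (ψ-cong (e₁ 1ℤ) (e₂ 1ℤ) (e₁ (+ 5)) (e₂ (+ 5)))
  (cong₂ _-_ (ℤ.+-comm [12∣ -1ℤ * X - 1ℤ * Y ] _) (ℤ.+-comm [12∣ -1ℤ * X - + 5 * Y ] _))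
  where
  id₁ : ∀ X k Y → 1ℤ * (- X) - k * Y ≡ -1ℤ * X - k * Y
  id₁ = ℤRing.solve-∀
  id₂ : ∀ X k Y → -1ℤ * (- X) - k * Y ≡ 1ℤ * X - k * Y
  id₂ = ℤRing.solve-∀
  e₁ : ∀ k → [12∣ 1ℤ * (- X) - k * Y ] ≡ [12∣ -1ℤ * X - k * Y ]
  e₁ k = cong [12∣_] (id₁ X k Y)
  e₂ : ∀ k → [12∣ -1ℤ * (- X) - k * Y ] ≡ [12∣ 1ℤ * X - k * Y ]
  e₂ k = cong [12∣_] (id₂ X k Y)

ψ-negʳ : ∀ X Y → ψ X (- Y) ≡ ψ X Y
ψ-negʳ X Y = trans (ψ-cong (e₁ 1ℤ) (e₂ 1ℤ) (e₁ (+ 5)) (e₂ (+ 5)))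
  (cong₂ _-_ (ℤ.+-comm [12∣ -1ℤ * X - 1ℤ * Y ] _) (ℤ.+-comm [12∣ -1ℤ * X - + 5 * Y ] _))
  where
  id₁ : ∀ X k Y → - (1ℤ * X - k * (- Y)) ≡ -1ℤ * X - k * Y
  id₁ = ℤRing.solve-∀
  id₂ : ∀ X k Y → - (-1ℤ * X - k * (- Y)) ≡ 1ℤ * X - k * Y
  id₂ = ℤRing.solve-∀
  e₁ : ∀ k → [12∣ 1ℤ * X - k * (- Y) ] ≡ [12∣ -1ℤ * X - k * Y ]
  e₁ k = trans ([12∣]-neg (1ℤ * X - k * (- Y))) (cong [12∣_] (id₁ X k Y))
  e₂ : ∀ k → [12∣ -1ℤ * X - k * (- Y) ] ≡ [12∣ 1ℤ * X - k * Y ]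
  e₂ k = trans ([12∣]-neg (-1ℤ * X - k * (- Y))) (cong [12∣_] (id₂ X k Y))

ψ-shift : ∀ X Y p q → ψ (X + p * + 12) (Y + q * + 12) ≡ ψ X Y
ψ-shift X Y p q = sym (ψ-cong (e 1ℤ 1ℤ) (e -1ℤ 1ℤ) (e 1ℤ (+ 5)) (e -1ℤ (+ 5)))
  where
  id₁ : ∀ X Y p q ε k → ε * (X + p * + 12) - k * (Y + q * + 12) ≡ ε * X - k * Y + (ε * p - k * q) * + 12
  id₁ = ℤRing.solve-∀
  e : ∀ ε k → [12∣ ε * X - k * Y ] ≡ [12∣ ε * (X + p * + 12) - k * (Y + q * + 12) ]
  e ε k = [12∣]-cong (ε * X - k * Y) (ε * (X + p * + 12) - k * (Y + q * + 12)) (ε * p - k * q) (id₁ X Y p q ε k)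

χ-shift : ∀ r q → χ (r ℕ.+ q ℕ.* 12) ≡ χ r
χ-shift r zero    = cong χ (ℕ.+-identityʳ r)
χ-shift r (suc q) = trans (cong χ (trans (sym (ℕ.+-assoc r 12 (q ℕ.* 12))) (cong (ℕ._+ q ℕ.* 12) (ℕ.+-comm r 12))))
  (trans (ℤ.neg-involutive (χ (r ℕ.+ q ℕ.* 12))) (χ-shift r q))

-- For units `X`, `Y` modulo 12 exactly one of `X ≡ ±Y` and `X ≡ ±5Y` holds, with `χ(X)χ(Y)` equal
-- to 1 or -1 accordingly; otherwise the two counts agree. Both sides are even and have period 12 in
-- each variable, so 144 pairs decide the general identity.
ψ-residues : ∀ (r s : Fin 12) → ψ (+ toℕ r) (+ toℕ s) ≡ χ (toℕ r) * χ (toℕ s)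
ψ-residues = toWitness {a? = Fin.all? (λ r → Fin.all? (λ s → ψ (+ toℕ r) (+ toℕ s) ℤ.≟ χ (toℕ r) * χ (toℕ s)))} tt

ψ≡χχ-ℕ : ∀ x y → ψ (+ x) (+ y) ≡ χ x * χ y
ψ≡χχ-ℕ x y = begin
  ψ (+ x) (+ y) ≡⟨ cong₂ ψ (divMod x) (divMod y) ⟩
  ψ (+ toℕ (r x) + + (x ℕ./ 12) * + 12) (+ toℕ (r y) + + (y ℕ./ 12) * + 12) ≡⟨ ψ-shift (+ toℕ (r x)) (+ toℕ (r y))
    (+ (x ℕ./ 12)) (+ (y ℕ./ 12)) ⟩
  ψ (+ toℕ (r x)) (+ toℕ (r y)) ≡⟨ ψ-residues (r x) (r y) ⟩
  χ (toℕ (r x)) * χ (toℕ (r y)) ≡⟨ cong₂ _*_ (χ-res x) (χ-res y) ⟩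
  χ x * χ y ∎
  where
  open ≡-Reasoning
  r : ℕ → Fin 12
  r x = x ℕ.mod 12
  eq : ∀ x → x ≡ toℕ (r x) ℕ.+ x ℕ./ 12 ℕ.* 12
  eq x = trans (ℕ.m≡m%n+[m/n]*n x 12) (cong (ℕ._+ x ℕ./ 12 ℕ.* 12) (sym (Fin.toℕ-fromℕ< (ℕ.m%n<n x 12))))
  divMod : ∀ x → + x ≡ + toℕ (r x) + + (x ℕ./ 12) * + 12
  divMod x = trans (cong +_ (eq x)) (trans (ℤ.pos-+ (toℕ (r x)) (x ℕ./ 12 ℕ.* 12)) (cong (_+_ (+ toℕ (r x)))
    (ℤ.pos-* (x ℕ./ 12) 12)))
  χ-res : ∀ x → χ (toℕ (r x)) ≡ χ x
  χ-res x = trans (sym (χ-shift (toℕ (r x)) (x ℕ./ 12))) (cong χ (sym (eq x)))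

ψ≡χχ : ∀ X Y → ψ X Y ≡ χ ∣ X ∣ * χ ∣ Y ∣
ψ≡χχ (+ x)    (+ y)    = ψ≡χχ-ℕ x y
ψ≡χχ (+ x)    -[1+ y ] = trans (ψ-negʳ (+ x) (+ suc y)) (ψ≡χχ-ℕ x (suc y))
ψ≡χχ -[1+ x ] (+ y)    = trans (ψ-negˡ (+ suc x) (+ y)) (ψ≡χχ-ℕ (suc x) y)
ψ≡χχ -[1+ x ] -[1+ y ] = trans (ψ-negˡ (+ suc x) -[1+ y ]) (trans (ψ-negʳ (+ suc x) (+ suc y)) (ψ≡χχ-ℕ (suc x) (suc y)))

-- Products of Euler functions as lattice sums

Σ-comm : ∀ m n (f : ℕ → ℕ → ℤ) → Σ< m (λ i → Σ< n (f i)) ≡ Σ< n (λ j → Σ< m (λ i → f i j))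
Σ-comm m n f = ∑-comm {m} {n} (λ i j → f (toℕ i) (toℕ j))

Σ-*ʳ : ∀ n (f : ℕ → ℤ) c → Σ< n f * c ≡ Σ< n (λ i → f i * c)
Σ-*ʳ n f c = *-distribʳ-sum {n} c (λ i → f (toℕ i))

Σ-*ˡ : ∀ n c (f : ℕ → ℤ) → c * Σ< n f ≡ Σ< n (λ i → c * f i)
Σ-*ˡ n c f = *-distribˡ-sum {n} c (λ i → f (toℕ i))

dilate-multiple : ∀ δ f k .{{_ : ℕ.NonZero δ}} → dilate δ f (k ℕ.* δ) ≡ f k
dilate-multiple δ f k with δ ∣? (k ℕ.* δ)
... | yes (divides j eq) = cong f (sym (ℕ.*-cancelʳ-≡ k j δ eq))
... | no  ¬d             = contradiction (divides k refl) ¬d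

dilate-nonmultiple : ∀ δ f n → ¬ δ ∣ n → dilate δ f n ≡ 0ℤ
dilate-nonmultiple δ f n ¬d with δ ∣? n
... | yes d = contradiction d ¬d
... | no  _ = refl

dilate-1 : ∀ f n → dilate 1 f n ≡ f n
dilate-1 f n = subst (λ k → dilate 1 f k ≡ f n) (ℕ.*-identityʳ n) (dilate-multiple 1 f n)

⊛-cong : ∀ {f f′ g g′ : Series} n → (∀ i → i ℕ.≤ n → f i ≡ f′ i) → (∀ i → i ℕ.≤ n → g i ≡ g′ i) → (f ⊛ g) n ≡ (f′ ⊛ g′)
  n
⊛-cong n f≗ g≗ = Σ-cong (suc n) (λ i i≤n → cong₂ _*_ (f≗ i (ℕ.s≤s⁻¹ i≤n)) (g≗ (n ℕ.∸ i) (ℕ.m∸n≤m n i)))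

-- The pentagonal number theorem, tested against φ.
Σ-euler : ∀ N {B} (φ : ℕ → ℤ) → 2 ℕ.+ N ℕ.* 6 ℕ.≤ B → (∀ i → N ℕ.≤ i → φ (suc (24 ℕ.* i)) ≡ 0ℤ) →
  Σ< N (λ i → euler i * φ (suc (24 ℕ.* i))) ≡ Σ< B (λ k → χ k * φ (k ℕ.* k))
Σ-euler N {B} φ B≥ φ≡0 = begin
  Σ< N (λ i → euler i * φ (suc (24 ℕ.* i)))  ≡⟨ Σ-cong N (λ i i<N → trans (cong (_* φ (suc (24 ℕ.* i)))
      (pentagonalNumberTheorem i (ℕ.≤-trans (ℕ.+-monoʳ-≤ 2 (ℕ.*-monoˡ-≤ 6 (ℕ.<⇒≤ i<N))) B≥)))
        (Σ-*ʳ B (λ k → e k i * χ k) _)) ⟩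
  Σ< N (λ i → Σ< B (λ k → g k i))            ≡⟨ Σ-comm N B (λ i k → g k i) ⟩
  Σ< B (λ k → Σ< N (g k))                    ≡⟨ Σ-cong B (λ k _ → inner k) ⟩
  Σ< B (λ k → χ k * φ (k ℕ.* k))             ∎
  where
  open ≡-Reasoning
  e g : ℕ → ℕ → ℤ
  e k i = 𝟙 (k ℕ.* k ℕ.≟ suc (24 ℕ.* i))
  g k i = e k i * χ k * φ (suc (24 ℕ.* i))
  inner : ∀ k → Σ< N (g k) ≡ χ k * φ (k ℕ.* k)
  inner k with χ-support k
  ... | inj₁ χk≡0 = trans (Σ-zero N (λ i _ → cong (_* φ (suc (24 ℕ.* i))) (trans (cong (e k i *_) χk≡0)
    (ℤ.*-zeroʳ (e k i)))))
                          (sym (cong (_* φ (k ℕ.* k)) χk≡0))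
  ... | inj₂ (j , k²≡) with j ℕ.<? N
  ...   | yes j<N = trans (Σ-single N j j<N off) on
    where
    off : ∀ i → i ℕ.< N → i ≢ j → g k i ≡ 0ℤ
    off i _ i≢j = cong (λ z → z * χ k * φ (suc (24 ℕ.* i))) (𝟙-no (k ℕ.* k ℕ.≟ _)
      (λ k²≡′ → i≢j (ℕ.*-cancelˡ-≡ i j 24 (ℕ.suc-injective (trans (sym k²≡′) k²≡)))))
    on : g k j ≡ χ k * φ (k ℕ.* k)
    on = cong₂ _*_ (trans (cong (_* χ k) (𝟙-yes (k ℕ.* k ℕ.≟ _) k²≡)) (ℤ.*-identityˡ (χ k))) (cong φ (sym k²≡))
  ...   | no j≮N = trans (Σ-zero N off)
                     (sym (trans (cong (χ k *_) (trans (cong φ k²≡) (φ≡0 j (ℕ.≮⇒≥ j≮N)))) (ℤ.*-zeroʳ (χ k))))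
    where
    off : ∀ i → i ℕ.< N → g k i ≡ 0ℤ
    off i i<N = cong (λ z → z * χ k * φ (suc (24 ℕ.* i))) (𝟙-no (k ℕ.* k ℕ.≟ _)
      (λ k²≡′ → j≮N (subst (ℕ._< N) (ℕ.*-cancelˡ-≡ i j 24 (ℕ.suc-injective (trans (sym k²≡′) k²≡))) i<N)))

module _ (D c : ℕ) (24c≡ : suc D ≡ 24 ℕ.* c) where

  -- The coefficient of `q^n` in η(z)η(Dz). The bound `24n` suffices because `X ≤ X²` and `Y ≤ DY²`,
  -- and the nested shape is what two uses of `Σ-euler` produce.
  latticeSum : ℕ → ℤ
  latticeSum n = Σ< (suc (24 ℕ.* n)) (λ X → χ X * Σ< (suc (24 ℕ.* n)) (λ Y → χ Y * 𝟙 (X ℕ.* X ℕ.+ D ℕ.* (Y ℕ.* Y) ℕ.≟ 24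
    ℕ.* n)))

  private
    D≢0 : ℕ.NonZero D
    D≢0 = go D c 24c≡
      where
      go : ∀ D c → suc D ≡ 24 ℕ.* c → ℕ.NonZero D
      go (suc D) _       _ = _
      go zero    (suc c) e = contradiction (ℕ.suc-injective (trans e (ℕ.*-suc 24 c))) (λ ())
      go zero    zero    ()

    instance
      D-nonZero : ℕ.NonZero D
      D-nonZero = D≢0

    1≤c : 1 ℕ.≤ c
    1≤c = go c 24c≡
      where
      go : ∀ c → suc D ≡ 24 ℕ.* c → 1 ℕ.≤ c
      go (suc c) _ = s≤s z≤n

    -- The number `c = (D + 1) / 24` is the order of η(z)η(Dz), whence the shift by `c` between the
    -- product of the two series and `latticeSum`.
    exponents : ∀ i j → suc (24 ℕ.* i) ℕ.+ D ℕ.* suc (24 ℕ.* j) ≡ 24 ℕ.* (i ℕ.+ j ℕ.* D ℕ.+ c)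
    exponents i j = trans (id₁ D i j) (trans (cong (ℕ._+ 24 ℕ.* (i ℕ.+ j ℕ.* D)) 24c≡) (id₂ c (i ℕ.+ j ℕ.* D)))
      where
      id₁ : ∀ D i j → suc (24 ℕ.* i) ℕ.+ D ℕ.* suc (24 ℕ.* j) ≡ suc D ℕ.+ 24 ℕ.* (i ℕ.+ j ℕ.* D)
      id₁ = ℕRing.solve-∀
      id₂ : ∀ c s → 24 ℕ.* c ℕ.+ 24 ℕ.* s ≡ 24 ℕ.* (s ℕ.+ c)
      id₂ = ℕRing.solve-∀

    outside : ∀ {n j} → n ℕ.< j → 24 ℕ.* (n ℕ.+ c) ℕ.< D ℕ.* suc (24 ℕ.* j)
    outside {n} {j} n<j = N<
      where
      id₁ : ∀ D j → D ℕ.* suc (24 ℕ.* j) ≡ D ℕ.+ 24 ℕ.* (j ℕ.* D)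
      id₁ = ℕRing.solve-∀
      id₂ : ∀ D n → D ℕ.+ 24 ℕ.* suc n ≡ suc (24 ℕ.* n ℕ.+ suc D ℕ.+ 22)
      id₂ = ℕRing.solve-∀
      N< : 24 ℕ.* (n ℕ.+ c) ℕ.< D ℕ.* suc (24 ℕ.* j)
      N< = begin-strict
        24 ℕ.* (n ℕ.+ c)               ≡⟨ ℕ.*-distribˡ-+ 24 n c ⟩
        24 ℕ.* n ℕ.+ 24 ℕ.* c          ≡⟨ cong (ℕ._+_ (24 ℕ.* n)) (sym 24c≡) ⟩
        24 ℕ.* n ℕ.+ suc D             ≤⟨ ℕ.m≤m+n _ 22 ⟩
        24 ℕ.* n ℕ.+ suc D ℕ.+ 22      <⟨ ℕ.n<1+n _ ⟩
        suc (24 ℕ.* n ℕ.+ suc D ℕ.+ 22) ≡⟨ sym (id₂ D n) ⟩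
        D ℕ.+ 24 ℕ.* suc n             ≤⟨ ℕ.+-monoʳ-≤ D (ℕ.*-monoʳ-≤ 24 (ℕ.≤-trans n<j (ℕ.m≤m*n j D))) ⟩
        D ℕ.+ 24 ℕ.* (j ℕ.* D)         ≡⟨ sym (id₁ D j) ⟩
        D ℕ.* suc (24 ℕ.* j)           ∎
        where open ℕ.≤-Reasoning

    bound : ∀ n → 2 ℕ.+ suc n ℕ.* 6 ℕ.≤ suc (24 ℕ.* (n ℕ.+ c))
    bound n = s≤s (begin
      suc (suc n ℕ.* 6)               ≤⟨ ℕ.m≤m+n _ (18 ℕ.* n ℕ.+ 17) ⟩
      suc (suc n ℕ.* 6) ℕ.+ (18 ℕ.* n ℕ.+ 17) ≡⟨ id₁ n ⟩
      24 ℕ.* (n ℕ.+ 1)                ≤⟨ ℕ.*-monoʳ-≤ 24 (ℕ.+-monoʳ-≤ n 1≤c) ⟩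
      24 ℕ.* (n ℕ.+ c)                ∎)
      where
      open ℕ.≤-Reasoning
      id₁ : ∀ n → suc (suc n ℕ.* 6) ℕ.+ (18 ℕ.* n ℕ.+ 17) ≡ 24 ℕ.* (n ℕ.+ 1)
      id₁ = ℕRing.solve-∀

  -- `Σ-euler` is applied first over `i`, with a test function `φ` that already contains the sum
  -- over `j`, and then over `j` for each `X`. By `exponents` the indicator in `φ` says
  -- `i + jD = n`, so `φ (24i + 1)` is the coefficient of `dilate D euler` at `n - i`.
  eulerProduct-latticeSum : ∀ n → (euler ⊛ dilate D euler) n ≡ latticeSum (n ℕ.+ c)
  eulerProduct-latticeSum n = begin
    Σ< (suc n) (λ i → euler i * dilate D euler (n ℕ.∸ i)) ≡⟨ Σ-cong (suc n) (λ i i≤n → cong (euler i *_)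
      (sym (φ-inside i (ℕ.s≤s⁻¹ i≤n)))) ⟩
    Σ< (suc n) (λ i → euler i * φ (suc (24 ℕ.* i)))       ≡⟨ Σ-euler (suc n) φ (bound n) φ-outside ⟩
    Σ< B (λ X → χ X * φ (X ℕ.* X))                        ≡⟨ Σ-cong B (λ X _ → cong (χ X *_)
      (Σ-euler (suc n) (φ₂ (X ℕ.* X)) (bound n) (φ₂-outside (X ℕ.* X)))) ⟩
    latticeSum (n ℕ.+ c)                                  ∎
    where
    open ≡-Reasoning
    N B : ℕ
    N = 24 ℕ.* (n ℕ.+ c)
    B = suc N
    φ₂ : ℕ → ℕ → ℤ
    φ₂ u v = 𝟙 (u ℕ.+ D ℕ.* v ℕ.≟ N)
    φ : ℕ → ℤ
    φ u = Σ< (suc n) (λ j → euler j * φ₂ u (suc (24 ℕ.* j)))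
    hit : ∀ i j → suc (24 ℕ.* i) ℕ.+ D ℕ.* suc (24 ℕ.* j) ≡ N → i ℕ.+ j ℕ.* D ≡ n
    hit i j e = ℕ.+-cancelʳ-≡ c _ _ (ℕ.*-cancelˡ-≡ _ _ 24 (trans (sym (exponents i j)) e))
    miss : ∀ i j → i ℕ.+ j ℕ.* D ≢ n → euler j * φ₂ (suc (24 ℕ.* i)) (suc (24 ℕ.* j)) ≡ 0ℤ
    miss i j ≢n = trans (cong (euler j *_) (𝟙-no (_ ℕ.≟ N) (λ e → ≢n (hit i j e)))) (ℤ.*-zeroʳ (euler j))
    φ-outside : ∀ i → suc n ℕ.≤ i → φ (suc (24 ℕ.* i)) ≡ 0ℤ
    φ-outside i n<i = Σ-zero (suc n) (λ j _ → miss i j (λ e → ℕ.<⇒≱ n<i (ℕ.m+n≤o⇒m≤o i (ℕ.≤-reflexive e))))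
    φ-inside : ∀ i → i ℕ.≤ n → φ (suc (24 ℕ.* i)) ≡ dilate D euler (n ℕ.∸ i)
    φ-inside i i≤n with D ∣? (n ℕ.∸ i)
    ... | yes (divides k eq) = trans (Σ-single (suc n) k (s≤s k≤n) (λ j _ j≢k → miss i j (λ e → j≢k
              (ℕ.*-cancelʳ-≡ j k D (trans (sym (ℕ.m+n∸m≡n i (j ℕ.* D))) (trans (cong (ℕ._∸ i) e) eq))))))
            (trans (cong (euler k *_) (𝟙-yes (_ ℕ.≟ N) (trans (exponents i k) (cong (λ z → 24 ℕ.* (z ℕ.+ c)) i+kD≡n))))
              (ℤ.*-identityʳ (euler k)))
      where
      i+kD≡n : i ℕ.+ k ℕ.* D ≡ n
      i+kD≡n = trans (cong (ℕ._+_ i) (sym eq)) (ℕ.m+[n∸m]≡n i≤n)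
      k≤n : k ℕ.≤ n
      k≤n = ℕ.≤-trans (ℕ.m≤m*n k D) (ℕ.m+n≤o⇒n≤o i (ℕ.≤-reflexive i+kD≡n))
    ... | no D∤ = Σ-zero (suc n) (λ j _ → miss i j
      (λ e → D∤ (divides j (trans (cong (ℕ._∸ i) (sym e)) (ℕ.m+n∸m≡n i (j ℕ.* D))))))
    φ₂-outside : ∀ u j → suc n ℕ.≤ j → φ₂ u (suc (24 ℕ.* j)) ≡ 0ℤ
    φ₂-outside u j n<j = 𝟙-no (_ ℕ.≟ N) (λ e → ℕ.<⇒≱ (outside n<j) (ℕ.m+n≤o⇒n≤o u (ℕ.≤-reflexive e)))

  -- Below `c` one has `24n < D`, so a solution needs `Y = 0`, where `χ` vanishes.
  latticeSum-small : ∀ n → n ℕ.< c → latticeSum n ≡ 0ℤ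
  latticeSum-small n n<c = Σ-zero (suc (24 ℕ.* n))
    (λ X _ → trans (cong (χ X *_) (Σ-zero (suc (24 ℕ.* n)) (λ Y _ → small X Y))) (ℤ.*-zeroʳ (χ X)))
    where
    24n<D : 24 ℕ.* n ℕ.< D
    24n<D = ℕ.s<s⁻¹ (begin-strict
      suc (24 ℕ.* n)       <⟨ s≤s (ℕ.m<n+m (24 ℕ.* n) {23} (s≤s z≤n)) ⟩
      suc (23 ℕ.+ 24 ℕ.* n) ≡⟨ sym (ℕ.*-suc 24 n) ⟩
      24 ℕ.* suc n         ≤⟨ ℕ.*-monoʳ-≤ 24 n<c ⟩
      24 ℕ.* c             ≡⟨ sym 24c≡ ⟩
      suc D                ∎)
      where open ℕ.≤-Reasoning
    small : ∀ X Y → χ Y * 𝟙 (X ℕ.* X ℕ.+ D ℕ.* (Y ℕ.* Y) ℕ.≟ 24 ℕ.* n) ≡ 0ℤ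
    small X zero    = refl
    small X (suc Y) = trans (cong (χ (suc Y) *_) (𝟙-no (_ ℕ.≟ _) (λ e → ℕ.<⇒≱ 24n<D
      (ℕ.≤-trans (ℕ.m≤m*n D (suc Y ℕ.* suc Y)) (ℕ.m+n≤o⇒n≤o (X ℕ.* X) (ℕ.≤-reflexive e)))))) (ℤ.*-zeroʳ (χ (suc Y)))

-- The theta functions of 6x² + κxy + ky²

𝟙-× : ∀ {P Q : Set} (P? : Dec P) (Q? : Dec Q) → 𝟙 (P? ×-dec Q?) ≡ 𝟙 P? * 𝟙 Q?
𝟙-× (yes p) (yes q) = refl
𝟙-× (yes p) (no ¬q) = refl
𝟙-× (no ¬p) (yes q) = refl
𝟙-× (no ¬p) (no ¬q) = refl

∣i∣*∣i∣ : ∀ i → + (∣ i ∣ ℕ.* ∣ i ∣) ≡ i * i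
∣i∣*∣i∣ (+ n)    = ℤ.pos-* n n
∣i∣*∣i∣ -[1+ n ] = refl

m≤m*m : ∀ m → m ℕ.≤ m ℕ.* m
m≤m*m zero    = z≤n
m≤m*m (suc m) = ℕ.m≤m*n (suc m) (suc m)

module _ (D n : ℕ) where

  Solution : ℤ × ℤ → Set
  Solution (X , Y) = ∣ X ∣ ℕ.* ∣ X ∣ ℕ.+ D ℕ.* (∣ Y ∣ ℕ.* ∣ Y ∣) ≡ 24 ℕ.* n

  solution? : Decidable Solution
  solution? (X , Y) = ∣ X ∣ ℕ.* ∣ X ∣ ℕ.+ D ℕ.* (∣ Y ∣ ℕ.* ∣ Y ∣) ℕ.≟ 24 ℕ.* n

  square : List (ℤ × ℤ)
  square = cartesianProduct (symmetricInterval (24 ℕ.* n)) (symmetricInterval (24 ℕ.* n))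

  -- For `24k = D + κ²` and `ε² = 1`, this describes the image of the representations of `n` by
  -- `(6, κ, k)` under `(x, y) ↦ (ε (12x + κy), y)`.
  fibre? : ∀ ε κ → Decidable (λ v → Solution v × + 12 Signed.∣ ε * proj₁ v - κ * proj₂ v)
  fibre? ε κ v = solution? v ×-dec (+ 12 Signed.∣? (ε * proj₁ v - κ * proj₂ v))

  solution-ℤ : ∀ X Y → + (∣ X ∣ ℕ.* ∣ X ∣ ℕ.+ D ℕ.* (∣ Y ∣ ℕ.* ∣ Y ∣)) ≡ X * X + + D * (Y * Y)
  solution-ℤ X Y = trans (ℤ.pos-+ (∣ X ∣ ℕ.* ∣ X ∣) _) (cong₂ _+_ (∣i∣*∣i∣ X) (trans (ℤ.pos-* D _)
    (cong (+ D *_) (∣i∣*∣i∣ Y))))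

  module _ .{{_ : ℕ.NonZero D}} (ε κ k : ℤ) (ε²≡1 : ε * ε ≡ 1ℤ) (24k≡ : + 24 * k ≡ + D + κ * κ) where

    completeSquare : ∀ x y → + 24 * eval (form (+ 6) κ k) x y ≡
      ε * (+ 12 * x + κ * y) * (ε * (+ 12 * x + κ * y)) + + D * (y * y)
    completeSquare x y = begin
      + 24 * (+ 6 * (x * x) + κ * (x * y) + k * (y * y))                ≡⟨ id₁ κ k x y ⟩
      + 144 * (x * x) + + 24 * (κ * (x * y)) + + 24 * k * (y * y)       ≡⟨ cong (λ z → + 144 * (x * x) + + 24 *
        (κ * (x * y)) + z * (y * y)) 24k≡ ⟩
      + 144 * (x * x) + + 24 * (κ * (x * y)) + (+ D + κ * κ) * (y * y)  ≡⟨ id₂ κ (+ D) x y ⟩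
      1ℤ * ((+ 12 * x + κ * y) * (+ 12 * x + κ * y)) + + D * (y * y)    ≡⟨ cong
        (λ z → z * ((+ 12 * x + κ * y) * (+ 12 * x + κ * y)) + + D * (y * y)) (sym ε²≡1) ⟩
      ε * ε * ((+ 12 * x + κ * y) * (+ 12 * x + κ * y)) + + D * (y * y) ≡⟨ id₃ ε (+ 12 * x + κ * y) (+ D * (y * y)) ⟩
      ε * (+ 12 * x + κ * y) * (ε * (+ 12 * x + κ * y)) + + D * (y * y) ∎
      where
      open ≡-Reasoning
      id₁ : ∀ κ k x y → + 24 * (+ 6 * (x * x) + κ * (x * y) + k * (y * y)) ≡ + 144 * (x * x) + + 24 * (κ * (x * y)) + +
        24 * k * (y * y)
      id₁ = ℤRing.solve-∀
      id₂ : ∀ κ D x y → + 144 * (x * x) + + 24 * (κ * (x * y)) + (D + κ * κ) * (y * y) ≡ 1ℤ * ((+ 12 * x + κ * y) *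
        (+ 12 * x + κ * y)) + D * (y * y)
      id₂ = ℤRing.solve-∀
      id₃ : ∀ e s t → e * e * (s * s) + t ≡ e * s * (e * s) + t
      id₃ = ℤRing.solve-∀

    ε-cancel : ∀ z → ε * (ε * z) ≡ z
    ε-cancel z = trans (sym (ℤ.*-assoc ε ε z)) (trans (cong (_* z) ε²≡1) (ℤ.*-identityˡ z))

    representations-fibre : PositiveDefinite (form (+ 6) κ k) → representations (form (+ 6) κ k) n ≡ count (fibre? ε κ)
      square
    representations-fibre pd = representations-count (form (+ 6) κ k) pd n (fibre? ε κ) unique f injective to from
      where
      unique = Unique.cartesianProduct⁺ (symmetricInterval-unique (24 ℕ.* n)) (symmetricInterval-unique (24 ℕ.* n))
      f : ℤ × ℤ → ℤ × ℤ
      f (x , y) = ε * (+ 12 * x + κ * y) , y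
      cancelʳ : ∀ a b → a + b - b ≡ a
      cancelʳ = ℤRing.solve-∀
      injective : ∀ {u v} → f u ≡ f v → u ≡ v
      injective {x , y} {x′ , y′} e with refl ← cong proj₂ e = cong (_, y)
        (ℤ.*-cancelˡ-≡ (+ 12) x x′ (trans (sym (cancelʳ (+ 12 * x) (κ * y))) (trans (cong (_- κ * y)
          (trans (sym (ε-cancel (+ 12 * x + κ * y))) (trans (cong (λ v → ε * proj₁ v) e)
            (ε-cancel (+ 12 * x′ + κ * y)))))
          (cancelʳ (+ 12 * x′) (κ * y)))))
      solution : ∀ x y → eval (form (+ 6) κ k) x y ≡ + n → Solution (f (x , y))
      solution x y e = ℤ.+-injective (trans (solution-ℤ (ε * (+ 12 * x + κ * y)) y) (trans (sym (completeSquare x y))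
        (trans (cong (+ 24 *_) e) (sym (ℤ.pos-* 24 n)))))
      ∈square : ∀ X Y → Solution (X , Y) → (X , Y) ∈ square
      ∈square X Y s = ∈-cartesianProduct⁺
        (∈-symmetricInterval _ X (ℕ.≤-trans (m≤m*m ∣ X ∣) (ℕ.m+n≤o⇒m≤o _ (ℕ.≤-reflexive s))))
        (∈-symmetricInterval _ Y (ℕ.≤-trans (m≤m*m ∣ Y ∣) (ℕ.≤-trans (ℕ.m≤n*m _ D) (ℕ.m+n≤o⇒n≤o (∣ X ∣ ℕ.* ∣ X ∣)
          (ℕ.≤-reflexive s)))))
      to : ∀ x y → eval (form (+ 6) κ k) x y ≡ + n → f (x , y) ∈ square × (Solution (f (x , y)) × + 12 Signed.∣ ε *
        (ε * (+ 12 * x + κ * y)) - κ * y)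
      to x y e = ∈square (ε * (+ 12 * x + κ * y)) y (solution x y e) , solution x y e ,
        Signed.divides x (trans (cong (_- κ * y) (ε-cancel (+ 12 * x + κ * y))) (trans (cancelʳ (+ 12 * x) (κ * y))
          (ℤ.*-comm (+ 12) x)))
      from : ∀ {v} → Solution v × + 12 Signed.∣ ε * proj₁ v - κ * proj₂ v → ∃[ x ] ∃[ y ] (eval (form (+ 6) κ k) x y ≡ +
        n × f (x , y) ≡ v)
      from {X , Y} (s , Signed.divides x e) = x , Y , ℤ.*-cancelˡ-≡ (+ 24) _ _ 24Q≡ , cong (_, Y) fx≡X
        where
        restore : ∀ a b → a ≡ a - b + b
        restore = ℤRing.solve-∀
        fx≡X : ε * (+ 12 * x + κ * Y) ≡ X
        fx≡X = trans (cong (λ z → ε * (z + κ * Y)) (trans (ℤ.*-comm (+ 12) x) (sym e)))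
          (trans (cong (ε *_) (sym (restore (ε * X) (κ * Y)))) (ε-cancel X))
        24Q≡ : + 24 * eval (form (+ 6) κ k) x Y ≡ + 24 * + n
        24Q≡ = trans (completeSquare x Y) (trans (cong (λ z → z * z + + D * (Y * Y)) fx≡X)
          (trans (sym (solution-ℤ X Y)) (trans (cong +_ s) (ℤ.pos-* 24 n))))

  fibreSum : ℤ → ℤ → ℤ
  fibreSum ε κ = Σᴸ square (λ v → 𝟙 (fibre? ε κ v))

  χχ : ℤ × ℤ → ℤ
  χχ (X , Y) = χ ∣ X ∣ * χ ∣ Y ∣

  fibreSum-alternating : (fibreSum 1ℤ 1ℤ + fibreSum -1ℤ 1ℤ) + - (fibreSum 1ℤ (+ 5) + fibreSum -1ℤ (+ 5)) ≡
    Σᴸ square (λ v → 𝟙 (solution? v) * χχ v)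
  fibreSum-alternating = begin
    (fibreSum 1ℤ 1ℤ + fibreSum -1ℤ 1ℤ) + - (fibreSum 1ℤ (+ 5) + fibreSum -1ℤ (+ 5))
      ≡⟨ cong₂ (λ p q → p + - q) (sym (Σᴸ-+ square (T 1ℤ 1ℤ) (T -1ℤ 1ℤ))) (sym (Σᴸ-+ square (T 1ℤ (+ 5)) (T -1ℤ (+ 5))))
        ⟩
    Σᴸ square (λ v → T 1ℤ 1ℤ v + T -1ℤ 1ℤ v) + - Σᴸ square (λ v → T 1ℤ (+ 5) v + T -1ℤ (+ 5) v)
      ≡⟨ cong (_+_ (Σᴸ square (λ v → T 1ℤ 1ℤ v + T -1ℤ 1ℤ v)))
        (sym (Σᴸ-neg square (λ v → T 1ℤ (+ 5) v + T -1ℤ (+ 5) v))) ⟩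
    Σᴸ square (λ v → T 1ℤ 1ℤ v + T -1ℤ 1ℤ v) + Σᴸ square (λ v → - (T 1ℤ (+ 5) v + T -1ℤ (+ 5) v))
      ≡⟨ sym (Σᴸ-+ square (λ v → T 1ℤ 1ℤ v + T -1ℤ 1ℤ v) (λ v → - (T 1ℤ (+ 5) v + T -1ℤ (+ 5) v))) ⟩
    Σᴸ square (λ v → (T 1ℤ 1ℤ v + T -1ℤ 1ℤ v) + - (T 1ℤ (+ 5) v + T -1ℤ (+ 5) v))
      ≡⟨ Σᴸ-cong square pointwise ⟩
    Σᴸ square (λ v → 𝟙 (solution? v) * χχ v) ∎
    where
    open ≡-Reasoning
    T : ℤ → ℤ → ℤ × ℤ → ℤ
    T ε κ v = 𝟙 (fibre? ε κ v)
    factor : ∀ s a b c d → (s * a + s * b) + - (s * c + s * d) ≡ s * ((a + b) - (c + d))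
    factor = ℤRing.solve-∀
    congF : ∀ {a b c d a′ b′ c′ d′ : ℤ} → a ≡ a′ → b ≡ b′ → c ≡ c′ → d ≡ d′ → (a + b) + - (c + d) ≡ (a′ + b′) + -
      (c′ + d′)
    congF refl refl refl refl = refl
    pointwise : ∀ v → (T 1ℤ 1ℤ v + T -1ℤ 1ℤ v) + - (T 1ℤ (+ 5) v + T -1ℤ (+ 5) v) ≡ 𝟙 (solution? v) * χχ v
    pointwise (X , Y) = trans (congF (e 1ℤ 1ℤ) (e -1ℤ 1ℤ) (e 1ℤ (+ 5)) (e -1ℤ (+ 5)))
      (trans (factor (𝟙 (solution? (X , Y))) [12∣ 1ℤ * X - 1ℤ * Y ] [12∣ -1ℤ * X - 1ℤ * Y ] [12∣ 1ℤ * X - + 5 * Y ] [12∣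
        -1ℤ * X - + 5 * Y ])
        (cong (𝟙 (solution? (X , Y)) *_) (ψ≡χχ X Y)))
      where
      e : ∀ ε κ → T ε κ (X , Y) ≡ 𝟙 (solution? (X , Y)) * [12∣ ε * X - κ * Y ]
      e ε κ = 𝟙-× (solution? (X , Y)) (+ 12 Signed.∣? (ε * X - κ * Y))

  -- The summand is even in `X` and in `Y` and vanishes on both axes because `χ 0 = 0`, so the four
  -- quadrants contribute equally.
  squareSum : ∀ c → (24c≡ : suc D ≡ 24 ℕ.* c) → Σᴸ square (λ v → 𝟙 (solution? v) * χχ v) ≡ + 4 * latticeSum D c 24c≡ n
  squareSum c 24c≡ = begin
    Σᴸ square h                                      ≡⟨ Σᴸ-cartesianProduct S S h ⟩
    Σᴸ S (λ X → Σᴸ S (λ Y → h (X , Y)))              ≡⟨ Σᴸ-cong S (λ X → Σᴸ-symmetricInterval N (λ Y → h (X , Y))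
      (h0ʳ X) (λ _ → refl)) ⟩
    Σᴸ S (λ X → + 2 * Σ< (suc N) (λ Y → h (X , + Y))) ≡⟨ Σᴸ-symmetricInterval N (λ X → + 2 * Σ< (suc N)
      (λ Y → h (X , + Y))) (cong (+ 2 *_) (Σ-zero (suc N) (λ Y _ → h0ˡ (+ Y)))) (λ _ → refl) ⟩
    + 2 * Σ< (suc N) (λ X → + 2 * Σ< (suc N) (λ Y → h (+ X , + Y))) ≡⟨ cong (+ 2 *_)
      (sym (Σ-*ˡ (suc N) (+ 2) (λ X → Σ< (suc N) (λ Y → h (+ X , + Y))))) ⟩
    + 2 * (+ 2 * Σ< (suc N) (λ X → Σ< (suc N) (λ Y → h (+ X , + Y)))) ≡⟨ sym (ℤ.*-assoc (+ 2) (+ 2)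
      (Σ< (suc N) (λ X → Σ< (suc N) (λ Y → h (+ X , + Y))))) ⟩
    + 4 * Σ< (suc N) (λ X → Σ< (suc N) (λ Y → h (+ X , + Y))) ≡⟨ cong (+ 4 *_) (Σ-cong (suc N) (λ X _ → pull X)) ⟩
    + 4 * latticeSum D c 24c≡ n                      ∎
    where
    open ≡-Reasoning
    N : ℕ
    N = 24 ℕ.* n
    S : List ℤ
    S = symmetricInterval N
    h : ℤ × ℤ → ℤ
    h v = 𝟙 (solution? v) * χχ v
    h0ˡ : ∀ Y → h (0ℤ , Y) ≡ 0ℤ
    h0ˡ Y = ℤ.*-zeroʳ (𝟙 (solution? (0ℤ , Y)))
    h0ʳ : ∀ X → h (X , 0ℤ) ≡ 0ℤ
    h0ʳ X = trans (cong (𝟙 (solution? (X , 0ℤ)) *_) (ℤ.*-zeroʳ (χ ∣ X ∣))) (ℤ.*-zeroʳ (𝟙 (solution? (X , 0ℤ))))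
    comm : ∀ a b c → a * (b * c) ≡ b * (c * a)
    comm = ℤRing.solve-∀
    pull : ∀ X → Σ< (suc N) (λ Y → h (+ X , + Y)) ≡ χ X * Σ< (suc N) (λ Y → χ Y * 𝟙 (X ℕ.* X ℕ.+ D ℕ.* (Y ℕ.* Y) ℕ.≟ N))
    pull X = trans (Σ-cong (suc N) (λ Y _ → comm (𝟙 (solution? (+ X , + Y))) (χ X) (χ Y)))
      (sym (Σ-*ˡ (suc N) (χ X) (λ Y → χ Y * 𝟙 (X ℕ.* X ℕ.+ D ℕ.* (Y ℕ.* Y) ℕ.≟ N))))

  -- Each representation number is the size of the fibre for either sign `ε`, so twice the
  -- difference is an alternating sum of four fibres. Only with both signs present do the conditions
  -- modulo 12 combine to a product of characters; the result is four lattice sums, one for each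
  -- quadrant.
  thetaDifference : ∀ c → (24c≡ : suc D ≡ 24 ℕ.* c) → .{{_ : ℕ.NonZero D}} → ∀ k₁ k₅ → + 24 * k₁ ≡ + D + 1ℤ * 1ℤ → + 24
    * k₅ ≡ + D + + 5 * + 5 →
    PositiveDefinite (form (+ 6) (+ 1) k₁) → PositiveDefinite (form (+ 6) (+ 5) k₅) →
    + representations (form (+ 6) (+ 1) k₁) n - + representations (form (+ 6) (+ 5) k₅) n ≡ + 2 * latticeSum D c 24c≡ n
  thetaDifference c 24c≡ k₁ k₅ e₁ e₅ pd₁ pd₅ = ℤ.*-cancelˡ-≡ (+ 2) _ _ (begin
    + 2 * (+ r₁ - + r₅)                         ≡⟨ double (+ r₁) (+ r₅) ⟩
    (+ r₁ + + r₁) + - (+ r₅ + + r₅)             ≡⟨ cong₂ (λ p q → p + - q) (cong₂ _+_ (fib 1ℤ refl 1ℤ k₁ e₁ pd₁)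
      (fib -1ℤ refl 1ℤ k₁ e₁ pd₁)) (cong₂ _+_ (fib 1ℤ refl (+ 5) k₅ e₅ pd₅) (fib -1ℤ refl (+ 5) k₅ e₅ pd₅)) ⟩
    (fibreSum 1ℤ 1ℤ + fibreSum -1ℤ 1ℤ) + - (fibreSum 1ℤ (+ 5) + fibreSum -1ℤ (+ 5)) ≡⟨ fibreSum-alternating ⟩
    Σᴸ square (λ v → 𝟙 (solution? v) * χχ v)    ≡⟨ squareSum c 24c≡ ⟩
    + 4 * latticeSum D c 24c≡ n                 ≡⟨ ℤ.*-assoc (+ 2) (+ 2) (latticeSum D c 24c≡ n) ⟩
    + 2 * (+ 2 * latticeSum D c 24c≡ n)         ∎)
    where
    open ≡-Reasoning
    r₁ r₅ : ℕ
    r₁ = representations (form (+ 6) (+ 1) k₁) n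
    r₅ = representations (form (+ 6) (+ 5) k₅) n
    double : ∀ a b → + 2 * (a - b) ≡ (a + a) + - (b + b)
    double = ℤRing.solve-∀
    fib : ∀ ε → ε * ε ≡ 1ℤ → ∀ κ k → + 24 * k ≡ + D + κ * κ → PositiveDefinite (form (+ 6) κ k) →
      + representations (form (+ 6) κ k) n ≡ fibreSum ε κ
    fib ε ε² κ k e pd = trans (cong +_ (representations-fibre ε κ k ε² e pd)) (count-Σᴸ (fibre? ε κ) square)

-- Reduction of binary quadratic forms

-- Completing the square: `4a Q(x, y) = (2ax + by)² + d y²`.
positiveDefinite : ∀ a b c d .{{_ : ℕ.NonZero a}} .{{_ : ℕ.NonZero d}} →
  discriminant (form (+ a) b c) ≡ - (+ d) → PositiveDefinite (form (+ a) b c)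
positiveDefinite a@(suc _) b c d disc x y xy≢0 = ℤ.*-cancelˡ-<-nonNeg (+ 4 * + a)
  (subst (ℤ._< + 4 * + a * eval (form (+ a) b c) x y) (sym (ℤ.*-zeroʳ (+ 4 * + a))) (subst (0ℤ ℤ.<_) (sym 4aQ)
    (0<+ n n≢0)))
  where
  n : ℕ
  n = ∣ + 2 * + a * x + b * y ∣ ℕ.* ∣ + 2 * + a * x + b * y ∣ ℕ.+ d ℕ.* (∣ y ∣ ℕ.* ∣ y ∣)
  0<+ : ∀ n → n ≢ 0 → 0ℤ ℤ.< + n
  0<+ zero    n≢0 = contradiction refl n≢0
  0<+ (suc n) _   = +<+ (s≤s z≤n)
  i*i≡0 : ∀ i → ∣ i ∣ ℕ.* ∣ i ∣ ≡ 0 → i ≡ 0ℤ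
  i*i≡0 i e with ℕ.m*n≡0⇒m≡0∨n≡0 ∣ i ∣ e
  ... | inj₁ e′ = ℤ.∣i∣≡0⇒i≡0 e′
  ... | inj₂ e′ = ℤ.∣i∣≡0⇒i≡0 e′
  n≢0 : n ≢ 0
  n≢0 e = xy≢0 (x≡0 , y≡0)
    where
    y≡0 : y ≡ 0ℤ
    y≡0 = i*i≡0 y (ℕ.m*n≡0⇒m≡0 _ d (trans (ℕ.*-comm _ d) (ℕ.m+n≡0⇒n≡0 (∣ + 2 * + a * x + b * y ∣ ℕ.* ∣ + 2 * + a * x + b
      * y ∣) e)))
    2ax≡0 : + 2 * + a * x ≡ + 2 * + a * 0ℤ
    2ax≡0 = trans (sym (ℤ.+-identityʳ _))
      (trans (cong (_+_ (+ 2 * + a * x)) (sym (trans (cong (b *_) y≡0) (ℤ.*-zeroʳ b))))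
      (trans (i*i≡0 _ (ℕ.m+n≡0⇒m≡0 _ e)) (sym (ℤ.*-zeroʳ (+ 2 * + a)))))
    x≡0 : x ≡ 0ℤ
    x≡0 = ℤ.*-cancelˡ-≡ (+ 2 * + a) x 0ℤ 2ax≡0
  4aQ : + 4 * + a * eval (form (+ a) b c) x y ≡ + n
  4aQ = begin
    + 4 * + a * (+ a * (x * x) + b * (x * y) + c * (y * y)) ≡⟨ id (+ a) b c x y ⟩
    s * s + - (b * b - + 4 * (+ a * c)) * (y * y) ≡⟨ cong (λ z → s * s + - z * (y * y)) disc ⟩
    s * s + - (- (+ d)) * (y * y)                 ≡⟨ cong (λ z → s * s + z * (y * y)) (ℤ.neg-involutive (+ d)) ⟩
    s * s + + d * (y * y)                         ≡⟨ sym (cong₂ _+_ (∣i∣*∣i∣ s) (trans (ℤ.pos-* d _)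
      (cong (+ d *_) (∣i∣*∣i∣ y)))) ⟩
    + (∣ s ∣ ℕ.* ∣ s ∣) + + (d ℕ.* (∣ y ∣ ℕ.* ∣ y ∣)) ≡⟨ sym (ℤ.pos-+ (∣ s ∣ ℕ.* ∣ s ∣) _) ⟩
    + n                                           ∎
    where
    open ≡-Reasoning
    s : ℤ
    s = + 2 * + a * x + b * y
    id : ∀ a b c x y → + 4 * a * (a * (x * x) + b * (x * y) + c * (y * y)) ≡
      (+ 2 * a * x + b * y) * (+ 2 * a * x + b * y) + - (b * b - + 4 * (a * c)) * (y * y)
    id = ℤRing.solve-∀

properlyEquivalent-trans : ∀ {Q₁ Q₂ Q₃} → ProperlyEquivalent Q₁ Q₂ → ProperlyEquivalent Q₂ Q₃ → ProperlyEquivalent Q₁ Q₃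
properlyEquivalent-trans {Q₁} {Q₂} {Q₃} (p , q , r , s , det , e) (p′ , q′ , r′ , s′ , det′ , e′) =
  p′ * p + q′ * r , p′ * q + q′ * s , r′ * p + s′ * r , r′ * q + s′ * s ,
  trans (id₁ p q r s p′ q′ r′ s′) (cong₂ _*_ det′ det) ,
  λ x y → trans (e x y) (trans (e′ (p * x + q * y) (r * x + s * y)) (cong₂ (eval Q₃) (id₂ p q r s p′ q′ x y)
    (id₂ p q r s r′ s′ x y)))
  where
  id₁ : ∀ p q r s p′ q′ r′ s′ → (p′ * p + q′ * r) * (r′ * q + s′ * s) - (p′ * q + q′ * s) * (r′ * p + s′ * r) ≡
    (p′ * s′ - q′ * r′) * (p * s - q * r)
  id₁ = ℤRing.solve-∀
  id₂ : ∀ p q r s p′ q′ x y → p′ * (p * x + q * y) + q′ * (r * x + s * y) ≡ (p′ * p + q′ * r) * x + (p′ * q + q′ * s) *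
    y
  id₂ = ℤRing.solve-∀

properlyEquivalent-representations : ∀ Q Q′ → PositiveDefinite Q → PositiveDefinite Q′ → ProperlyEquivalent Q Q′ →
  ∀ n → representations Q n ≡ representations Q′ n
properlyEquivalent-representations Q Q′ pd pd′ (p , q , r , s , det , e) = representations-≡ Q Q′ pd pd′
  (λ (x , y) → p * x + q * y , r * x + s * y) (λ (x , y) → s * x + - q * y , - r * x + p * y)
  (λ (x , y) → cong₂ _,_ (by det (id₁ p q r s x y)) (by det (id₂ p q r s x y)))
  (λ (x , y) → cong₂ _,_ (by det (id₃ p q r s x y)) (by det (id₄ p q r s x y)))
  (λ x y → sym (e x y))
  where
  by : ∀ {d z w} → d ≡ 1ℤ → w ≡ d * z → w ≡ z
  by {z = z} refl w≡ = trans w≡ (ℤ.*-identityˡ z)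
  id₁ : ∀ p q r s x y → s * (p * x + q * y) + - q * (r * x + s * y) ≡ (p * s - q * r) * x
  id₁ = ℤRing.solve-∀
  id₂ : ∀ p q r s x y → - r * (p * x + q * y) + p * (r * x + s * y) ≡ (p * s - q * r) * y
  id₂ = ℤRing.solve-∀
  id₃ : ∀ p q r s x y → p * (s * x + - q * y) + q * (- r * x + p * y) ≡ (p * s - q * r) * x
  id₃ = ℤRing.solve-∀
  id₄ : ∀ p q r s x y → r * (s * x + - q * y) + s * (- r * x + p * y) ≡ (p * s - q * r) * y
  id₄ = ℤRing.solve-∀

conjugate-representations : ∀ Q → PositiveDefinite Q → PositiveDefinite (conjugate Q) →
  ∀ n → representations Q n ≡ representations (conjugate Q) n
conjugate-representations Q@(form a b c) pd pd′ = representations-≡ Q (conjugate Q) pd pd′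
  (λ (x , y) → x , - y) (λ (x , y) → x , - y)
  (λ (x , y) → cong (x ,_) (ℤ.neg-involutive y)) (λ (x , y) → cong (x ,_) (ℤ.neg-involutive y))
  (id a b c)
  where
  id : ∀ a b c x y → a * (x * x) + - b * (x * - y) + c * (- y * - y) ≡ a * (x * x) + b * (x * y) + c * (y * y)
  id = ℤRing.solve-∀

centredResidue : ∀ a b .{{_ : ℕ.NonZero a}} → ∃[ k ] ∣ b + + 2 * + a * k ∣ ℕ.≤ a
centredResidue a@(suc _) b = go (r ℕ.≤? a)
  where
  r : ℕ
  r = b ℤ.%ℕ (2 ℕ.* a)
  m : ℤ
  m = b ℤ./ℕ (2 ℕ.* a)
  b≡ : b ≡ + r + m * (+ 2 * + a)
  b≡ = trans (ℤ.a≡a%ℕn+[a/ℕn]*n b (2 ℕ.* a)) (cong (λ z → + r + m * z) (ℤ.pos-* 2 a))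
  id₁ : ∀ r m a → r + m * (+ 2 * a) + + 2 * a * - m ≡ r
  id₁ = ℤRing.solve-∀
  id₂ : ∀ r m a → r + m * (+ 2 * a) + + 2 * a * (- m - + 1) ≡ - (+ 2 * a - r)
  id₂ = ℤRing.solve-∀
  go : Dec (r ℕ.≤ a) → ∃[ k ] ∣ b + + 2 * + a * k ∣ ℕ.≤ a
  go (yes r≤a) = - m , subst (ℕ._≤ a) (sym (cong ∣_∣ (trans (cong (_+ + 2 * + a * - m) b≡) (id₁ (+ r) m (+ a))))) r≤a
  go (no  r≰a) = - m - + 1 , subst (ℕ._≤ a) (sym ∣b′∣≡) (ℕ.m≤n+o⇒m∸n≤o (2 ℕ.* a) r
      (subst (ℕ._≤ r ℕ.+ a) (cong (ℕ._+_ a) (sym (ℕ.+-identityʳ a))) (ℕ.+-monoˡ-≤ a (ℕ.<⇒≤ (ℕ.≰⇒> r≰a)))))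
    where
    r≤2a : r ℕ.≤ 2 ℕ.* a
    r≤2a = ℕ.<⇒≤ (ℤ.n%ℕd<d b (2 ℕ.* a))
    ∣b′∣≡ : ∣ b + + 2 * + a * (- m - + 1) ∣ ≡ 2 ℕ.* a ℕ.∸ r
    ∣b′∣≡ = trans (cong ∣_∣ (trans (cong (_+ + 2 * + a * (- m - + 1)) b≡) (id₂ (+ r) m (+ a))))
      (trans (ℤ.∣-i∣≡∣i∣ (+ 2 * + a - + r)) (cong ∣_∣ (trans (cong (_- + r) (sym (ℤ.pos-* 2 a))) (-‿≥ r≤2a))))

-- Up to conjugation the middle coefficient is nonnegative, so the coefficients can be natural
-- numbers, and the discriminant is stated without subtraction.
record AlmostReduced (D : ℕ) : Set where
  constructor almostReduced
  field
    a b c    : ℕ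
    b≤a      : b ℕ.≤ a
    a≤c      : a ℕ.≤ c
    D+b²≡4ac : D ℕ.+ b ℕ.* b ≡ 4 ℕ.* (a ℕ.* c)

  toForm : Form
  toForm = form (+ a) (+ b) (+ c)

module _ {D : ℕ} .{{D-nonZero : ℕ.NonZero D}} (R : AlmostReduced D) where
  open AlmostReduced R renaming (a to α; b to β; c to γ; D+b²≡4ac to eq)

  a-nonZero : ℕ.NonZero α
  a-nonZero = go α eq
    where
    go : ∀ α → D ℕ.+ β ℕ.* β ≡ 4 ℕ.* (α ℕ.* γ) → ℕ.NonZero α
    go zero    e = contradiction (ℕ.m+n≡0⇒m≡0 D e) (ℕ.≢-nonZero⁻¹ D)
    go (suc _) _ = _

  private
    discR : + β * + β - + 4 * (+ α * + γ) ≡ - (+ D)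
    discR = trans (cong (λ z → + β * + β - z) (sym (trans (cong₂ _+_ (refl {x = + D}) (sym (ℤ.pos-* β β)))
      (trans (sym (ℤ.pos-+ D (β ℕ.* β))) (trans (cong +_ eq) (trans (ℤ.pos-* 4 (α ℕ.* γ))
        (cong (+ 4 *_) (ℤ.pos-* α γ)))))))) (id₁ (+ β) (+ D))
      where
      id₁ : ∀ b d → b * b - (d + b * b) ≡ - d
      id₁ = ℤRing.solve-∀

  toForm-positiveDefinite : PositiveDefinite toForm
  toForm-positiveDefinite = positiveDefinite α (+ β) (+ γ) D {{a-nonZero}} discR

  conjugate-positiveDefinite : PositiveDefinite (conjugate toForm)
  conjugate-positiveDefinite = positiveDefinite α (- (+ β)) (+ γ) D {{a-nonZero}}
    (trans (cong (_- + 4 * (+ α * + γ)) (id₂ (+ β))) discR)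
    where
    id₂ : ∀ b → - b * - b ≡ b * b
    id₂ = ℤRing.solve-∀

reduction : ∀ D .{{_ : ℕ.NonZero D}} Q → HasLevel D Q →
  ∃[ R ] (EquivalentUpToConjugation Q (AlmostReduced.toForm {D} R)
    × (∀ n → representations Q n ≡ representations (AlmostReduced.toForm R) n))
reduction D Q@(form a b c) level = go a 0<a pd disc
  where
  open HasLevel level renaming (positiveDefinite to pd; discriminant≡-D to disc)
  0<a : 0ℤ ℤ.< a
  0<a = subst (0ℤ ℤ.<_) (id a b c) (pd (+ 1) (+ 0) (λ ()))
    where
    id : ∀ a b c → a * (+ 1 * + 1) + b * (+ 1 * + 0) + c * (+ 0 * + 0) ≡ a
    id = ℤRing.solve-∀
  swapDisc : ∀ b d a → - b * - b - + 4 * (d * a) ≡ b * b - + 4 * (a * d)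
  swapDisc = ℤRing.solve-∀
  Goal : Form → Set
  Goal Q = ∃[ R ] EquivalentUpToConjugation Q (AlmostReduced.toForm {D} R)

  posDisc : ∀ a b c → + a * c ≡ 0ℤ → b * b - + 4 * (+ a * c) ≢ - (+ D)
  posDisc a b c e eq = absurd (b * b) D (trans (sym (ℤ.+-identityʳ (b * b)))
    (trans (cong (λ z → b * b - + 4 * z) (sym e)) eq)) (∣i∣*∣i∣ b)
    where
    absurd : ∀ i D .{{_ : ℕ.NonZero D}} {n} → i ≡ - (+ D) → + n ≢ i
    absurd _ (suc D) refl ()

  -- Gauss reduction: a translation brings the middle coefficient into `[-a, a]`, and if the new
  -- last coefficient `d` is smaller than `a`, the two are swapped and the recursion continues with
  -- the leading coefficient `d`. A last coefficient `≤ 0` would make the discriminant nonnegative.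
  reduce : ∀ a → Acc ℕ._<_ a → .{{ℕ.NonZero a}} → ∀ b c → discriminant (form (+ a) b c) ≡ - (+ D) → Goal
    (form (+ a) b c)
  reduce a (acc rec) b c disc with k , ∣b′∣≤a ← centredResidue a b = step c′ refl
    where
    b′ c′ : ℤ
    b′ = b + + 2 * + a * k
    c′ = + a * (k * k) + b * k + c
    disc′ : b′ * b′ - + 4 * (+ a * c′) ≡ - (+ D)
    disc′ = trans (id (+ a) b c k) disc
      where
      id : ∀ a b c k → (b + + 2 * a * k) * (b + + 2 * a * k) - + 4 * (a * (a * (k * k) + b * k + c)) ≡ b * b - + 4 *
        (a * c)
      id = ℤRing.solve-∀
    translate : ∀ d → c′ ≡ d → ProperlyEquivalent (form (+ a) b c) (form (+ a) b′ d)
    translate d refl = 1ℤ , - k , 0ℤ , 1ℤ , det k , id (+ a) b c k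
      where
      det : ∀ k → 1ℤ * 1ℤ - - k * 0ℤ ≡ 1ℤ
      det = ℤRing.solve-∀
      id : ∀ a b c k x y → a * (x * x) + b * (x * y) + c * (y * y) ≡
        a * ((1ℤ * x + - k * y) * (1ℤ * x + - k * y)) + (b + + 2 * a * k) * ((1ℤ * x + - k * y) * (0ℤ * x + 1ℤ * y))
          + (a * (k * k) + b * k + c) * ((0ℤ * x + 1ℤ * y) * (0ℤ * x + 1ℤ * y))
      id = ℤRing.solve-∀
    swap : ∀ d → ProperlyEquivalent (form (+ a) b′ d) (form d (- b′) (+ a))
    swap d = 0ℤ , -1ℤ , 1ℤ , 0ℤ , refl , id (+ a) b′ d
      where
      id : ∀ a b c x y → a * (x * x) + b * (x * y) + c * (y * y) ≡
        c * ((0ℤ * x + -1ℤ * y) * (0ℤ * x + -1ℤ * y)) + - b * ((0ℤ * x + -1ℤ * y) * (1ℤ * x + 0ℤ * y))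
          + a * ((1ℤ * x + 0ℤ * y) * (1ℤ * x + 0ℤ * y))
      id = ℤRing.solve-∀
    step : ∀ d → c′ ≡ d → Goal (form (+ a) b c)
    step (+ zero) c′≡ = contradiction disc′ (posDisc a b′ c′ (trans (cong (+ a *_) c′≡) (ℤ.*-zeroʳ (+ a))))
    step -[1+ d ] c′≡ = contradiction (trans (sym (trans (cong (λ z → b′ * b′ - + 4 * (+ a * z)) c′≡) pos)) disc′)
      (positive D)
      where
      n : ℕ
      n = ∣ b′ ∣ ℕ.* ∣ b′ ∣ ℕ.+ 4 ℕ.* (a ℕ.* suc d)
      pos : b′ * b′ - + 4 * (+ a * -[1+ d ]) ≡ + n
      pos = trans (id (b′ * b′) (+ a) (+ suc d)) (sym (trans (ℤ.pos-+ (∣ b′ ∣ ℕ.* ∣ b′ ∣) _)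
        (cong₂ _+_ (∣i∣*∣i∣ b′) (trans (ℤ.pos-* 4 (a ℕ.* suc d)) (cong (+ 4 *_) (ℤ.pos-* a (suc d)))))))
        where
        id : ∀ s a d → s - + 4 * (a * - d) ≡ s + + 4 * (a * d)
        id = ℤRing.solve-∀
      positive : ∀ D .{{_ : ℕ.NonZero D}} → + n ≢ - (+ D)
      positive (suc D) ()
    step (+ d@(suc _)) c′≡ with a ℕ.≤? d
    ... | yes a≤d = R , equiv b′ refl
      where
      ℕdisc : D ℕ.+ ∣ b′ ∣ ℕ.* ∣ b′ ∣ ≡ 4 ℕ.* (a ℕ.* d)
      ℕdisc = ℤ.+-injective (trans (ℤ.pos-+ D _) (trans (cong (_+_ (+ D)) (∣i∣*∣i∣ b′)) (trans
        (rearrange (+ D) (b′ * b′) (+ 4 * (+ a * + d)) (trans (cong (λ z → b′ * b′ - + 4 * (+ a * z)) (sym c′≡)) disc′))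
        (sym (trans (ℤ.pos-* 4 (a ℕ.* d)) (cong (+ 4 *_) (ℤ.pos-* a d)))))))
        where
        id₁ : ∀ s t → - (s - t) + s ≡ t
        id₁ = ℤRing.solve-∀
        rearrange : ∀ D s t → s - t ≡ - D → D + s ≡ t
        rearrange D s t e = trans (cong (_+ s) (trans (sym (ℤ.neg-involutive D)) (cong -_ (sym e)))) (id₁ s t)
      R : AlmostReduced D
      R = almostReduced a ∣ b′ ∣ d ∣b′∣≤a a≤d ℕdisc
      equiv : ∀ β → b′ ≡ β → ProperlyEquivalent (form (+ a) b c) (form (+ a) (+ ∣ b′ ∣) (+ d)) ⊎ ProperlyEquivalent
        (form (+ a) b c) (form (+ a) (- (+ ∣ b′ ∣)) (+ d))
      equiv (+ n)    e = inj₁ (subst (λ z → ProperlyEquivalent (form (+ a) b c) (form (+ a) z (+ d)))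
        (trans e (cong (λ z → + ∣ z ∣) (sym e))) (translate (+ d) c′≡))
      equiv -[1+ n ] e = inj₂ (subst (λ z → ProperlyEquivalent (form (+ a) b c) (form (+ a) z (+ d)))
        (trans e (cong (λ z → - (+ ∣ z ∣)) (sym e))) (translate (+ d) c′≡))
    ... | no a≰d with R , e ← reduce d (rec (ℕ.≰⇒> a≰d)) (- b′) (+ a)
                    (trans (swapDisc b′ (+ d) (+ a)) (trans (cong (λ z → b′ * b′ - + 4 * (+ a * z)) (sym c′≡)) disc′)) =
                      R , compose e
      where
      to-swapped : ProperlyEquivalent (form (+ a) b c) (form (+ d) (- b′) (+ a))
      to-swapped = properlyEquivalent-trans {form (+ a) b c} {form (+ a) b′ (+ d)} {form (+ d) (- b′) (+ a)}
        (translate (+ d) c′≡) (swap (+ d))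
      compose : EquivalentUpToConjugation (form (+ d) (- b′) (+ a)) (AlmostReduced.toForm R) → EquivalentUpToConjugation
        (form (+ a) b c) (AlmostReduced.toForm R)
      compose (inj₁ e) = inj₁ (properlyEquivalent-trans {form (+ a) b c} {form (+ d) (- b′) (+ a)} {AlmostReduced.toForm
        R} to-swapped e)
      compose (inj₂ e) = inj₂ (properlyEquivalent-trans {form (+ a) b c} {form (+ d) (- b′) (+ a)}
        {conjugate (AlmostReduced.toForm R)} to-swapped e)

  go : ∀ a → 0ℤ ℤ.< a → PositiveDefinite (form a b c) → discriminant (form a b c) ≡ - (+ D) →
    ∃[ R ] (EquivalentUpToConjugation (form a b c) (AlmostReduced.toForm {D} R) × (∀ n → representations (form a b c) n
      ≡ representations (AlmostReduced.toForm R) n))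
  go (+ suc a) _ pd disc with R , e ← reduce (suc a) (<-wellFounded (suc a)) b c disc = R , e , reps e
    where
    reps : EquivalentUpToConjugation (form (+ suc a) b c) (AlmostReduced.toForm R) →
      ∀ n → representations (form (+ suc a) b c) n ≡ representations (AlmostReduced.toForm R) n
    reps (inj₁ e) = properlyEquivalent-representations (form (+ suc a) b c) (AlmostReduced.toForm R) pd
      (toForm-positiveDefinite R) e
    reps (inj₂ e) n = trans (properlyEquivalent-representations (form (+ suc a) b c)
      (conjugate (AlmostReduced.toForm R)) pd (conjugate-positiveDefinite R) e n)
      (sym (conjugate-representations (AlmostReduced.toForm R) (toForm-positiveDefinite R) (conjugate-positiveDefinite
      R) n))
  go (+ zero) (+<+ ())

-- Short vectors of reduced forms

Represents : Form → ℕ → Set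
Represents Q n = ∃[ x ] ∃[ y ] eval Q x y ≡ + n

represents⇒representations≢0 : ∀ Q → PositiveDefinite Q → ∀ n → Represents Q n → representations Q n ≢ 0
represents⇒representations≢0 Q pd n (x , y , e) = go (∈-filter⁺ (λ (x , y) → eval Q x y ℤ.≟ + n) (box-complete Q pd n x
  y e) e)
  where
  go : ∀ {v} {vs : List (ℤ × ℤ)} → v ∈ vs → length vs ≢ 0
  go (here _)  ()
  go (there _) ()

representations≢0⇒represents : ∀ Q n → representations Q n ≢ 0 → Represents Q n
representations≢0⇒represents Q n r≢0 = go (filter (λ (x , y) → eval Q x y ℤ.≟ + n) (box Q n)) refl
  where
  go : ∀ vs → filter (λ (x , y) → eval Q x y ℤ.≟ + n) (box Q n) ≡ vs → Represents Q n
  go []            e = contradiction (cong length e) r≢0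
  go ((x , y) ∷ _) e = x , y , proj₂ (∈-filter⁻ (λ (x , y) → eval Q x y ℤ.≟ + n) {xs = box Q n}
    (subst ((x , y) ∈_) (sym e) (here refl)))

-- Only `k ≥ 0` is counted, so for `n > 0` each `k` stands for the two vectors `(±k, 0)`.
axisCount : ℕ → ℕ → ℤ
axisCount a n = Σ< (suc n) (λ k → 𝟙 (a ℕ.* (k ℕ.* k) ℕ.≟ n))

axisCount-self : ∀ a .{{_ : ℕ.NonZero a}} → axisCount a a ≡ 1ℤ
axisCount-self a@(suc a′) = trans (Σ-single (suc a) 1 (s≤s (s≤s z≤n)) off) (𝟙-yes (a ℕ.* 1 ℕ.≟ a) (ℕ.*-identityʳ a))
  where
  off : ∀ k → k ℕ.< suc a → k ≢ 1 → 𝟙 (a ℕ.* (k ℕ.* k) ℕ.≟ a) ≡ 0ℤ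
  off k _ k≢1 = 𝟙-no (a ℕ.* (k ℕ.* k) ℕ.≟ a)
    (λ e → k≢1 (ℕ.m*n≡1⇒m≡1 k k (ℕ.*-cancelˡ-≡ (k ℕ.* k) 1 a (trans e (sym (ℕ.*-identityʳ a))))))

axisCount-none : ∀ a n → (∀ k → a ℕ.* (k ℕ.* k) ≢ n) → axisCount a n ≡ 0ℤ
axisCount-none a n ≢n = Σ-zero (suc n) (λ k _ → 𝟙-no (a ℕ.* (k ℕ.* k) ℕ.≟ n) (≢n k))

axis-gap : ∀ a n → a ℕ.< n → n ℕ.< 4 ℕ.* a → ∀ k → a ℕ.* (k ℕ.* k) ≢ n
axis-gap a n a<n _ 0 e = ℕ.<⇒≱ a<n (subst (ℕ._≤ a) (trans (sym (ℕ.*-zeroʳ a)) e) z≤n)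
axis-gap a n a<n _ 1 e = ℕ.<⇒≢ a<n (trans (sym (ℕ.*-identityʳ a)) e)
axis-gap a n _ n<4a (suc (suc k)) e = ℕ.<⇒≱ n<4a (subst (4 ℕ.* a ℕ.≤_) e
  (≤-slack (a ℕ.* (k ℕ.* 4 ℕ.+ k ℕ.* k)) (expand a k)))
  where
  expand : ∀ a k → a ℕ.* (suc (suc k) ℕ.* suc (suc k)) ≡ 4 ℕ.* a ℕ.+ a ℕ.* (k ℕ.* 4 ℕ.+ k ℕ.* k)
  expand = ℕRing.solve-∀

axis-below : ∀ a n → 0 ℕ.< n → n ℕ.< a → ∀ k → a ℕ.* (k ℕ.* k) ≢ n
axis-below a n 0<n _   0       e = ℕ.<⇒≢ 0<n (trans (sym (ℕ.*-zeroʳ a)) e)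
axis-below a n _   n<a (suc k) e = ℕ.<⇒≱ n<a (subst (a ℕ.≤_) e (ℕ.m≤m*n a (suc k ℕ.* suc k)))

module _ {a b c : ℕ} (b≤a : b ℕ.≤ a) (a≤c : a ℕ.≤ c) where

  private
    Q : Form
    Q = form (+ a) (+ b) (+ c)

  -- The bound `Q(x, y) ≥ aX² - bXY + cY²` with `X = ∣x∣`, `Y = ∣y∣`, moved to natural numbers by
  -- adding `bXY` on both sides.
  eval-abs : ∀ x y n → eval Q x y ≡ + n → a ℕ.* (∣ x ∣ ℕ.* ∣ x ∣) ℕ.+ c ℕ.* (∣ y ∣ ℕ.* ∣ y ∣) ℕ.≤ n ℕ.+ b ℕ.*
    (∣ x ∣ ℕ.* ∣ y ∣)
  eval-abs x y n e = ℤ.drop‿+≤+ (subst₂ ℤ._≤_ (sym lhs) (sym rhs) (ineq (ℤ.+∣i∣≡i⊎+∣i∣≡-i (x * y))))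
    where
    ax² cy² : ℤ
    ax² = + a * (x * x)
    cy² = + c * (y * y)
    P : ℕ
    P = ∣ x ∣ ℕ.* ∣ y ∣
    lhs : + (a ℕ.* (∣ x ∣ ℕ.* ∣ x ∣) ℕ.+ c ℕ.* (∣ y ∣ ℕ.* ∣ y ∣)) ≡ ax² + cy²
    lhs = trans (ℤ.pos-+ (a ℕ.* (∣ x ∣ ℕ.* ∣ x ∣)) _) (cong₂ _+_ (trans (ℤ.pos-* a _) (cong (+ a *_) (∣i∣*∣i∣ x)))
      (trans (ℤ.pos-* c _) (cong (+ c *_) (∣i∣*∣i∣ y))))
    rhs : + (n ℕ.+ b ℕ.* P) ≡ ax² + + b * (x * y) + cy² + + (b ℕ.* P)
    rhs = trans (ℤ.pos-+ n (b ℕ.* P)) (cong (_+ + (b ℕ.* P)) (sym e))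
    id₁ : ∀ p q s t → p + q + s + t ≡ p + s + (q + t)
    id₁ = ℤRing.solve-∀
    ineq : + ∣ x * y ∣ ≡ x * y ⊎ + ∣ x * y ∣ ≡ - (x * y) → ax² + cy² ℤ.≤ ax² + + b * (x * y) + cy² + + (b ℕ.* P)
    ineq s = subst (ax² + cy² ℤ.≤_) (sym (id₁ ax² (+ b * (x * y)) cy² (+ (b ℕ.* P)))) (0≤⇒≤ (nonNeg s))
      where
      0≤⇒≤ : ∀ {u v} → 0ℤ ℤ.≤ v → u ℤ.≤ u + v
      0≤⇒≤ {u} 0≤v = subst (ℤ._≤ u + _) (ℤ.+-identityʳ u) (ℤ.+-monoʳ-≤ u 0≤v)
      nonNeg : + ∣ x * y ∣ ≡ x * y ⊎ + ∣ x * y ∣ ≡ - (x * y) → 0ℤ ℤ.≤ + b * (x * y) + + (b ℕ.* P)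
      nonNeg (inj₁ s) = subst (λ z → 0ℤ ℤ.≤ + b * z + + (b ℕ.* P)) s (subst (λ z → 0ℤ ℤ.≤ z + + (b ℕ.* P))
        (ℤ.pos-* b ∣ x * y ∣) (subst (0ℤ ℤ.≤_) (ℤ.pos-+ (b ℕ.* ∣ x * y ∣) (b ℕ.* P)) (+≤+ z≤n)))
      nonNeg (inj₂ s) = ℤ.≤-reflexive
        (sym (trans (cong (_+_ (+ b * (x * y))) (trans (ℤ.pos-* b P) (trans (cong (λ z → + b * + z) (sym (ℤ.abs-* x y)))
        (cong (+ b *_) s)))) (id₂ (+ b) (x * y))))
        where
        id₂ : ∀ b z → b * z + b * - z ≡ 0ℤ
        id₂ = ℤRing.solve-∀

  -- c (X² - XY + Y²) bounds the form from below, as X² ≤ XY in the first case.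
  tall : ∀ X Y → 2 ℕ.≤ Y → 3 ℕ.* c ℕ.+ b ℕ.* (X ℕ.* Y) ℕ.≤ a ℕ.* (X ℕ.* X) ℕ.+ c ℕ.* (Y ℕ.* Y)
  tall X Y 2≤Y with ℕ.≤-total X Y
  ... | inj₁ X≤Y = go X (slack X≤Y) 2≤Y
    where
    go : ∀ X {Y} → ∃[ t ] Y ≡ X ℕ.+ t → 2 ℕ.≤ Y → 3 ℕ.* c ℕ.+ b ℕ.* (X ℕ.* Y) ℕ.≤ a ℕ.* (X ℕ.* X) ℕ.+ c ℕ.* (Y ℕ.* Y)
    go X (t , refl) 2≤X+t with k , refl ← slack b≤a with l , refl ← slack a≤c = ≤-slack′ (three X t 2≤X+t)
      where
      Z : ℕ
      Z = X ℕ.* X ℕ.+ X ℕ.* t ℕ.+ t ℕ.* t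
      three : ∀ X t → 2 ℕ.≤ X ℕ.+ t → 3 ℕ.≤ X ℕ.* X ℕ.+ X ℕ.* t ℕ.+ t ℕ.* t
      three zero          (suc zero)    (s≤s ())
      three zero          (suc (suc t)) _ = ≤-slack (1 ℕ.+ (t ℕ.* 4 ℕ.+ t ℕ.* t)) (id t)
        where
        id : ∀ t → 0 ℕ.+ suc (suc t) ℕ.* suc (suc t) ≡ 3 ℕ.+ (1 ℕ.+ (t ℕ.* 4 ℕ.+ t ℕ.* t))
        id = ℕRing.solve-∀
      three (suc X)       (suc t)       _ = ≤-slack (3 ℕ.* X ℕ.+ 3 ℕ.* t ℕ.+ (X ℕ.* X ℕ.+ X ℕ.* t ℕ.+ t ℕ.* t)) (id X t)
        where
        id : ∀ X t → suc X ℕ.* suc X ℕ.+ suc X ℕ.* suc t ℕ.+ suc t ℕ.* suc t ≡ 3 ℕ.+ (3 ℕ.* X ℕ.+ 3 ℕ.* t ℕ.+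
          (X ℕ.* X ℕ.+ X ℕ.* t ℕ.+ t ℕ.* t))
        id = ℕRing.solve-∀
      three (suc zero)    zero          (s≤s ())
      three (suc (suc X)) zero          _ = ≤-slack (1 ℕ.+ (X ℕ.* 4 ℕ.+ X ℕ.* X)) (id X)
        where
        id : ∀ X → suc (suc X) ℕ.* suc (suc X) ℕ.+ suc (suc X) ℕ.* 0 ℕ.+ 0 ≡ 3 ℕ.+ (1 ℕ.+ (X ℕ.* 4 ℕ.+ X ℕ.* X))
        id = ℕRing.solve-∀
      ≤-slack′ : 3 ℕ.≤ Z → 3 ℕ.* (b ℕ.+ k ℕ.+ l) ℕ.+ b ℕ.* (X ℕ.* (X ℕ.+ t)) ℕ.≤ (b ℕ.+ k) ℕ.* (X ℕ.* X) ℕ.+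
        (b ℕ.+ k ℕ.+ l) ℕ.* ((X ℕ.+ t) ℕ.* (X ℕ.+ t))
      ≤-slack′ 3≤Z = ℕ.≤-trans (ℕ.+-monoˡ-≤ (b ℕ.* (X ℕ.* (X ℕ.+ t))) (ℕ.≤-trans (ℕ.*-monoˡ-≤ (b ℕ.+ k ℕ.+ l) 3≤Z)
        (ℕ.≤-reflexive (ℕ.*-comm Z (b ℕ.+ k ℕ.+ l)))))
        (≤-slack (k ℕ.* (X ℕ.* (X ℕ.+ t)) ℕ.+ l ℕ.* (X ℕ.* t)) (id b k l X t))
        where
        id : ∀ b k l X t → (b ℕ.+ k) ℕ.* (X ℕ.* X) ℕ.+ (b ℕ.+ k ℕ.+ l) ℕ.* ((X ℕ.+ t) ℕ.* (X ℕ.+ t)) ≡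
          (b ℕ.+ k ℕ.+ l) ℕ.* (X ℕ.* X ℕ.+ X ℕ.* t ℕ.+ t ℕ.* t) ℕ.+ b ℕ.* (X ℕ.* (X ℕ.+ t)) ℕ.+ (k ℕ.* (X ℕ.* (X ℕ.+ t))
            ℕ.+ l ℕ.* (X ℕ.* t))
        id = ℕRing.solve-∀
  -- For `X ≥ Y` the part `aX² - bXY` is nonnegative, and `cY² ≥ 4c` is more than enough.
  ... | inj₂ Y≤X with t , refl ← slack Y≤X with k , refl ← slack b≤a with s , refl ← slack 2≤Y =
    ≤-slack (c ℕ.+ (c ℕ.* (4 ℕ.* s ℕ.+ s ℕ.* s) ℕ.+ (k ℕ.* ((2 ℕ.+ s ℕ.+ t) ℕ.* (2 ℕ.+ s ℕ.+ t)) ℕ.+ b ℕ.*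
      ((2 ℕ.+ s ℕ.+ t) ℕ.* t)))) (expand b k c s t)
    where
    expand : ∀ b k c s t → (b ℕ.+ k) ℕ.* ((2 ℕ.+ s ℕ.+ t) ℕ.* (2 ℕ.+ s ℕ.+ t)) ℕ.+ c ℕ.* ((2 ℕ.+ s) ℕ.* (2 ℕ.+ s)) ≡
      3 ℕ.* c ℕ.+ b ℕ.* ((2 ℕ.+ s ℕ.+ t) ℕ.* (2 ℕ.+ s)) ℕ.+
        (c ℕ.+ (c ℕ.* (4 ℕ.* s ℕ.+ s ℕ.* s) ℕ.+ (k ℕ.* ((2 ℕ.+ s ℕ.+ t) ℕ.* (2 ℕ.+ s ℕ.+ t)) ℕ.+ b ℕ.*
        ((2 ℕ.+ s ℕ.+ t) ℕ.* t))))
    expand = ℕRing.solve-∀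

  -- For `X ≥ 2` one has `aX² - bX ≥ 4a - 2b ≥ a + b`.
  wide : ∀ X → 2 ℕ.≤ X → a ℕ.+ b ℕ.+ c ℕ.+ b ℕ.* (X ℕ.* 1) ℕ.≤ a ℕ.* (X ℕ.* X) ℕ.+ c ℕ.* 1
  wide X 2≤X with k , refl ← slack b≤a with s , refl ← slack 2≤X =
    ≤-slack (3 ℕ.* k ℕ.+ (3 ℕ.* b ℕ.+ 4 ℕ.* k) ℕ.* s ℕ.+ (b ℕ.+ k) ℕ.* (s ℕ.* s)) (expand b k c s)
    where
    expand : ∀ b k c s → (b ℕ.+ k) ℕ.* ((2 ℕ.+ s) ℕ.* (2 ℕ.+ s)) ℕ.+ c ℕ.* 1 ≡
      b ℕ.+ k ℕ.+ b ℕ.+ c ℕ.+ b ℕ.* ((2 ℕ.+ s) ℕ.* 1) ℕ.+ (3 ℕ.* k ℕ.+ (3 ℕ.* b ℕ.+ 4 ℕ.* k) ℕ.* s ℕ.+ (b ℕ.+ k) ℕ.*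
        (s ℕ.* s))
    expand = ℕRing.solve-∀

  -- `long` says nothing about the vector, only that `n` has left the range in which the other
  -- constructors suffice; the vectors `±(e₁ + e₂)`, of value `a + b + c`, fall under it. The value
  -- `a - b + c` is written without subtraction.
  data Vector (n : ℕ) : ℤ → ℤ → Set where
    axis  : ∀ {x} → a ℕ.* (∣ x ∣ ℕ.* ∣ x ∣) ≡ n → Vector n x 0ℤ
    e₂    : c ≡ n → Vector n 0ℤ 1ℤ
    -e₂   : c ≡ n → Vector n 0ℤ -1ℤ
    e₁-e₂ : c ℕ.+ a ≡ n ℕ.+ b → Vector n 1ℤ -1ℤ
    e₂-e₁ : c ℕ.+ a ≡ n ℕ.+ b → Vector n -1ℤ 1ℤ
    long  : ∀ {x y} → a ℕ.+ b ℕ.+ c ℕ.≤ n ⊎ 3 ℕ.* c ℕ.≤ n → Vector n x y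

  classify : ∀ x y n → eval Q x y ≡ + n → Vector n x y
  classify x y n e = go x y (eval-abs x y n e) e
    where
    cancel : ∀ {u v w : ℕ} → u ℕ.+ w ℕ.≤ v → v ℕ.≤ n ℕ.+ w → u ℕ.≤ n
    cancel {u} {v} {w} p q = ℕ.+-cancelʳ-≤ w u n (ℕ.≤-trans p q)
    ℕsum : ∀ p q s → + p + + q + + s ≡ + n → p ℕ.+ q ℕ.+ s ≡ n
    ℕsum p q s e = ℤ.+-injective (trans (trans (ℤ.pos-+ (p ℕ.+ q) s) (cong (_+ + s) (ℤ.pos-+ p q))) e)
    val₀ : ∀ p → (x : ℤ) → + p ≡ x → x ≡ + n → p ≡ n
    val₀ p x p≡ ≡n = ℤ.+-injective (trans p≡ ≡n)
    diff : ∀ {p q s} → + p + - (+ q) + + s ≡ + n → s ℕ.+ p ≡ n ℕ.+ q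
    diff {p} {q} {s} e = ℤ.+-injective (trans (ℤ.pos-+ s p) (trans (id (+ p) (+ q) (+ s)) (trans (cong (_+ + q) e)
      (sym (ℤ.pos-+ n q)))))
      where
      id : ∀ p q s → s + p ≡ p + - q + s + q
      id = ℤRing.solve-∀
    1·1 : ∀ a b c → a * (1ℤ * 1ℤ) + b * (1ℤ * 1ℤ) + c * (1ℤ * 1ℤ) ≡ a + b + c
    1·1 = ℤRing.solve-∀
    -1·-1 : ∀ a b c → a * (-1ℤ * -1ℤ) + b * (-1ℤ * -1ℤ) + c * (-1ℤ * -1ℤ) ≡ a + b + c
    -1·-1 = ℤRing.solve-∀
    1·-1 : ∀ a b c → a * (1ℤ * 1ℤ) + b * (1ℤ * -1ℤ) + c * (-1ℤ * -1ℤ) ≡ a + - b + c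
    1·-1 = ℤRing.solve-∀
    -1·1 : ∀ a b c → a * (-1ℤ * -1ℤ) + b * (-1ℤ * 1ℤ) + c * (1ℤ * 1ℤ) ≡ a + - b + c
    -1·1 = ℤRing.solve-∀
    ·0 : ∀ a b c x → a * (x * x) + b * (x * 0ℤ) + c * (0ℤ * 0ℤ) ≡ a * (x * x)
    ·0 = ℤRing.solve-∀
    0·1 : ∀ a b c → a * (0ℤ * 0ℤ) + b * (0ℤ * 1ℤ) + c * (1ℤ * 1ℤ) ≡ c
    0·1 = ℤRing.solve-∀
    0·-1 : ∀ a b c → a * (0ℤ * 0ℤ) + b * (0ℤ * -1ℤ) + c * (-1ℤ * -1ℤ) ≡ c
    0·-1 = ℤRing.solve-∀
    go : ∀ x y → a ℕ.* (∣ x ∣ ℕ.* ∣ x ∣) ℕ.+ c ℕ.* (∣ y ∣ ℕ.* ∣ y ∣) ℕ.≤ n ℕ.+ b ℕ.* (∣ x ∣ ℕ.* ∣ y ∣) → eval Q x y ≡ +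
      n → Vector n x y
    go x (+ zero) _ e = axis (val₀ _ _ (trans (ℤ.pos-* a _) (trans (cong (+ a *_) (∣i∣*∣i∣ x))
      (sym (·0 (+ a) (+ b) (+ c) x)))) e)
    go (+ 0) (+ 1) _ e = e₂ (val₀ c _ (sym (0·1 (+ a) (+ b) (+ c))) e)
    go (+ 0) -[1+ 0 ] _ e = -e₂ (val₀ c _ (sym (0·-1 (+ a) (+ b) (+ c))) e)
    go (+ 1) (+ 1) _ e = long (inj₁ (ℕ.≤-reflexive (ℕsum a b c (trans (sym (1·1 (+ a) (+ b) (+ c))) e))))
    go -[1+ 0 ] -[1+ 0 ] _ e = long (inj₁ (ℕ.≤-reflexive (ℕsum a b c (trans (sym (-1·-1 (+ a) (+ b) (+ c))) e))))
    go (+ 1) -[1+ 0 ] _ e = e₁-e₂ (diff (trans (sym (1·-1 (+ a) (+ b) (+ c))) e))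
    go -[1+ 0 ] (+ 1) _ e = e₂-e₁ (diff (trans (sym (-1·1 (+ a) (+ b) (+ c))) e))
    go (+ suc (suc x)) (+ 1) i _ = long (inj₁ (cancel (wide (suc (suc x)) (s≤s (s≤s z≤n))) i))
    go (+ suc (suc x)) -[1+ 0 ] i _ = long (inj₁ (cancel (wide (suc (suc x)) (s≤s (s≤s z≤n))) i))
    go -[1+ suc x ] (+ 1) i _ = long (inj₁ (cancel (wide (suc (suc x)) (s≤s (s≤s z≤n))) i))
    go -[1+ suc x ] -[1+ 0 ] i _ = long (inj₁ (cancel (wide (suc (suc x)) (s≤s (s≤s z≤n))) i))
    go x (+ suc (suc y)) i _ = long (inj₂ (cancel (tall ∣ x ∣ (suc (suc y)) (s≤s (s≤s z≤n))) i))
    go x -[1+ suc y ] i _ = long (inj₂ (cancel (tall ∣ x ∣ (suc (suc y)) (s≤s (s≤s z≤n))) i))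

  module _ (d : ℕ) (b+d≡a : b ℕ.+ d ≡ a) where

    private
      corner : ∀ {n} → c ℕ.+ a ≡ n ℕ.+ b → n ≡ c ℕ.+ d
      corner {n} e = ℕ.+-cancelʳ-≡ b n (c ℕ.+ d)
        (trans (sym e) (trans (cong (ℕ._+_ c) (trans (sym b+d≡a) (ℕ.+-comm b d))) (sym (ℕ.+-assoc c d b))))

      d≤a : d ℕ.≤ a
      d≤a = ℕ.m+n≤o⇒n≤o b (ℕ.≤-reflexive b+d≡a)

    -- The corner value `a - b + c` is `c + d`. Both thresholds of `long` are at least `c + d`,
    -- because `d ≤ a ≤ c`.
    represented : ∀ n → Represents Q n → (∃[ X ] a ℕ.* (X ℕ.* X) ≡ n) ⊎ c ≡ n ⊎ c ℕ.+ d ℕ.≤ n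
    represented n (x , y , e) with classify x y n e
    ... | axis e′          = inj₁ (∣ x ∣ , e′)
    ... | e₂ e′            = inj₂ (inj₁ e′)
    ... | -e₂ e′           = inj₂ (inj₁ e′)
    ... | e₁-e₂ e′         = inj₂ (inj₂ (ℕ.≤-reflexive (sym (corner e′))))
    ... | e₂-e₁ e′         = inj₂ (inj₂ (ℕ.≤-reflexive (sym (corner e′))))
    ... | long (inj₁ a+b+c≤n) = inj₂ (inj₂ (ℕ.≤-trans (ℕ.≤-trans (ℕ.+-monoʳ-≤ c d≤a) (≤-slack b (rearrange a b c)))
      a+b+c≤n))
      where
      rearrange : ∀ a b c → a ℕ.+ b ℕ.+ c ≡ c ℕ.+ a ℕ.+ b
      rearrange = ℕRing.solve-∀
    ... | long (inj₂ 3c≤n) = inj₂ (inj₂ (ℕ.≤-trans (ℕ.≤-trans (ℕ.+-monoʳ-≤ c (ℕ.≤-trans d≤a a≤c))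
      (≤-slack c (rearrange c))) 3c≤n))
      where
      rearrange : ∀ c → 3 ℕ.* c ≡ c ℕ.+ c ℕ.+ c
      rearrange = ℕRing.solve-∀

    represents-corner : Represents Q (c ℕ.+ d)
    represents-corner = 1ℤ , -1ℤ , trans (id₁ (+ a) (+ b) (+ c)) (trans (cong (λ z → + z - + b + + c) (sym b+d≡a))
      (trans (cong (λ z → z - + b + + c) (ℤ.pos-+ b d)) (trans (id₂ (+ b) (+ c) (+ d)) (sym (ℤ.pos-+ c d)))))
      where
      id₁ : ∀ a b c → a * (1ℤ * 1ℤ) + b * (1ℤ * -1ℤ) + c * (-1ℤ * -1ℤ) ≡ a - b + c
      id₁ = ℤRing.solve-∀
      id₂ : ∀ b c d → b + d - b + c ≡ c + d
      id₂ = ℤRing.solve-∀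

    -- In this range all representations lie in one duplicate-free list, the axis and `±e₂`,
    -- `±(e₁ - e₂)`. The vectors are distinct even when their values coincide, so the three
    -- contributions simply add.
    shortRepresentations : .{{_ : ℕ.NonZero a}} → PositiveDefinite Q → ∀ n → 0 ℕ.< n → n ℕ.< a ℕ.+ b ℕ.+ c → n ℕ.< 3 ℕ.*
      c →
      + representations Q n ≡ + 2 * (axisCount a n + 𝟙 (n ℕ.≟ c) + 𝟙 (n ℕ.≟ c ℕ.+ d))
    shortRepresentations pd n 0<n n<abc n<3c = begin
      + representations Q n   ≡⟨ cong +_ (representations-count Q pd n R? unique (λ v → v) (λ e → e) to
        (λ {(x , y)} r → x , y , r , refl)) ⟩
      + count R? (xs ++ ys)   ≡⟨ count-Σᴸ R? (xs ++ ys) ⟩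
      Σᴸ (xs ++ ys) r         ≡⟨ Σᴸ-++ xs ys r ⟩
      Σᴸ xs r + Σᴸ ys r       ≡⟨ cong₂ _+_ axes others ⟩
      + 2 * axisCount a n + (𝟙 (n ℕ.≟ c) + (𝟙 (n ℕ.≟ c) + (𝟙 (n ℕ.≟ c ℕ.+ d) + (𝟙 (n ℕ.≟ c ℕ.+ d) + 0ℤ)))) ≡⟨ collect
        (axisCount a n) (𝟙 (n ℕ.≟ c)) (𝟙 (n ℕ.≟ c ℕ.+ d)) ⟩
      + 2 * (axisCount a n + 𝟙 (n ℕ.≟ c) + 𝟙 (n ℕ.≟ c ℕ.+ d)) ∎
      where
      open ≡-Reasoning
      R? : (v : ℤ × ℤ) → Dec (eval Q (proj₁ v) (proj₂ v) ≡ + n)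
      R? (x , y) = eval Q x y ℤ.≟ + n
      r : ℤ × ℤ → ℤ
      r v = 𝟙 (R? v)
      xs ys : List (ℤ × ℤ)
      xs = map (_, 0ℤ) (symmetricInterval n)
      ys = (0ℤ , 1ℤ) ∷ (0ℤ , -1ℤ) ∷ (1ℤ , -1ℤ) ∷ (-1ℤ , 1ℤ) ∷ []
      disjoint : ∀ {v} → v ∈ xs × v ∈ ys → _
      disjoint (p , q) with _ , _ , refl ← ∈-map⁻ (_, 0ℤ) p with q
      ... | here ()
      ... | there (here ())
      ... | there (there (here ()))
      ... | there (there (there (here ())))
      unique : Unique (xs ++ ys)
      unique = Unique.++⁺ (Unique.map⁺ (cong proj₁) (symmetricInterval-unique n))
        (((λ ()) ∷ (λ ()) ∷ (λ ()) ∷ []) ∷ ((λ ()) ∷ (λ ()) ∷ []) ∷ ((λ ()) ∷ []) ∷ [] ∷ []) disjoint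
      onAxis : ∀ x → a ℕ.* (∣ x ∣ ℕ.* ∣ x ∣) ≡ n → (x , 0ℤ) ∈ xs ++ ys
      onAxis x e = ∈-++⁺ˡ (∈-map⁺ (_, 0ℤ) (∈-symmetricInterval n x (ℕ.≤-trans (m≤m*m ∣ x ∣) (ℕ.≤-trans (ℕ.m≤n*m _ a)
        (ℕ.≤-reflexive e)))))
      member : ∀ x y → Vector n x y → (x , y) ∈ xs ++ ys
      member x _ (axis e)  = onAxis x e
      member _ _ (e₂ _)    = ∈-++⁺ʳ xs (here refl)
      member _ _ (-e₂ _)   = ∈-++⁺ʳ xs (there (here refl))
      member _ _ (e₁-e₂ _) = ∈-++⁺ʳ xs (there (there (here refl)))
      member _ _ (e₂-e₁ _) = ∈-++⁺ʳ xs (there (there (there (here refl))))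
      member _ _ (long (inj₁ abc≤n)) = contradiction abc≤n (ℕ.<⇒≱ n<abc)
      member _ _ (long (inj₂ 3c≤n))  = contradiction 3c≤n (ℕ.<⇒≱ n<3c)
      to : ∀ x y → eval Q x y ≡ + n → (x , y) ∈ xs ++ ys × eval Q x y ≡ + n
      to x y e = member x y (classify x y n e) , e
      axisValue : ∀ x → eval Q x 0ℤ ≡ + (a ℕ.* (∣ x ∣ ℕ.* ∣ x ∣))
      axisValue x = trans (·0 (+ a) (+ b) (+ c) x) (sym (trans (ℤ.pos-* a _) (cong (+ a *_) (∣i∣*∣i∣ x))))
        where
        ·0 : ∀ a b c x → a * (x * x) + b * (x * 0ℤ) + c * (0ℤ * 0ℤ) ≡ a * (x * x)
        ·0 = ℤRing.solve-∀
      value : ∀ {x y m} → eval Q x y ≡ + m → r (x , y) ≡ 𝟙 (n ℕ.≟ m)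
      value {x} {y} {m} e = 𝟙-cong (R? (x , y)) (n ℕ.≟ m) (λ e′ → ℤ.+-injective (trans (sym e′) e))
        (λ n≡m → trans e (cong +_ (sym n≡m)))
      axes : Σᴸ xs r ≡ + 2 * axisCount a n
      axes = trans (Σᴸ-map (_, 0ℤ) (symmetricInterval n) r) (trans (Σᴸ-cong (symmetricInterval n) pointwise)
        -- The condition `0 < n` excludes the zero vector, the only one on the axis that is its own
        -- negative.
        (Σᴸ-symmetricInterval n g (𝟙-no (a ℕ.* 0 ℕ.≟ n) (λ e → ℕ.<⇒≢ 0<n (trans (sym (ℕ.*-zeroʳ a)) e))) (λ _ → refl)))
        where
        g : ℤ → ℤ
        g x = 𝟙 (a ℕ.* (∣ x ∣ ℕ.* ∣ x ∣) ℕ.≟ n)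
        pointwise : ∀ x → r (x , 0ℤ) ≡ g x
        pointwise x = 𝟙-cong (R? (x , 0ℤ)) (a ℕ.* (∣ x ∣ ℕ.* ∣ x ∣) ℕ.≟ n)
          (λ e → ℤ.+-injective (trans (sym (axisValue x)) e)) (λ e → trans (axisValue x) (cong +_ e))
      0·1 : ∀ a b c → a * (0ℤ * 0ℤ) + b * (0ℤ * 1ℤ) + c * (1ℤ * 1ℤ) ≡ c
      0·1 = ℤRing.solve-∀
      0·-1 : ∀ a b c → a * (0ℤ * 0ℤ) + b * (0ℤ * -1ℤ) + c * (-1ℤ * -1ℤ) ≡ c
      0·-1 = ℤRing.solve-∀
      flip : ∀ a b c → a * (-1ℤ * -1ℤ) + b * (-1ℤ * 1ℤ) + c * (1ℤ * 1ℤ) ≡ a * (1ℤ * 1ℤ) + b * (1ℤ * -1ℤ) + c *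
        (-1ℤ * -1ℤ)
      flip = ℤRing.solve-∀
      others : Σᴸ ys r ≡ 𝟙 (n ℕ.≟ c) + (𝟙 (n ℕ.≟ c) + (𝟙 (n ℕ.≟ c ℕ.+ d) + (𝟙 (n ℕ.≟ c ℕ.+ d) + 0ℤ)))
      others = cong₂ _+_ (value {0ℤ} {1ℤ} {c} (0·1 (+ a) (+ b) (+ c)))
        (cong₂ _+_ (value {0ℤ} { -1ℤ} {c} (0·-1 (+ a) (+ b) (+ c)))
        (cong₂ _+_ (value {1ℤ} { -1ℤ} {c ℕ.+ d} (proj₂ (proj₂ represents-corner)))
          (cong (_+ 0ℤ) (value { -1ℤ} {1ℤ} {c ℕ.+ d} (trans (flip (+ a) (+ b) (+ c))
            (proj₂ (proj₂ represents-corner)))))))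
      collect : ∀ s p q → + 2 * s + (p + (p + (q + (q + 0ℤ)))) ≡ + 2 * (s + p + q)
      collect = ℤRing.solve-∀

  represents-c : Represents Q c
  represents-c = 0ℤ , 1ℤ , id (+ a) (+ b) (+ c)
    where
    id : ∀ a b c → a * (0ℤ * 0ℤ) + b * (0ℤ * 1ℤ) + c * (1ℤ * 1ℤ) ≡ c
    id = ℤRing.solve-∀

  represents-axis : ∀ k → Represents Q (a ℕ.* (k ℕ.* k))
  represents-axis k = + k , 0ℤ , trans (id (+ a) (+ b) (+ c) (+ k))
    (sym (trans (ℤ.pos-* a _) (cong (+ a *_) (ℤ.pos-* k k))))
    where
    id : ∀ a b c k → a * (k * k) + b * (k * 0ℤ) + c * (0ℤ * 0ℤ) ≡ a * (k * k)
    id = ℤRing.solve-∀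

  represents-a : Represents Q a
  represents-a = subst (Represents Q) (ℕ.*-identityʳ a) (represents-axis 1)

  represented≥a : ∀ n → 0 ℕ.< n → Represents Q n → a ℕ.≤ n
  represented≥a n 0<n rep with represented (a ℕ.∸ b) (ℕ.m+[n∸m]≡n b≤a) n rep
  ... | inj₁ (zero , e)  = contradiction (trans (sym (ℕ.*-zeroʳ a)) e) (ℕ.<⇒≢ 0<n)
  ... | inj₁ (suc X , e) = subst (a ℕ.≤_) e (ℕ.m≤m*n a (suc X ℕ.* suc X))
  ... | inj₂ (inj₁ refl) = a≤c
  ... | inj₂ (inj₂ c+d≤n) = ℕ.≤-trans a≤c (ℕ.m+n≤o⇒m≤o c c+d≤n)

representations-zero : ∀ Q → PositiveDefinite Q → representations Q 0 ≡ 1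
representations-zero Q pd = representations-count Q pd 0 {R = _≡ (0ℤ , 0ℤ)} (λ v → ≡-dec v) {xs = (0ℤ , 0ℤ) ∷ []}
  ([] ∷ []) (λ v → v) (λ e → e) to (λ { refl → 0ℤ , 0ℤ , eval-0 Q , refl })
  where
  ≡-dec : ∀ v → Dec (v ≡ (0ℤ , 0ℤ))
  ≡-dec (x , y) with x ℤ.≟ 0ℤ | y ℤ.≟ 0ℤ
  ... | yes refl | yes refl = yes refl
  ... | no x≢0   | _        = no (λ e → x≢0 (cong proj₁ e))
  ... | yes _    | no y≢0   = no (λ e → y≢0 (cong proj₂ e))
  eval-0 : ∀ Q → eval Q 0ℤ 0ℤ ≡ 0ℤ
  eval-0 (form a b c) = id a b c
    where
    id : ∀ a b c → a * (0ℤ * 0ℤ) + b * (0ℤ * 0ℤ) + c * (0ℤ * 0ℤ) ≡ 0ℤ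
    id = ℤRing.solve-∀
  to : ∀ x y → eval Q x y ≡ 0ℤ → ((x , y) ∈ (0ℤ , 0ℤ) ∷ []) × (x , y) ≡ (0ℤ , 0ℤ)
  to x y e with ≡-dec (x , y)
  ... | yes refl = here refl , refl
  ... | no ≢0 = contradiction (subst (0ℤ ℤ.<_) e (pd x y (λ { (refl , refl) → ≢0 refl }))) (ℤ.<-irrefl refl)

-- Eta quotients of prime level

coeff-≥ : ∀ E k {j} → k - order E ≡ + j → coeff E k ≡ dilate 24 (series E) j
coeff-≥ E k e with k - order E | e
... | + j | refl = refl

coeff-< : ∀ E k {j} → k - order E ≡ -[1+ j ] → coeff E k ≡ 0ℤ
coeff-< E k e with k - order E | e
... | -[1+ j ] | refl = refl

coeff-order : ∀ E {m} j → order E ≡ + (m ℕ.* 24) → coeff E (+ ((m ℕ.+ j) ℕ.* 24)) ≡ series E j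
coeff-order E {m} j e = trans (coeff-≥ E (+ ((m ℕ.+ j) ℕ.* 24)) (trans (cong₂ (λ n o → + n - o) (ℕ.*-distribʳ-+ 24 m j)
  e)
  (trans (-‿≥ {m ℕ.* 24 ℕ.+ j ℕ.* 24} (ℕ.m≤m+n (m ℕ.* 24) _)) (cong +_ (ℕ.m+n∸m≡n (m ℕ.* 24) (j ℕ.* 24))))))
    (dilate-multiple 24 (series E) j)

coeff-Θ : ∀ Q n → coeff (Θ Q) (+ (n ℕ.* 24)) ≡ + representations Q n
coeff-Θ Q n = coeff-order (Θ Q) {0} n refl

dilate-cong : ∀ δ {f g : Series} → (∀ n → f n ≡ g n) → ∀ n → dilate δ f n ≡ dilate δ g n
dilate-cong δ f≗g n with δ ∣? n
... | yes (divides k _) = f≗g k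
... | no  _             = refl

≈-intro : ∀ E shanksSum → order E ≡ order shanksSum → (∀ n → series E n ≡ series shanksSum n) → E ≈ shanksSum
≈-intro (q^ o /24· f) (q^ .o /24· g) refl f≗g k with k - o
... | + j      = dilate-cong 24 f≗g j
... | -[1+ _ ] = refl

halfDifference⇒ : ∀ {E shanksSum G} → IsHalfDifference E shanksSum G → ∀ k → coeff shanksSum k - coeff G k ≡ + 2 * coeff
  E k
halfDifference⇒ {E} {shanksSum} {G} half k with *≡* e ← ℚ./-injective-≃ (mkℚᵘ (coeff E k) 0)
  (mkℚᵘ (coeff shanksSum k - coeff G k) 1) (half k) =
  trans (sym (ℤ.*-identityʳ _)) (trans (sym e) (ℤ.*-comm (coeff E k) (+ 2)))

⇒halfDifference : ∀ {E shanksSum G} → (∀ k → coeff shanksSum k - coeff G k ≡ + 2 * coeff E k) → IsHalfDifference E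
  shanksSum G
⇒halfDifference {E} {shanksSum} {G} eq k = ℚ.fromℚᵘ-cong {mkℚᵘ (coeff E k) 0} {mkℚᵘ (coeff shanksSum k - coeff G k) 1}
  (*≡* (trans (ℤ.*-comm (coeff E k) (+ 2)) (trans (sym (eq k)) (sym (ℤ.*-identityʳ _)))))

halfDifference-resp-≈ : ∀ {E E′ shanksSum G} → E ≈ E′ → IsHalfDifference E shanksSum G → IsHalfDifference E′ shanksSum G
halfDifference-resp-≈ E≈E′ half k = trans (cong (ℚ._/ 1) (sym (E≈E′ k))) (half k)

-- The series `1 + O(q^D)`. They are closed under powers and inverses and act as 1 below degree `D`,
-- which hides the exponent of η(Dz) from the first `D` coefficients.
OneUpTo : ℕ → Series → Set
OneUpTo D f = f 0 ≡ 1ℤ × (∀ j → 0 ℕ.< j → j ℕ.< D → f j ≡ 0ℤ)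

module _ {D : ℕ} where

  ⊛-oneUpToˡ : ∀ {f} g → OneUpTo D f → ∀ j → j ℕ.< D → (f ⊛ g) j ≡ g j
  ⊛-oneUpToˡ {f} g (f0 , f≡0) j j<D = trans (Σ-single (suc j) 0 (s≤s z≤n) off) (trans (cong (_* g j) f0)
    (ℤ.*-identityˡ (g j)))
    where
    off : ∀ i → i ℕ.< suc j → i ≢ 0 → f i * g (j ℕ.∸ i) ≡ 0ℤ
    off i i<1+j i≢0 = trans (cong (_* g (j ℕ.∸ i)) (f≡0 i (ℕ.n≢0⇒n>0 i≢0) (ℕ.≤-<-trans (ℕ.s≤s⁻¹ i<1+j) j<D)))
      (ℤ.*-zeroˡ (g (j ℕ.∸ i)))

  ⊛-oneUpToʳ : ∀ f {g} → OneUpTo D g → ∀ j → j ℕ.< D → (f ⊛ g) j ≡ f j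
  ⊛-oneUpToʳ f {g} (g0 , g≡0) j j<D = trans (Σ-single (suc j) j (ℕ.n<1+n j) off)
    (trans (cong (f j *_) (trans (cong g (ℕ.n∸n≡0 j)) g0)) (ℤ.*-identityʳ (f j)))
    where
    off : ∀ i → i ℕ.< suc j → i ≢ j → f i * g (j ℕ.∸ i) ≡ 0ℤ
    off i i<1+j i≢j = trans (cong (f i *_) (g≡0 (j ℕ.∸ i) (ℕ.m<n⇒0<n∸m (ℕ.≤∧≢⇒< (ℕ.s≤s⁻¹ i<1+j) i≢j))
      (ℕ.≤-<-trans (ℕ.m∸n≤m j i) j<D))) (ℤ.*-zeroʳ (f i))

  module _ .{{_ : ℕ.NonZero D}} where

    oneUpTo-cong : ∀ {f g} → (∀ j → j ℕ.< D → f j ≡ g j) → OneUpTo D g → OneUpTo D f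
    oneUpTo-cong f≗g (g0 , g≡0) = trans (f≗g 0 (ℕ.>-nonZero⁻¹ D)) g0 , λ j 0<j j<D → trans (f≗g j j<D) (g≡0 j 0<j j<D)

    oneUpTo-one : OneUpTo D oneˢ
    oneUpTo-one = refl , λ j 0<j _ → monomial-≢ {0} (λ e → ℕ.<⇒≢ 0<j (sym e))

    oneUpTo-inverse : ∀ {f} → OneUpTo D f → OneUpTo D (inverse f)
    oneUpTo-inverse {f} one = oneUpTo-cong (λ j j<D → trans (sym (⊛-oneUpToˡ (inverse f) one j j<D))
      (⊛-inverseʳ f (proj₁ one) j)) oneUpTo-one

    oneUpTo-^ : ∀ {f} → OneUpTo D f → ∀ k → OneUpTo D (f ^ˢ k)
    oneUpTo-^ one zero    = oneUpTo-one
    oneUpTo-^ one (suc k) = oneUpTo-cong (⊛-oneUpToˡ _ one) (oneUpTo-^ one k)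

    oneUpTo-dilate : ∀ {f} → f 0 ≡ 1ℤ → OneUpTo D (dilate D f)
    oneUpTo-dilate {f} f0 = trans (dilate-multiple D f 0) f0 , λ j 0<j j<D →
      dilate-nonmultiple D f j (λ D∣j → ℕ.<⇒≱ j<D (∣⇒≤ {{ℕ.>-nonZero 0<j}} D∣j))

    oneUpTo-η^ : ∀ r → OneUpTo D (series (η⟨ D ⟩ ^ᶻ r))
    oneUpTo-η^ (+ k)    = oneUpTo-^ (oneUpTo-dilate refl) k
    oneUpTo-η^ -[1+ k ] = oneUpTo-^ (oneUpTo-inverse (oneUpTo-dilate refl)) (suc k)

order-^ᶻ : ∀ E r → order (E ^ᶻ r) ≡ r * order E
order-^ᶻ E (+ k)    = refl
order-^ᶻ E -[1+ k ] = refl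

^ˢ-coeff₀₁ : ∀ f k → f 0 ≡ 1ℤ → (f ^ˢ k) 0 ≡ 1ℤ × (f ^ˢ k) 1 ≡ + k * f 1
^ˢ-coeff₀₁ f zero    f0 = refl , sym (ℤ.*-zeroˡ (f 1))
^ˢ-coeff₀₁ f (suc k) f0 with p0 , p1 ← ^ˢ-coeff₀₁ f k f0 =
  cong₂ (λ x y → x * y + 0ℤ) f0 p0 ,
  trans (cong₂ (λ x y → x * y + (f 1 * (f ^ˢ k) 0 + 0ℤ)) f0 p1) (trans (cong (λ y → 1ℤ * (+ k * f 1) + (f 1 * y + 0ℤ))
    p0)
    (trans (id (+ k) (f 1)) (cong (_* f 1) (sym (ℤ.pos-+ 1 k)))))
  where
  id : ∀ k x → 1ℤ * (k * x) + (x * 1ℤ + 0ℤ) ≡ (1ℤ + k) * x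
  id = ℤRing.solve-∀

divisors-prime : ∀ {D} → Prime D → divisors D ≡ 1 ∷ D ∷ []
divisors-prime {D} p = go D p (ℕ.nonTrivial⇒n>1 D {{prime⇒nonTrivial p}})
  where
  go : ∀ D → Prime D → 2 ℕ.≤ D → divisors D ≡ 1 ∷ D ∷ []
  go D@(suc (suc m)) p _ = begin
    filter (_∣? D) (map suc (applyUpTo (λ i → i) D))        ≡⟨ cong (filter (_∣? D)) (map-upTo suc D) ⟩
    filter (_∣? D) (1 ∷ applyUpTo (λ i → 2 ℕ.+ i) (suc m))  ≡⟨ filter-accept (_∣? D) (1∣ D) ⟩
    1 ∷ filter (_∣? D) (applyUpTo (λ i → 2 ℕ.+ i) (suc m))  ≡⟨ cong (λ l → 1 ∷ filter (_∣? D) l)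
      (sym (applyUpTo-∷ʳ (λ i → 2 ℕ.+ i) m)) ⟩
    1 ∷ filter (_∣? D) (applyUpTo (λ i → 2 ℕ.+ i) m ++ D ∷ []) ≡⟨ cong (1 ∷_)
      (filter-++ (_∣? D) (applyUpTo (λ i → 2 ℕ.+ i) m) (D ∷ [])) ⟩
    1 ∷ filter (_∣? D) (applyUpTo (λ i → 2 ℕ.+ i) m) ++ filter (_∣? D) (D ∷ []) ≡⟨ cong₂ (λ k l → 1 ∷ k ++ l)
      (filter-none (_∣? D) (All.applyUpTo⁺₁ _ m (λ {i} i<m → notDivisor i i<m))) (filter-accept (_∣? D) {D} {[]} ∣-refl)
      ⟩
    1 ∷ D ∷ []                                              ∎
    where
    open ≡-Reasoning
    notDivisor : ∀ i → i ℕ.< m → ¬ (2 ℕ.+ i) ∣ D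
    notDivisor i i<m d with prime⇒irreducible p d
    ... | inj₁ ()
    ... | inj₂ e = ℕ.<⇒≢ (s≤s (s≤s i<m)) e
  go (suc zero) _ (s≤s ())

module _ {D : ℕ} (p : Prime D) (r : ℕ → ℤ) where

  private instance
    D-nonZero : ℕ.NonZero D
    D-nonZero = prime⇒nonZero p

  private
    E₁ E₂ : QSeries
    E₁ = η⟨ 1 ⟩ ^ᶻ r 1
    E₂ = η⟨ D ⟩ ^ᶻ r D

  etaQuotient-prime : etaQuotient D r ≡ E₁ ⊗ (E₂ ⊗ oneQ)
  etaQuotient-prime = cong (foldr _⊗_ oneQ ∘ map (λ δ → η⟨ δ ⟩ ^ᶻ r δ)) (divisors-prime p)

  etaQuotient-order : order (etaQuotient D r) ≡ r 1 + r D * + D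
  etaQuotient-order = trans (cong order etaQuotient-prime) (trans (cong₂ (λ x y → x + (y + 0ℤ)) (order-^ᶻ η⟨ 1 ⟩ (r 1))
    (order-^ᶻ η⟨ D ⟩ (r D)))
    (id (r 1) (r D) (+ D)))
    where
    id : ∀ x y d → x * + 1 + (y * d + 0ℤ) ≡ x + y * d
    id = ℤRing.solve-∀

  etaQuotient-series : ∀ j → j ℕ.< D → series (etaQuotient D r) j ≡ series E₁ j
  etaQuotient-series j j<D = trans (cong (λ E → series E j) etaQuotient-prime)
    (⊛-oneUpToʳ (series E₁) (oneUpTo-cong (λ i _ → ⊛-identityʳ (series E₂) i) (oneUpTo-η^ (r D))) j j<D)

  series₀₁ : series E₁ 0 ≡ 1ℤ × series E₁ 1 ≡ - r 1
  series₀₁ with r 1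
  ... | + k      = proj₁ coeffs , trans (proj₂ coeffs) (trans (ℤ.*-comm (+ k) -1ℤ) (ℤ.-1*i≡-i (+ k)))
    where
    coeffs = ^ˢ-coeff₀₁ (dilate 1 euler) k refl
  ... | -[1+ k ] = proj₁ coeffs , trans (proj₂ coeffs) (ℤ.*-identityʳ (+ suc k))
    where
    coeffs = ^ˢ-coeff₀₁ (inverse (dilate 1 euler)) (suc k) refl

  series-r≡0 : r 1 ≡ 0ℤ → ∀ j → 0 ℕ.< j → series E₁ j ≡ 0ℤ
  series-r≡0 e j 0<j = trans (cong (λ k → series (η⟨ 1 ⟩ ^ᶻ k) j) e) (monomial-≢ {0} (λ e → ℕ.<⇒≢ 0<j (sym e)))

  series-r≡1 : r 1 ≡ 1ℤ → ∀ j → series E₁ j ≡ euler j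
  series-r≡1 e j = trans (cong (λ k → series (η⟨ 1 ⟩ ^ᶻ k) j) e) (trans (⊛-identityʳ (dilate 1 euler) j)
    (dilate-1 euler j))

  -- The number of partitions of 2.
  series-r≡-1 : r 1 ≡ -1ℤ → series E₁ 2 ≡ + 2
  series-r≡-1 e = trans (cong (λ k → series (η⟨ 1 ⟩ ^ᶻ k) 2) e) refl

  etaQuotient≈ηη : r 1 ≡ 1ℤ → r D ≡ 1ℤ → etaQuotient D r ≈ η⟨ 1 ⟩ ⊗ η⟨ D ⟩
  etaQuotient≈ηη r₁≡1 rD≡1 = ≈-intro _ (η⟨ 1 ⟩ ⊗ η⟨ D ⟩)
    (trans etaQuotient-order (cong₂ (λ x y → x + y) r₁≡1 (trans (cong (_* + D) rD≡1) (ℤ.*-identityˡ (+ D)))))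
    (λ n → trans (cong (λ E → series E n) etaQuotient-prime) (⊛-cong n
      (λ i _ → trans (cong (λ k → series (η⟨ 1 ⟩ ^ᶻ k) i) r₁≡1) (⊛-identityʳ (dilate 1 euler) i))
      (λ i _ → trans (⊛-identityʳ (series E₂) i) (trans (cong (λ k → series (η⟨ D ⟩ ^ᶻ k) i) rD≡1)
        (⊛-identityʳ (dilate D euler) i)))))

-- The first coefficients determine the forms

schoenebergPair-generic : ∀ D c → D ℕ.+ 1 ≡ 24 ℕ.* c → 6 ℕ.≤ c → SchoenebergPair D (form (+ 6) (+ 1) (+ c))
  (form (+ 6) (+ 5) (+ (c ℕ.+ 1)))
schoenebergPair-generic D (suc c) e 6≤c = subst₂ (λ k l → SchoenebergPair D (form (+ 6) (+ 1) (+ k))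
  (form (+ 6) (+ 5) (+ l)))
  quot₁ quot₂ (generic rem (subst (6 ℕ.≤_) (sym quot₁) 6≤c))
  where
  D≡ : D ≡ 23 ℕ.+ c ℕ.* 24
  D≡ = ℕ.+-cancelʳ-≡ 1 D _ (trans e (eq c))
    where
    eq : ∀ c → 24 ℕ.* suc c ≡ 23 ℕ.+ c ℕ.* 24 ℕ.+ 1
    eq = ℕRing.solve-∀
  rem : D ℕ.% 24 ≡ 23
  rem = trans (cong (ℕ._% 24) D≡) (ℕ.[m+kn]%n≡m%n 23 c 24)
  quot₁ : (D ℕ.+ 1) ℕ./ 24 ≡ suc c
  quot₁ = trans (cong (ℕ._/ 24) (trans e (ℕ.*-comm 24 (suc c)))) (ℕ.m*n/n≡m (suc c) 24)
  quot₂ : (D ℕ.+ 25) ℕ./ 24 ≡ suc c ℕ.+ 1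
  quot₂ = trans (cong (ℕ._/ 24) (trans (cong (ℕ._+ 25) D≡) (eq c))) (ℕ.m*n/n≡m (suc c ℕ.+ 1) 24)
    where
    eq : ∀ c → 23 ℕ.+ c ℕ.* 24 ℕ.+ 25 ≡ (suc c ℕ.+ 1) ℕ.* 24
    eq = ℕRing.solve-∀

squares-< : ∀ {b β} → b ℕ.* b ℕ.< β ℕ.* β → b ℕ.< β
squares-< {b} {β} b²<β² = ℕ.≰⇒> (λ β≤b → ℕ.<⇒≱ b²<β² (ℕ.*-mono-≤ β≤b β≤b))

module Facts {D : ℕ} (p : Prime D) {a b c : ℕ} (b≤a : b ℕ.≤ a) (a≤c : a ℕ.≤ c) (disc : D ℕ.+ b ℕ.* b ≡ 4 ℕ.* (a ℕ.* c)) where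

  b≥1 : 1 ℕ.≤ b
  b≥1 = 1≤b p b≤a a≤c disc

  a≥1 : 1 ℕ.≤ a
  a≥1 = ℕ.≤-trans b≥1 b≤a

  c≥1 : 1 ℕ.≤ c
  c≥1 = ℕ.≤-trans a≥1 a≤c

  c<3c : c ℕ.< 3 ℕ.* c
  c<3c = ℕ.m<m+n c (ℕ.≤-trans c≥1 (ℕ.m≤m+n c (c ℕ.+ 0)))

  c<a+b+c : c ℕ.< a ℕ.+ b ℕ.+ c
  c<a+b+c = ℕ.m<n+m c (ℕ.≤-trans a≥1 (ℕ.m≤m+n a b))

  instance
    a≢0 : ℕ.NonZero a
    a≢0 = ℕ.>-nonZero a≥1

  d : ℕ
  d = a ℕ.∸ b

  b+d≡a : b ℕ.+ d ≡ a
  b+d≡a = ℕ.m+[n∸m]≡n b≤a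

  Q : Form
  Q = form (+ a) (+ b) (+ c)

  rep : ℕ → ℕ
  rep = representations Q

  pd : PositiveDefinite Q
  pd = positiveDefinite a (+ b) (+ c) D {{a≢0}} {{prime⇒nonZero p}} (trans (cong₂ _-_ (sym (ℤ.pos-* b b)) 4ac)
    (cancel (+ D) (+ (b ℕ.* b))))
    where
    4ac : + 4 * (+ a * + c) ≡ + D + + (b ℕ.* b)
    4ac = trans (cong (+ 4 *_) (sym (ℤ.pos-* a c))) (trans (sym (ℤ.pos-* 4 (a ℕ.* c))) (trans (cong +_ (sym disc))
      (ℤ.pos-+ D _)))
    cancel : ∀ x y → y - (x + y) ≡ - x
    cancel = ℤRing.solve-∀

  b<a : a ≢ 1 → b ℕ.< a
  b<a a≢1 = ℕ.≤∧≢⇒< b≤a (λ b≡a → a≢1 (b≡a⇒a≡1 p b≤a a≤c disc b≡a))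

  a<c : a ≢ 1 → a ℕ.< c
  a<c a≢1 = ℕ.≤∧≢⇒< a≤c (λ a≡c → a≢1 (a≡c⇒a≡1 p b≤a a≤c disc a≡c))

  b<a⇒1≤d : b ℕ.< a → 1 ℕ.≤ d
  b<a⇒1≤d b<a = ℕ.m<n⇒0<n∸m b<a

  d<a : d ℕ.< a
  d<a = ℕ.≤-trans (ℕ.≤-reflexive (ℕ.+-comm 1 d)) (ℕ.≤-trans (ℕ.+-monoʳ-≤ d b≥1)
    (ℕ.≤-reflexive (trans (ℕ.+-comm d b) b+d≡a)))

  rep≢0 : ∀ {n} → Represents Q n → rep n ≢ 0
  rep≢0 {n} = represents⇒representations≢0 Q pd n

  rep≢0⇒ : ∀ {n} → rep n ≢ 0 → Represents Q n
  rep≢0⇒ {n} = representations≢0⇒represents Q n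

  rep≢0⇒a≤ : ∀ {n} → 0 ℕ.< n → rep n ≢ 0 → a ℕ.≤ n
  rep≢0⇒a≤ 0<n r≢0 = represented≥a b≤a a≤c _ 0<n (rep≢0⇒ r≢0)

-- Here `m` is the order of the eta quotient as a power of `q`, `f` its series and `r` the exponent
-- of η(z). Apart from `f₀`, the series is known only through `r`: its first coefficient is `-r`,
-- and more is recorded only for `r = 0, 1, -1`, the values that survive the comparison of first
-- coefficients.
module Classification {D : ℕ} (p : Prime D)
  {a b c : ℕ} (b≤a : b ℕ.≤ a) (a≤c : a ℕ.≤ c) (disc : D ℕ.+ b ℕ.* b ≡ 4 ℕ.* (a ℕ.* c))
  {α β γ : ℕ} (β≤α : β ℕ.≤ α) (α≤γ : α ℕ.≤ γ) (disc′ : D ℕ.+ β ℕ.* β ≡ 4 ℕ.* (α ℕ.* γ))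
  (m : ℕ) (f : ℕ → ℤ) (r : ℤ)
  (low : ∀ n → n ℕ.< m → representations (form (+ a) (+ b) (+ c)) n ≡ representations (form (+ α) (+ β) (+ γ)) n)
  (expansion : ∀ j → j ℕ.< D → + representations (form (+ a) (+ b) (+ c)) (m ℕ.+ j) - + representations
    (form (+ α) (+ β) (+ γ)) (m ℕ.+ j) ≡ + 2 * f j)
  (f₀ : f 0 ≡ 1ℤ) (f₁ : 1 ℕ.< D → f 1 ≡ - r)
  (r≡0 : r ≡ 0ℤ → ∀ j → 0 ℕ.< j → j ℕ.< D → f j ≡ 0ℤ)
  (r≡1 : r ≡ 1ℤ → ∀ j → j ℕ.< D → f j ≡ euler j)
  (r≡-1 : r ≡ -1ℤ → 2 ℕ.< D → f 2 ≡ + 2)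
  where

  module S = Facts p b≤a a≤c disc
  module T = Facts p β≤α α≤γ disc′

  Conclusion : Set
  Conclusion = r ≡ 1ℤ × D ℕ.+ 1 ≡ 24 ℕ.* m × SchoenebergPair D S.Q T.Q

  0<D : 0 ℕ.< D
  0<D = ℕ.<⇒≤ (prime⇒2≤ p)

  minus⇒plus : ∀ {x y z : ℤ} → x - y ≡ z → x ≡ z + y
  minus⇒plus {x} {y} refl = id x y
    where
    id : ∀ x y → x ≡ x - y + y
    id = ℤRing.solve-∀

  rep-m : S.rep m ≡ 2 ℕ.+ T.rep m
  rep-m = ℤ.+-injective (trans (subst (λ n → + S.rep n ≡ + 2 * f 0 + + T.rep n) (ℕ.+-identityʳ m)
    (minus⇒plus {+ S.rep (m ℕ.+ 0)} (expansion 0 0<D)))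
    (trans (cong (λ z → + 2 * z + + T.rep m) f₀) (sym (ℤ.pos-+ 2 (T.rep m)))))

  -- Every form represents 0 exactly once, whereas at `m` the two counts differ by 2.
  0<m : 0 ℕ.< m
  0<m = ℕ.n≢0⇒n>0 (λ m≡0 → contradiction (trans (sym (trans (cong S.rep m≡0) (representations-zero S.Q S.pd)))
    (trans rep-m (cong (2 ℕ.+_) (trans (cong T.rep m≡0) (representations-zero T.Q T.pd))))) λ ())

  a≤m : a ℕ.≤ m
  a≤m = S.rep≢0⇒a≤ 0<m (λ e → contradiction (trans (sym e) rep-m) λ ())

  Range : ℕ → Set
  Range n = 0 ℕ.< n × (n ℕ.< a ℕ.+ b ℕ.+ c × n ℕ.< 3 ℕ.* c) × (n ℕ.< α ℕ.+ β ℕ.+ γ × n ℕ.< 3 ℕ.* γ)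

  -- Half the representation numbers in `Range`, so that the surplus of `hS` over `hT` at `m + j` is
  -- the coefficient `f j` itself.
  hS hT : ℕ → ℤ
  hS n = axisCount a n + 𝟙 (n ℕ.≟ c) + 𝟙 (n ℕ.≟ c ℕ.+ S.d)
  hT n = axisCount α n + 𝟙 (n ℕ.≟ γ) + 𝟙 (n ℕ.≟ γ ℕ.+ T.d)

  repS : ∀ n → Range n → + S.rep n ≡ + 2 * hS n
  repS n (0<n , (q , q′) , _) = shortRepresentations b≤a a≤c S.d S.b+d≡a {{S.a≢0}} S.pd n 0<n q q′

  repT : ∀ n → Range n → + T.rep n ≡ + 2 * hT n
  repT n (0<n , _ , (q , q′)) = shortRepresentations β≤α α≤γ T.d T.b+d≡a {{T.a≢0}} T.pd n 0<n q q′

  balance-low : ∀ n → n ℕ.< m → Range n → hS n ≡ hT n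
  balance-low n n<m range = ℤ.*-cancelˡ-≡ (+ 2) (hS n) (hT n) (trans (sym (repS n range)) (trans (cong +_ (low n n<m))
    (repT n range)))

  balance : ∀ n j → n ≡ m ℕ.+ j → j ℕ.< D → Range n → hS n ≡ f j + hT n
  balance n j refl j<D range = ℤ.*-cancelˡ-≡ (+ 2) (hS n) (f j + hT n) (trans (sym (repS n range))
    (trans (minus⇒plus {+ S.rep n} (expansion j j<D)) (trans (cong (_+_ (+ 2 * f j)) (repT n range))
      (sym (ℤ.*-distribˡ-+ (+ 2) (f j) (hT n))))))

  discriminants : 4 ℕ.* (a ℕ.* c) ℕ.+ β ℕ.* β ≡ 4 ℕ.* (α ℕ.* γ) ℕ.+ b ℕ.* b
  discriminants = trans (cong (ℕ._+ β ℕ.* β) (sym disc)) (trans (swap D (b ℕ.* b) (β ℕ.* β)) (cong (ℕ._+ b ℕ.* b)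
    disc′))
    where
    swap : ∀ x y z → x ℕ.+ y ℕ.+ z ≡ x ℕ.+ z ℕ.+ y
    swap = ℕRing.solve-∀

  -- Below `m` both forms represent the same numbers, and `a ≤ m`; so `α < a` would be represented
  -- by the first form below its minimum.
  α≮a : ¬ α ℕ.< a
  α≮a α<a with ℕ.<-cmp α m
  ... | tri< α<m _ _ = ℕ.<⇒≱ α<a (S.rep≢0⇒a≤ T.a≥1 (λ e → T.rep≢0 (represents-a β≤α α≤γ) (trans (sym (low α α<m)) e)))
  ... | tri≈ _ refl _ = ℕ.<⇒≱ α<a a≤m
  ... | tri> _ _ m<α = ℕ.<⇒≱ (ℕ.<-trans m<α α<a) a≤m

  -- The axes contribute equally to both forms.
  module EqualLeading (a≡α : a ≡ α) where

    hS≡ : ∀ n → hS n ≡ axisCount α n + 𝟙 (n ℕ.≟ c) + 𝟙 (n ℕ.≟ c ℕ.+ S.d)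
    hS≡ n = cong (λ k → axisCount k n + 𝟙 (n ℕ.≟ c) + 𝟙 (n ℕ.≟ c ℕ.+ S.d)) a≡α

    drop : ∀ s x y z x′ y′ → s + x + y ≡ z + (s + x′ + y′) → x + y ≡ z + (x′ + y′)
    drop s x y z x′ y′ e = ∙-cancel (trans (sym (ℤ.+-assoc s x y)) (trans e (id s z x′ y′)))
      where
      id : ∀ s z x y → z + (s + x + y) ≡ s + (z + (x + y))
      id = ℤRing.solve-∀
      ∙-cancel : ∀ {u v} → s + u ≡ s + v → u ≡ v
      ∙-cancel {u} {v} e = trans (sym (back s u)) (trans (cong (λ w → w - s) e) (back s v))
        where
        back : ∀ s u → s + u - s ≡ u
        back = ℤRing.solve-∀

    tails : ∀ n z {x y x′ y′} → hS n ≡ z + hT n → 𝟙 (n ℕ.≟ c) ≡ x → 𝟙 (n ℕ.≟ c ℕ.+ S.d) ≡ y → 𝟙 (n ℕ.≟ γ) ≡ x′ → 𝟙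
      (n ℕ.≟ γ ℕ.+ T.d) ≡ y′ →
      x + y ≡ z + (x′ + y′)
    tails n z e refl refl refl refl = drop (axisCount α n) (𝟙 (n ℕ.≟ c)) (𝟙 (n ℕ.≟ c ℕ.+ S.d)) z (𝟙 (n ℕ.≟ γ))
      (𝟙 (n ℕ.≟ γ ℕ.+ T.d))
      (trans (sym (hS≡ n)) e)

    no< : ∀ {n k} → n ℕ.< k → 𝟙 (n ℕ.≟ k) ≡ 0ℤ
    no< {n} {k} n<k = 𝟙-no (n ℕ.≟ k) (ℕ.<⇒≢ n<k)

    discriminants′ : 4 ℕ.* (a ℕ.* c) ℕ.+ β ℕ.* β ≡ 4 ℕ.* (a ℕ.* γ) ℕ.+ b ℕ.* b
    discriminants′ = trans discriminants (cong (λ k → 4 ℕ.* (k ℕ.* γ) ℕ.+ b ℕ.* b) (sym a≡α))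

    -- Equal outer coefficients force equal middle ones, and identical forms cannot differ at `m`.
    c≢γ : c ≢ γ
    c≢γ c≡γ = ℕ.m≢1+n+m (T.rep m) (trans (sym S≡T) rep-m)
      where
      b²≡β² : b ℕ.* b ≡ β ℕ.* β
      b²≡β² = sym (ℕ.+-cancelˡ-≡ (4 ℕ.* (a ℕ.* c)) _ _ (trans discriminants′ (cong (λ k → 4 ℕ.* (a ℕ.* k) ℕ.+ b ℕ.* b)
        (sym c≡γ))))
      b≡β : b ≡ β
      b≡β with ℕ.<-cmp b β
      ... | tri< b<β _ _ = contradiction b²≡β² (ℕ.<⇒≢ (ℕ.*-mono-< b<β b<β))
      ... | tri≈ _ e _   = e
      ... | tri> _ _ β<b = contradiction (sym b²≡β²) (ℕ.<⇒≢ (ℕ.*-mono-< β<b β<b))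
      S≡T : S.rep m ≡ T.rep m
      S≡T = trans (cong₂ (λ k l → representations (form (+ a) (+ k) (+ l)) m) b≡β c≡γ)
        (cong (λ k → representations (form (+ k) (+ β) (+ γ)) m) a≡α)

    middle : ∀ {k x y u v} → .{{ℕ.NonZero k}} → x ℕ.< y → 4 ℕ.* (k ℕ.* x) ℕ.+ v ℕ.* v ≡ 4 ℕ.* (k ℕ.* y) ℕ.+ u ℕ.* u → u
      ℕ.< v
    middle {k} {x} {y} {u} {v} x<y e = squares-< (ℕ.+-cancelˡ-< (4 ℕ.* (k ℕ.* x)) _ _
      (subst (4 ℕ.* (k ℕ.* x) ℕ.+ u ℕ.* u ℕ.<_) (sym e) (ℕ.+-monoˡ-< (u ℕ.* u) (ℕ.*-monoʳ-< 4 (ℕ.*-monoʳ-< k x<y)))))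

    -- If `γ < c`, then at `γ` the second form has an off-axis vector and the first has none, a
    -- negative surplus, while the surplus is 0 before `m` and 1 at `m`. And `m < γ` is impossible
    -- because off the axis neither form represents anything below `γ`.
    γ≮c : ¬ γ ℕ.< c
    γ≮c γ<c = go (ℕ.<-cmp γ m)
      where
      β<b : β ℕ.< b
      β<b = middle {a} {{S.a≢0}} γ<c (sym discriminants′)
      b<a : b ℕ.< a
      b<a = S.b<a (λ a≡1 → ℕ.<⇒≱ (ℕ.≤-trans (s≤s T.b≥1) β<b) (ℕ.≤-trans b≤a (ℕ.≤-reflexive a≡1)))
      range : ∀ n → 0 ℕ.< n → n ℕ.≤ γ → Range n
      range n 0<n n≤γ = 0<n , (ℕ.≤-trans (ℕ.≤-<-trans n≤γ γ<c) (ℕ.m≤n+m c (a ℕ.+ b)) , ℕ.≤-trans (ℕ.≤-<-trans n≤γ γ<c)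
        (ℕ.m≤n*m c 3)) ,
        (ℕ.≤-<-trans n≤γ T.c<a+b+c , ℕ.≤-<-trans n≤γ T.c<3c)
      γ<γ+δ : γ ℕ.< γ ℕ.+ T.d
      γ<γ+δ = ℕ.m<m+n γ (T.b<a⇒1≤d (subst (β ℕ.<_) a≡α (ℕ.<-trans β<b b<a)))
      at : ∀ z → hS γ ≡ z + hT γ → 0ℤ + 0ℤ ≡ z + (1ℤ + 0ℤ)
      at z e = tails γ z e (no< γ<c) (no< (ℕ.≤-trans γ<c (ℕ.m≤m+n c S.d))) (𝟙-yes (γ ℕ.≟ γ) refl) (no< γ<γ+δ)
      go : _ → ⊥
      go (tri< γ<m _ _) = contradiction (at 0ℤ (trans (balance-low γ γ<m (range γ T.c≥1 ℕ.≤-refl))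
        (sym (ℤ.+-identityˡ (hT γ))))) λ ()
      go (tri≈ _ γ≡m _) = contradiction (at 1ℤ (trans (balance γ 0 (trans γ≡m (sym (ℕ.+-identityʳ m))) 0<D
        (range γ T.c≥1 ℕ.≤-refl)) (cong (_+ hT γ) f₀))) λ ()
      go (tri> _ _ m<γ) = contradiction
        (tails m 1ℤ (trans (balance m 0 (sym (ℕ.+-identityʳ m)) 0<D (range m 0<m (ℕ.<⇒≤ m<γ))) (cong (_+ hT m) f₀))
        (no< (ℕ.<-trans m<γ γ<c)) (no< (ℕ.≤-trans (ℕ.<-trans m<γ γ<c) (ℕ.m≤m+n c S.d))) (no< m<γ)
          (no< (ℕ.<-trans m<γ γ<γ+δ))) λ ()

    module _ (c<γ : c ℕ.< γ) where

      b<β : b ℕ.< β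
      b<β = middle {a} {{S.a≢0}} c<γ discriminants′

      β<a : β ℕ.< a
      β<a = subst (β ℕ.<_) (sym a≡α) (T.b<a (λ α≡1 → ℕ.<⇒≱ (ℕ.≤-trans (s≤s S.b≥1) b<β)
        (ℕ.≤-trans β≤α (ℕ.≤-reflexive α≡1))))

      3≤a : 3 ℕ.≤ a
      3≤a = ℕ.≤-trans (s≤s (ℕ.≤-trans (s≤s S.b≥1) b<β)) β<a

      1≤δ : 1 ℕ.≤ T.d
      1≤δ = T.b<a⇒1≤d (subst (β ℕ.<_) a≡α β<a)

      δ<d : T.d ℕ.< S.d
      δ<d = subst (λ k → k ℕ.∸ β ℕ.< S.d) a≡α (ℕ.∸-monoʳ-< b<β (ℕ.<⇒≤ β<a))

      2≤d : 2 ℕ.≤ S.d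
      2≤d = ℕ.≤-trans (s≤s 1≤δ) δ<d

      -- 4 a (γ - c) = β² - b² < a²
      γ<c+a : γ ℕ.< c ℕ.+ a
      γ<c+a = ℕ.≰⇒> contra
        where
        contra : ¬ c ℕ.+ a ℕ.≤ γ
        contra c+a≤γ with k , refl ← slack c+a≤γ = ℕ.<⇒≱ (ℕ.*-mono-< β<a β<a)
          (≤-slack (3 ℕ.* (a ℕ.* a) ℕ.+ 4 ℕ.* (a ℕ.* k) ℕ.+ b ℕ.* b) (ℕ.+-cancelˡ-≡ (4 ℕ.* (a ℕ.* c)) _ _
            (trans discriminants′ (eq a b c k))))
          where
          eq : ∀ a b c k → 4 ℕ.* (a ℕ.* (c ℕ.+ a ℕ.+ k)) ℕ.+ b ℕ.* b ≡ 4 ℕ.* (a ℕ.* c) ℕ.+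
            (a ℕ.* a ℕ.+ (3 ℕ.* (a ℕ.* a) ℕ.+ 4 ℕ.* (a ℕ.* k) ℕ.+ b ℕ.* b))
          eq = ℕRing.solve-∀

      c<D : c ℕ.+ a ℕ.< D
      c<D = ℕ.+-cancelʳ-< (b ℕ.* b) _ D (subst (c ℕ.+ a ℕ.+ b ℕ.* b ℕ.<_) (sym disc) (go S.b≥1 (ℕ.<-trans b<β β<a) a≤c))
        where
        go : 1 ℕ.≤ b → b ℕ.< a → a ℕ.≤ c → c ℕ.+ a ℕ.+ b ℕ.* b ℕ.< 4 ℕ.* (a ℕ.* c)
        go 1≤b b<a a≤c with b₁ , refl ← slack 1≤b with k , refl ← slack b<a with l , refl ← slack a≤c =
          ≤-slack (10 ℕ.+ 14 ℕ.* k ℕ.+ 12 ℕ.* b₁ ℕ.+ 7 ℕ.* l ℕ.+ 3 ℕ.* (b₁ ℕ.* b₁) ℕ.+ 8 ℕ.* (b₁ ℕ.* k) ℕ.+ 4 ℕ.*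
            (k ℕ.* k) ℕ.+ 4 ℕ.* (b₁ ℕ.* l) ℕ.+ 4 ℕ.* (k ℕ.* l)) (eq b₁ k l)
          where
          eq : ∀ b k l → 4 ℕ.* ((suc (1 ℕ.+ b) ℕ.+ k) ℕ.* (suc (1 ℕ.+ b) ℕ.+ k ℕ.+ l)) ≡
            suc (suc (1 ℕ.+ b) ℕ.+ k ℕ.+ l ℕ.+ (suc (1 ℕ.+ b) ℕ.+ k) ℕ.+ (1 ℕ.+ b) ℕ.* (1 ℕ.+ b)) ℕ.+
            (10 ℕ.+ 14 ℕ.* k ℕ.+ 12 ℕ.* b ℕ.+ 7 ℕ.* l ℕ.+ 3 ℕ.* (b ℕ.* b) ℕ.+ 8 ℕ.* (b ℕ.* k) ℕ.+ 4 ℕ.* (k ℕ.* k) ℕ.+ 4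
              ℕ.* (b ℕ.* l) ℕ.+ 4 ℕ.* (k ℕ.* l))
          eq = ℕRing.solve-∀

      range : ∀ n → 0 ℕ.< n → n ℕ.< c ℕ.+ a → Range n
      range n 0<n n<c+a = 0<n ,
        (ℕ.≤-trans n<c+a (≤-slack b (eq a b c)) , ℕ.≤-trans n<c+a (ℕ.≤-trans (ℕ.+-monoʳ-≤ c a≤c)
          (ℕ.+-monoʳ-≤ c (ℕ.m≤m+n c (c ℕ.+ 0))))) ,
        (ℕ.≤-trans n<c+a (ℕ.≤-trans (ℕ.≤-trans (ℕ.+-mono-≤ (ℕ.<⇒≤ c<γ) (ℕ.≤-reflexive a≡α)) (≤-slack β (eq α β γ)))
          ℕ.≤-refl) ,
         ℕ.≤-trans n<c+a (ℕ.≤-trans (ℕ.+-mono-≤ (ℕ.<⇒≤ c<γ) (ℕ.≤-trans (ℕ.≤-reflexive a≡α) α≤γ))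
           (ℕ.+-monoʳ-≤ γ (ℕ.m≤m+n γ (γ ℕ.+ 0)))))
        where
        eq : ∀ a b c → a ℕ.+ b ℕ.+ c ≡ c ℕ.+ a ℕ.+ b
        eq = ℕRing.solve-∀

      c<c+a : c ℕ.< c ℕ.+ a
      c<c+a = ℕ.m<m+n c S.a≥1

      at-c : ∀ z → hS c ≡ z + hT c → 1ℤ + 0ℤ ≡ z + (0ℤ + 0ℤ)
      at-c z e = tails c z e (𝟙-yes (c ℕ.≟ c) refl) (no< (ℕ.m<m+n c (ℕ.<⇒≤ 2≤d))) (no< c<γ)
        (no< (ℕ.≤-trans c<γ (ℕ.m≤m+n γ T.d)))

      -- The smallest off-axis number is `c`, represented by the first form alone, and the
      -- difference has to start there.
      m≡c : m ≡ c
      m≡c with ℕ.<-cmp c m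
      ... | tri< c<m _ _ = contradiction (at-c 0ℤ (trans (balance-low c c<m (range c S.c≥1 c<c+a))
        (sym (ℤ.+-identityˡ (hT c))))) λ ()
      ... | tri≈ _ c≡m _ = sym c≡m
      ... | tri> _ _ m<c = contradiction
        (tails m 1ℤ (trans (balance m 0 (sym (ℕ.+-identityʳ m)) 0<D (range m 0<m (ℕ.<-trans m<c c<c+a)))
        (cong (_+ hT m) f₀))
        (no< m<c) (no< (ℕ.≤-trans m<c (ℕ.m≤m+n c S.d))) (no< (ℕ.<-trans m<c c<γ))
          (no< (ℕ.≤-trans (ℕ.<-trans m<c c<γ) (ℕ.m≤m+n γ T.d)))) λ ()

      balance-c : ∀ n j z → n ≡ c ℕ.+ j → f j ≡ z → j ℕ.< a → hS n ≡ z + hT n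
      balance-c n j z n≡ fj≡ j<a = trans (balance n j (trans n≡ (cong (ℕ._+ j) (sym m≡c))) (ℕ.≤-<-trans (ℕ.m≤n+m j c)
        (ℕ.<-trans (ℕ.+-monoʳ-< c j<a) c<D))
        (range n (subst (0 ℕ.<_) (sym n≡) (ℕ.≤-trans S.c≥1 (ℕ.m≤m+n c j))) (subst (ℕ._< c ℕ.+ a) (sym n≡)
          (ℕ.+-monoʳ-< c j<a)))) (cong (_+ hT n) fj≡)

      -- Off the axis, `c + 1` can only be `γ`: the corner of the first form is at least `c + 2`,
      -- and that of the second lies beyond `γ`. Hence `r` is 0 or 1.
      first : ∀ y → 𝟙 (c ℕ.+ 1 ℕ.≟ γ) ≡ y → 0ℤ ≡ - r + (y + 0ℤ)
      first y e = tails (c ℕ.+ 1) (- r) (balance-c (c ℕ.+ 1) 1 (- r) refl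
        (f₁ (ℕ.≤-<-trans (ℕ.≤-trans (ℕ.<⇒≤ (ℕ.<⇒≤ 3≤a)) (ℕ.m≤n+m a c)) c<D)) (ℕ.<⇒≤ 3≤a))
        (𝟙-no (c ℕ.+ 1 ℕ.≟ c) (λ e → ℕ.<⇒≢ (ℕ.m<m+n c (s≤s z≤n)) (sym e)))
        (no< (ℕ.+-monoʳ-< c 2≤d)) e (no< (ℕ.≤-trans (ℕ.≤-reflexive (sym (ℕ.+-suc c 1)))
          (ℕ.≤-trans (ℕ.≤-reflexive (ℕ.+-suc c 1)) (ℕ.+-mono-≤ c<γ 1≤δ))))

      conclude : Conclusion
      conclude with c ℕ.+ 1 ℕ.≟ γ
      -- Now `r = 0` and the counts agree at `γ`, so `γ` would have to be the corner `c + d` of the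
      -- first form.
      ... | no c+1≢γ = contradiction (trans (sym (tails γ 0ℤ (balance-c γ k 0ℤ γ≡ fk≡0 k<a)
              (𝟙-no (γ ℕ.≟ c) (λ e → ℕ.<⇒≢ c<γ (sym e))) (𝟙-no (γ ℕ.≟ c ℕ.+ S.d) γ≢c+d) (𝟙-yes (γ ℕ.≟ γ) refl)
                (no< (ℕ.m<m+n γ 1≤δ)))) refl) λ ()
        where
        k : ℕ
        k = γ ℕ.∸ c
        γ≡ : γ ≡ c ℕ.+ k
        γ≡ = sym (ℕ.m+[n∸m]≡n (ℕ.<⇒≤ c<γ))
        k<a : k ℕ.< a
        k<a = ℕ.+-cancelˡ-< c k a (subst (ℕ._< c ℕ.+ a) γ≡ γ<c+a)
        r≡0ℤ : r ≡ 0ℤ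
        r≡0ℤ = trans (sym (ℤ.neg-involutive r)) (cong -_ (trans (sym (ℤ.+-identityʳ (- r)))
          (sym (first 0ℤ (𝟙-no (c ℕ.+ 1 ℕ.≟ γ) c+1≢γ)))))
        fk≡0 : f k ≡ 0ℤ
        fk≡0 = r≡0 r≡0ℤ k (ℕ.m<n⇒0<n∸m c<γ) (ℕ.<-trans (ℕ.≤-trans k<a (ℕ.m≤n+m a c)) c<D)
        -- Otherwise β² - b² = 4 a d, so β² = (a + d)² exceeds a².
        γ≢c+d : γ ≢ c ℕ.+ S.d
        γ≢c+d e = ℕ.<⇒≱ (ℕ.*-mono-< β<a β<a) (≤-slack (2 ℕ.* (b ℕ.* S.d) ℕ.+ 3 ℕ.* (S.d ℕ.* S.d))
          (ℕ.+-cancelˡ-≡ (4 ℕ.* (a ℕ.* c)) _ _ (trans discriminants′ (trans (cong (λ k → 4 ℕ.* (a ℕ.* k) ℕ.+ b ℕ.* b) e)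
            (subst (λ a → 4 ℕ.* (a ℕ.* (c ℕ.+ S.d)) ℕ.+ b ℕ.* b ≡ 4 ℕ.* (a ℕ.* c) ℕ.+
              (a ℕ.* a ℕ.+ (2 ℕ.* (b ℕ.* S.d) ℕ.+ 3 ℕ.* (S.d ℕ.* S.d)))) S.b+d≡a (eq b S.d c))))))
          where
          eq : ∀ b d c → 4 ℕ.* ((b ℕ.+ d) ℕ.* (c ℕ.+ d)) ℕ.+ b ℕ.* b ≡ 4 ℕ.* ((b ℕ.+ d) ℕ.* c) ℕ.+
            ((b ℕ.+ d) ℕ.* (b ℕ.+ d) ℕ.+ (2 ℕ.* (b ℕ.* d) ℕ.+ 3 ℕ.* (d ℕ.* d)))
          eq = ℕRing.solve-∀
      ... | yes c+1≡γ = r≡1ℤ , trans D+1≡ (cong (24 ℕ.*_) (sym m≡c)) , pair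
        where
        r≡1ℤ : r ≡ 1ℤ
        r≡1ℤ = solveFor r (first 1ℤ (𝟙-yes (c ℕ.+ 1 ℕ.≟ γ) c+1≡γ))
          where
          solveFor : ∀ r → 0ℤ ≡ - r + (1ℤ + 0ℤ) → r ≡ 1ℤ
          solveFor r e = trans (id r) (trans (cong (λ z → 1ℤ - z) (sym e)) refl)
            where
            id : ∀ r → r ≡ 1ℤ - (- r + (1ℤ + 0ℤ))
            id = ℤRing.solve-∀
        -- The coefficient of `q²` in `∏(1 - q^n)` is -1, so the second form must have a surplus at
        -- `c + 2`; only its corner can provide it, which gives `δ = 1`.
        second : ∀ {y y′} → 𝟙 (c ℕ.+ 2 ℕ.≟ c ℕ.+ S.d) ≡ y → 𝟙 (c ℕ.+ 2 ℕ.≟ γ ℕ.+ T.d) ≡ y′ → 0ℤ + y ≡ -1ℤ + (0ℤ + y′)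
        second e e′ = tails (c ℕ.+ 2) -1ℤ (balance-c (c ℕ.+ 2) 2 -1ℤ refl
          (r≡1 r≡1ℤ 2 (ℕ.≤-<-trans (ℕ.≤-trans (ℕ.<⇒≤ 3≤a) (ℕ.m≤n+m a c)) c<D)) 3≤a)
          (𝟙-no (c ℕ.+ 2 ℕ.≟ c) (λ e → ℕ.<⇒≢ (ℕ.m<m+n c (s≤s z≤n)) (sym e))) e
          (𝟙-no (c ℕ.+ 2 ℕ.≟ γ) (λ e → contradiction (ℕ.+-cancelˡ-≡ c 2 1 (trans e (sym c+1≡γ))) λ ())) e′
        δ≡1 : T.d ≡ 1
        δ≡1 = go (c ℕ.+ 2 ℕ.≟ c ℕ.+ S.d) (c ℕ.+ 2 ℕ.≟ γ ℕ.+ T.d) (second refl refl)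
          where
          go : (d₁ : Dec (c ℕ.+ 2 ≡ c ℕ.+ S.d)) (d₂ : Dec (c ℕ.+ 2 ≡ γ ℕ.+ T.d)) → 0ℤ + 𝟙 d₁ ≡ -1ℤ + (0ℤ + 𝟙 d₂) → T.d ≡
            1
          go (no _)  (yes e) _ = sym (ℕ.+-cancelˡ-≡ (c ℕ.+ 1) 1 T.d (trans (ℕ.+-assoc c 1 1)
            (trans e (cong (ℕ._+ T.d) (sym c+1≡γ)))))
          go (yes _) (yes _) ()
          go (no _)  (no _)  ()
          go (yes _) (no _)  ()
        s : ℕ
        s = β ℕ.∸ b
        β≡ : β ≡ b ℕ.+ s
        β≡ = sym (ℕ.m+[n∸m]≡n (ℕ.<⇒≤ b<β))
        a≡ : a ≡ b ℕ.+ s ℕ.+ 1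
        a≡ = trans a≡α (trans (sym T.b+d≡a) (cong₂ ℕ._+_ β≡ δ≡1))
        solution : b ≡ 1 × s ≡ 4
        solution = equalLeading b s (sym (ℕ.+-cancelˡ-≡ (4 ℕ.* ((b ℕ.+ s ℕ.+ 1) ℕ.* c)) _ _ (trans
          (subst₂ (λ k l → 4 ℕ.* (k ℕ.* c) ℕ.+ l ℕ.* l ≡ 4 ℕ.* (k ℕ.* γ) ℕ.+ b ℕ.* b) a≡ β≡ discriminants′)
          (trans (cong (λ k → 4 ℕ.* ((b ℕ.+ s ℕ.+ 1) ℕ.* k) ℕ.+ b ℕ.* b) (sym c+1≡γ)) (eq b s c)))))
          where
          eq : ∀ b s c → 4 ℕ.* ((b ℕ.+ s ℕ.+ 1) ℕ.* (c ℕ.+ 1)) ℕ.+ b ℕ.* b ≡ 4 ℕ.* ((b ℕ.+ s ℕ.+ 1) ℕ.* c) ℕ.+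
            (4 ℕ.* (b ℕ.+ s ℕ.+ 1) ℕ.+ b ℕ.* b)
          eq = ℕRing.solve-∀
        b≡1 : b ≡ 1
        b≡1 = proj₁ solution
        β≡5 : β ≡ 5
        β≡5 = trans β≡ (cong₂ ℕ._+_ b≡1 (proj₂ solution))
        a≡6 : a ≡ 6
        a≡6 = trans a≡ (cong₂ (λ k l → k ℕ.+ l ℕ.+ 1) b≡1 (proj₂ solution))
        D+1≡ : D ℕ.+ 1 ≡ 24 ℕ.* c
        D+1≡ = trans (subst₂ (λ k l → D ℕ.+ k ℕ.* k ≡ 4 ℕ.* (l ℕ.* c)) b≡1 a≡6 disc) (sym (ℕ.*-assoc 4 6 c))
        pair : SchoenebergPair D S.Q T.Q
        pair = subst₂ (SchoenebergPair D)
          (cong₂ (λ k l → form (+ k) (+ l) (+ c)) (sym a≡6) (sym b≡1))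
          (trans (cong₂ (λ k l → form (+ k) (+ l) (+ (c ℕ.+ 1))) (trans (sym a≡6) a≡α) (sym β≡5))
            (cong (λ k → form (+ α) (+ β) (+ k)) c+1≡γ))
          (schoenebergPair-generic D c D+1≡ (subst (ℕ._≤ c) a≡6 a≤c))

  -- Different leading coefficients

  module SmallerLeading (a<α : a ℕ.< α) where

    α≢1 : α ≢ 1
    α≢1 α≡1 = ℕ.<⇒≱ a<α (ℕ.≤-trans (ℕ.≤-reflexive α≡1) S.a≥1)

    β<α : β ℕ.< α
    β<α = T.b<a α≢1

    α<γ : α ℕ.< γ
    α<γ = T.a<c α≢1

    1≤δ : 1 ℕ.≤ T.d
    1≤δ = T.b<a⇒1≤d β<α

    window : 3 ℕ.* (α ℕ.* α) ℕ.+ 4 ℕ.* α ℕ.< D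
    window = discriminant-large p β<α α<γ T.b≥1 disc′

    4α<D : 4 ℕ.* α ℕ.< D
    4α<D = ℕ.≤-<-trans (ℕ.m≤n+m (4 ℕ.* α) (3 ℕ.* (α ℕ.* α))) window

    2≤α : 2 ℕ.≤ α
    2≤α = ℕ.≤-trans (s≤s S.a≥1) a<α

    20<D : 20 ℕ.< D
    20<D = ℕ.≤-<-trans (ℕ.+-mono-≤ (ℕ.*-monoʳ-≤ 3 (ℕ.*-mono-≤ 2≤α 2≤α)) (ℕ.*-monoʳ-≤ 4 2≤α)) window

    small<D : ∀ {j} → j ℕ.≤ 20 → j ℕ.< D
    small<D j≤20 = ℕ.≤-<-trans j≤20 20<D

    -- The number `a` is represented by the first form and lies below the minimum `α` of the second.
    m≡a : m ≡ a
    m≡a with ℕ.<-cmp a m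
    ... | tri< a<m _ _ = contradiction (T.rep≢0⇒a≤ S.a≥1 (λ e → S.rep≢0 (represents-a b≤a a≤c) (trans (low a a<m) e)))
      (ℕ.<⇒≱ a<α)
    ... | tri≈ _ e _   = sym e
    ... | tri> _ _ m<a = contradiction a≤m (ℕ.<⇒≱ m<a)

    a≡1⇒6≤c : a ≡ 1 → 6 ℕ.≤ c
    a≡1⇒6≤c a≡1 = ℕ.*-cancelˡ-< 4 5 c (ℕ.≤-trans (ℕ.≤-trans 20<D (ℕ.m≤m+n D (b ℕ.* b)))
      (ℕ.≤-reflexive (trans disc (cong (4 ℕ.*_) (trans (cong (ℕ._* c) a≡1) (ℕ.*-identityˡ c))))))

    a<c : a ℕ.< c
    a<c with a ℕ.≟ 1
    ... | yes a≡1 = ℕ.≤-trans (ℕ.≤-trans (ℕ.≤-reflexive (cong suc a≡1)) (s≤s (s≤s z≤n))) (a≡1⇒6≤c a≡1)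
    ... | no a≢1  = S.a<c a≢1

    -- c + d is beyond the reach of the first coefficients, also for the principal form, where d = 0.
    corner : ∀ k → k ℕ.≤ 4 → a ℕ.+ k ℕ.≤ c → a ℕ.+ k ℕ.< c ℕ.+ S.d
    corner k k≤4 a+k≤c with a ℕ.≟ 1
    ... | yes a≡1 = ℕ.≤-trans (s≤s (ℕ.≤-trans (ℕ.+-mono-≤ (ℕ.≤-reflexive a≡1) k≤4) ℕ.≤-refl)) (ℕ.≤-trans (a≡1⇒6≤c a≡1)
      (ℕ.m≤m+n c S.d))
    ... | no a≢1  = ℕ.≤-trans (s≤s a+k≤c) (ℕ.≤-trans (ℕ.≤-reflexive (ℕ.+-comm 1 c))
      (ℕ.+-monoʳ-≤ c (S.b<a⇒1≤d (S.b<a a≢1))))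

    -- Strictly between `a` and `a + D` both forms represent the same numbers, and values are
    -- carried from one to the other in turn: `4a` gives `α ≤ 4a`, `α` gives `α = 4a`, `γ` gives
    -- `γ ≥ 9a`, and `9a` gives `γ ≤ 9a`. The corner `γ + δ` then lies strictly between the
    -- consecutive axis values `9a` and `16a` of the first form, and below `13a`, while `c` exceeds
    -- `13a`.
    module NoFirstCoefficient (r≡0ℤ : r ≡ 0ℤ) where

      same : ∀ n → a ℕ.< n → n ℕ.< a ℕ.+ D → S.rep n ≡ T.rep n
      same n a<n n<a+D with j , refl ← slack (ℕ.<⇒≤ a<n) = ℤ.+-injective
        (trans (minus⇒plus {+ S.rep (a ℕ.+ j)} (subst (λ k → + S.rep (k ℕ.+ j) - + T.rep (k ℕ.+ j) ≡ + 2 * f j) m≡a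
        (expansion j j<D)))
        (trans (cong (λ z → + 2 * z + + T.rep (a ℕ.+ j)) (r≡0 r≡0ℤ j 0<j j<D)) (ℤ.+-identityˡ (+ T.rep (a ℕ.+ j)))))
        where
        0<j : 0 ℕ.< j
        0<j = ℕ.+-cancelˡ-< a 0 j (subst (ℕ._< a ℕ.+ j) (sym (ℕ.+-identityʳ a)) a<n)
        j<D : j ℕ.< D
        j<D = ℕ.+-cancelˡ-< a j D n<a+D

      S⇒T : ∀ {n} → a ℕ.< n → n ℕ.< a ℕ.+ D → Represents S.Q n → Represents T.Q n
      S⇒T {n} p q R = T.rep≢0⇒ (λ e → S.rep≢0 R (trans (same n p q) e))

      T⇒S : ∀ {n} → a ℕ.< n → n ℕ.< a ℕ.+ D → Represents T.Q n → Represents S.Q n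
      T⇒S {n} p q R = S.rep≢0⇒ (λ e → T.rep≢0 R (trans (sym (same n p q)) e))

      valuesS : ∀ n → Represents S.Q n → (∃[ X ] a ℕ.* (X ℕ.* X) ≡ n) ⊎ c ≡ n ⊎ c ℕ.+ S.d ℕ.≤ n
      valuesS = represented b≤a a≤c S.d S.b+d≡a

      valuesT : ∀ n → Represents T.Q n → (∃[ X ] α ℕ.* (X ℕ.* X) ≡ n) ⊎ γ ≡ n ⊎ γ ℕ.+ T.d ℕ.≤ n
      valuesT = represented β≤α α≤γ T.d T.b+d≡a

      c≤ : ∀ {n} → c ≡ n ⊎ c ℕ.+ S.d ℕ.≤ n → c ℕ.≤ n
      c≤ (inj₁ refl) = ℕ.≤-refl
      c≤ (inj₂ le)   = ℕ.m+n≤o⇒m≤o c le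

      γ<D : γ ℕ.< D
      γ<D = ℕ.+-cancelʳ-< (β ℕ.* β) γ D (subst (γ ℕ.+ β ℕ.* β ℕ.<_) (sym disc′) (ℕ.<-≤-trans
        (ℕ.+-monoʳ-< γ (ℕ.<-≤-trans (ℕ.*-mono-< β<α β<α) (ℕ.*-monoʳ-≤ α α≤γ)))
        (ℕ.+-mono-≤ (ℕ.m≤n*m γ α {{T.a≢0}}) (ℕ.m≤m+n (α ℕ.* γ) _))))

      a<γ : a ℕ.< γ
      a<γ = ℕ.<-trans a<α α<γ

      γ-represented : Represents S.Q γ
      γ-represented = T⇒S a<γ (ℕ.<-≤-trans γ<D (ℕ.m≤n+m D a)) (represents-c β≤α α≤γ)

      a<k*a : ∀ k → a ℕ.< a ℕ.* suc (suc k)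
      a<k*a k = ℕ.m<m*n a (suc (suc k)) {{S.a≢0}} (s≤s (s≤s z≤n))

      α≤4a : α ℕ.≤ 4 ℕ.* a
      α≤4a = subst (α ℕ.≤_) (ℕ.*-comm a 4) (represented≥a β≤α α≤γ (a ℕ.* 4) (ℕ.≤-<-trans z≤n (a<k*a 2))
        (S⇒T (a<k*a 2) (ℕ.≤-<-trans (ℕ.≤-trans (ℕ.≤-reflexive (ℕ.*-comm a 4)) (ℕ.*-monoʳ-≤ 4 (ℕ.<⇒≤ a<α)))
          (ℕ.<-≤-trans 4α<D (ℕ.m≤n+m D a))) (represents-axis b≤a a≤c 2)))

      -- The second form represents `c`, so `c ≤ α` means `c = α`. Then `γ`, represented by the
      -- first form, is an axis value beyond `a` or at least `c + d`, as `γ > α = c`; `gap-0` and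
      -- `gap-1` exclude both.
      c≰α : ¬ c ℕ.≤ α
      c≰α c≤α = go (valuesS γ γ-represented)
        where
        α≤c : α ℕ.≤ c
        α≤c = represented≥a β≤α α≤γ c S.c≥1 (S⇒T a<c (ℕ.≤-<-trans (ℕ.≤-trans c≤α (ℕ.m≤n*m α 4))
          (ℕ.<-≤-trans 4α<D (ℕ.m≤n+m D a))) (represents-c b≤a a≤c))
        c≡α : c ≡ α
        c≡α = ℕ.≤-antisym c≤α α≤c
        disc″ : 4 ℕ.* (a ℕ.* α) ℕ.+ β ℕ.* β ≡ 4 ℕ.* (α ℕ.* γ) ℕ.+ b ℕ.* b
        disc″ = subst (λ k → 4 ℕ.* (a ℕ.* k) ℕ.+ β ℕ.* β ≡ 4 ℕ.* (α ℕ.* γ) ℕ.+ b ℕ.* b) c≡α discriminants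
        go : _ → ⊥
        go (inj₁ (X , e))   = gap-0 {a} {b} {α} {β} {γ} disc″ β<α α≤4a (square-≥2 a γ X a<γ e)
        go (inj₂ (inj₁ e))  = ℕ.<⇒≢ α<γ (trans (sym c≡α) e)
        go (inj₂ (inj₂ le)) = gap-1 {b} {S.d} {α} {β} {γ} (subst (λ k → 4 ℕ.* (k ℕ.* α) ℕ.+ β ℕ.* β ≡ 4 ℕ.* (α ℕ.* γ)
          ℕ.+ b ℕ.* b) (sym S.b+d≡a) disc″) β<α
          (ℕ.≤-trans b≤a (ℕ.<⇒≤ a<α)) (subst (λ k → k ℕ.+ S.d ℕ.≤ γ) c≡α le)

      α≡4a : α ≡ 4 ℕ.* a
      α≡4a = [ (λ (X , e) → ℕ.≤-antisym α≤4a (square-≥2 a α X a<α e)) , (λ le → contradiction (c≤ le) c≰α) ]′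
        (valuesS α (T⇒S a<α (ℕ.<-≤-trans (ℕ.≤-<-trans (ℕ.m≤n*m α 4) 4α<D) (ℕ.m≤n+m D a)) (represents-a β≤α α≤γ)))

      4a<c : 4 ℕ.* a ℕ.< c
      4a<c = subst (ℕ._< c) α≡4a (ℕ.≰⇒> c≰α)

      β<4a : β ℕ.< 4 ℕ.* a
      β<4a = subst (β ℕ.<_) α≡4a β<α

      disc‴ : 4 ℕ.* (a ℕ.* c) ℕ.+ β ℕ.* β ≡ 4 ℕ.* (4 ℕ.* a ℕ.* γ) ℕ.+ b ℕ.* b
      disc‴ = trans discriminants (cong (λ k → 4 ℕ.* (k ℕ.* γ) ℕ.+ b ℕ.* b) α≡4a)

      16a<D : 4 ℕ.* (4 ℕ.* a) ℕ.< D
      16a<D = subst (λ k → 4 ℕ.* k ℕ.< D) α≡4a 4α<D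

      9a≤γ : 9 ℕ.* a ℕ.≤ γ
      9a≤γ = [ (λ (X , e) → square-≥3 a γ X (subst (ℕ._< γ) α≡4a α<γ) e) , (λ le → contradiction (c≤ le)
        (gap-2 {a} {b} {c} {β} {γ} disc‴ β<4a 4a<c)) ]′
        (valuesS γ γ-represented)

      9a-represented : Represents T.Q (a ℕ.* 9)
      9a-represented = S⇒T (a<k*a 7) (ℕ.<-≤-trans (ℕ.≤-<-trans (≤-slack (7 ℕ.* a) (eq a)) 16a<D) (ℕ.m≤n+m D a))
        (represents-axis b≤a a≤c 3)
        where
        eq : ∀ a → 4 ℕ.* (4 ℕ.* a) ≡ a ℕ.* 9 ℕ.+ 7 ℕ.* a
        eq = ℕRing.solve-∀

      γ≤9a : γ ℕ.≤ 9 ℕ.* a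
      -- The number `9a` is not on the axis of the second form, since `4X² = 9` fails by parity.
      γ≤9a = [ (λ (X , e) → contradiction (ℕ.*-cancelˡ-≡ (2 ℕ.* (2 ℕ.* (X ℕ.* X))) 9 a {{S.a≢0}}
                 (trans (eq a (X ℕ.* X)) (trans (cong (ℕ._* (X ℕ.* X)) (sym α≡4a)) e))) (ℕ.even≢odd (2 ℕ.* (X ℕ.* X))
                   4)) ,
               [ (λ e → ℕ.≤-reflexive (trans e (ℕ.*-comm a 9))) , (λ le → ℕ.≤-trans (ℕ.m+n≤o⇒m≤o γ le)
                 (ℕ.≤-reflexive (ℕ.*-comm a 9))) ]′ ]′
        (valuesT (a ℕ.* 9) 9a-represented)
        where
        eq : ∀ a s → a ℕ.* (2 ℕ.* (2 ℕ.* s)) ≡ 4 ℕ.* a ℕ.* s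
        eq = ℕRing.solve-∀

      γ≡9a : γ ≡ 9 ℕ.* a
      γ≡9a = ℕ.≤-antisym γ≤9a 9a≤γ

      γ+δ<13a : γ ℕ.+ T.d ℕ.< 13 ℕ.* a
      γ+δ<13a = ℕ.≤-trans (ℕ.+-mono-≤-< γ≤9a (subst (T.d ℕ.<_) α≡4a T.d<a)) (ℕ.≤-reflexive (sym (ℕ.*-distribʳ-+ a 9 4)))

      impossible : ⊥
      impossible = [ (λ (X , e) → ℕ.<⇒≱ γ+δ<13a (ℕ.≤-trans (ℕ.*-monoˡ-≤ a (ℕ.m≤m+n 13 3)) (square-≥4 a (γ ℕ.+ T.d) X
        (ℕ.≤-<-trans 9a≤γ (ℕ.m<m+n γ 1≤δ)) e))) ,
                     (λ le → gap-3 {a} {b} {c} {β} (trans disc‴ (cong (λ k → 4 ℕ.* (4 ℕ.* a ℕ.* k) ℕ.+ b ℕ.* b) γ≡9a))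
                       β<4a (ℕ.≤-trans (c≤ le) (ℕ.<⇒≤ γ+δ<13a))) ]′
        (valuesS (γ ℕ.+ T.d) (T⇒S (ℕ.<-≤-trans a<γ (ℕ.m≤m+n γ T.d))
          (ℕ.<-≤-trans (ℕ.<-trans γ+δ<13a (ℕ.≤-<-trans (≤-slack (3 ℕ.* a) (eq a)) 16a<D)) (ℕ.m≤n+m D a))
            (represents-corner β≤α α≤γ T.d T.b+d≡a)))
        where
        eq : ∀ a → 4 ℕ.* (4 ℕ.* a) ≡ 13 ℕ.* a ℕ.+ 3 ℕ.* a
        eq = ℕRing.solve-∀

    no< : ∀ {n k} → n ℕ.< k → 𝟙 (n ℕ.≟ k) ≡ 0ℤ
    no< {n} {k} n<k = 𝟙-no (n ℕ.≟ k) (ℕ.<⇒≢ n<k)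

    values : ∀ j z {s x y s′ x′ y′} → Range (a ℕ.+ j) → j ℕ.≤ 20 → f j ≡ z →
      axisCount a (a ℕ.+ j) ≡ s → 𝟙 (a ℕ.+ j ℕ.≟ c) ≡ x → 𝟙 (a ℕ.+ j ℕ.≟ c ℕ.+ S.d) ≡ y →
      axisCount α (a ℕ.+ j) ≡ s′ → 𝟙 (a ℕ.+ j ℕ.≟ γ) ≡ x′ → 𝟙 (a ℕ.+ j ℕ.≟ γ ℕ.+ T.d) ≡ y′ → s + x + y ≡ z +
        (s′ + x′ + y′)
    values j z range j≤20 refl refl refl refl refl refl refl = balance (a ℕ.+ j) j (cong (ℕ._+ j) (sym m≡a))
      (small<D j≤20) range

    a<a+ : ∀ j → a ℕ.< a ℕ.+ suc j
    a<a+ j = ℕ.m<m+n a (s≤s z≤n)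

    axisS : ∀ j → suc j ℕ.< 3 ℕ.* a → axisCount a (a ℕ.+ suc j) ≡ 0ℤ
    axisS j j<3a = axisCount-none a (a ℕ.+ suc j) (axis-gap a (a ℕ.+ suc j) (a<a+ j) (ℕ.+-monoʳ-< a j<3a))

    firstRange : Range (a ℕ.+ 1)
    firstRange = ℕ.<-≤-trans S.a≥1 (ℕ.m≤m+n a 1) ,
      (ℕ.≤-trans (ℕ.≤-reflexive (trans (cong suc (ℕ.+-comm a 1)) (ℕ.+-comm 2 a)))
        (ℕ.≤-trans (ℕ.+-monoʳ-≤ a (ℕ.+-mono-≤ S.b≥1 S.c≥1)) (ℕ.≤-reflexive (sym (ℕ.+-assoc a b c)))) ,
       ℕ.≤-trans (s≤s (ℕ.≤-trans (ℕ.≤-reflexive (ℕ.+-comm a 1)) a<c)) S.c<3c) ,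
      (ℕ.≤-<-trans (ℕ.≤-trans (ℕ.≤-reflexive (ℕ.+-comm a 1)) (ℕ.≤-trans a<α α≤γ)) T.c<a+b+c ,
       ℕ.≤-<-trans (ℕ.≤-trans (ℕ.≤-reflexive (ℕ.+-comm a 1)) (ℕ.≤-trans a<α α≤γ)) T.c<3c)

    -- Only `±e₂` of the first form and `±e₁` of the second can have the value `a + 1`. Hence `r` is
    -- 0, 1 or -1.
    first : ∀ x s′ → 𝟙 (a ℕ.+ 1 ℕ.≟ c) ≡ x → axisCount α (a ℕ.+ 1) ≡ s′ → r ≡ s′ - x
    first x s′ e e′ = solveFor r x s′ (values 1 (- r) firstRange (s≤s z≤n) (f₁ (small<D (s≤s z≤n)))
      (axisS 0 (ℕ.≤-trans (s≤s (s≤s z≤n)) (ℕ.*-monoʳ-≤ 3 S.a≥1))) e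
      (no< (corner 1 (s≤s z≤n) (ℕ.≤-trans (ℕ.≤-reflexive (ℕ.+-comm a 1)) a<c))) e′ (no< a+1<γ)
        (no< (ℕ.≤-trans a+1<γ (ℕ.m≤m+n γ T.d))))
      where
      a+1<γ : a ℕ.+ 1 ℕ.< γ
      a+1<γ = ℕ.≤-<-trans (ℕ.≤-trans (ℕ.≤-reflexive (ℕ.+-comm a 1)) a<α) α<γ
      solveFor : ∀ r x s → 0ℤ + x + 0ℤ ≡ - r + (s + 0ℤ + 0ℤ) → r ≡ s - x
      solveFor r x s e = trans (id₁ r s) (trans (cong (λ z → s - z) (sym e)) (id₂ s x))
        where
        id₁ : ∀ r s → r ≡ s - (- r + (s + 0ℤ + 0ℤ))
        id₁ = ℤRing.solve-∀
        id₂ : ∀ s x → s - (0ℤ + x + 0ℤ) ≡ s - x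
        id₂ = ℤRing.solve-∀

    axis-yes : a ℕ.+ 1 ≡ α → axisCount α (a ℕ.+ 1) ≡ 1ℤ
    axis-yes e = trans (cong (axisCount α) e) (axisCount-self α {{T.a≢0}})

    axis-no : a ℕ.+ 1 ≢ α → axisCount α (a ℕ.+ 1) ≡ 0ℤ
    axis-no ne = axisCount-none α (a ℕ.+ 1) (axis-below α (a ℕ.+ 1) (ℕ.<-≤-trans S.a≥1 (ℕ.m≤m+n a 1))
      (ℕ.≤∧≢⇒< (ℕ.≤-trans (ℕ.≤-reflexive (ℕ.+-comm a 1)) a<α) ne))

    -- The coefficient 2 of `q²` demands at least four representations of `a + 2` by the first form.
    -- With `c = a + 1` only the corner is available, and it gives at most two.
    negativeExponent : r ≡ -1ℤ → a ℕ.+ 1 ≡ c → ⊥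
    negativeExponent r≡ a+1≡c = go (a ℕ.+ 2 ℕ.≟ c ℕ.+ S.d) rep≡
      where
      a≢1 : a ≢ 1
      a≢1 a≡1 = ℕ.<⇒≱ (ℕ.≤-trans (s≤s (s≤s (s≤s z≤n))) (a≡1⇒6≤c a≡1))
        (ℕ.≤-reflexive (trans (sym a+1≡c) (cong (ℕ._+ 1) a≡1)))
      2≤a : 2 ℕ.≤ a
      2≤a = ℕ.≤∧≢⇒< S.a≥1 (λ e → a≢1 (sym e))
      0<n : 0 ℕ.< a ℕ.+ 2
      0<n = ℕ.<-≤-trans S.a≥1 (ℕ.m≤m+n a 2)
      3≤c : 3 ℕ.≤ c
      3≤c = ℕ.≤-trans (ℕ.+-monoˡ-≤ 1 2≤a) (ℕ.≤-reflexive a+1≡c)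
      n<abc : a ℕ.+ 2 ℕ.< a ℕ.+ b ℕ.+ c
      n<abc = ℕ.≤-trans (ℕ.+-monoʳ-< a (ℕ.≤-trans 3≤c (ℕ.m≤n+m c b))) (ℕ.≤-reflexive (sym (ℕ.+-assoc a b c)))
      n<3c : a ℕ.+ 2 ℕ.< 3 ℕ.* c
      n<3c = ℕ.≤-trans (ℕ.+-mono-≤-< (ℕ.<⇒≤ a<c) 3≤c) (ℕ.+-monoʳ-≤ c (ℕ.m≤m+n c (c ℕ.+ 0)))
      2<3a : 2 ℕ.< 3 ℕ.* a
      2<3a = ℕ.≤-trans (s≤s (s≤s (s≤s z≤n))) (ℕ.*-monoʳ-≤ 3 2≤a)
      rep≡ : + 2 * (0ℤ + 0ℤ + 𝟙 (a ℕ.+ 2 ℕ.≟ c ℕ.+ S.d)) ≡ + (4 ℕ.+ T.rep (a ℕ.+ 2))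
      rep≡ = trans (sym (trans (shortRepresentations b≤a a≤c S.d S.b+d≡a {{S.a≢0}} S.pd (a ℕ.+ 2) 0<n n<abc n<3c)
          (cong₂ (λ s x → + 2 * (s + x + 𝟙 (a ℕ.+ 2 ℕ.≟ c ℕ.+ S.d))) (axisS 1 2<3a)
            (𝟙-no (a ℕ.+ 2 ℕ.≟ c) (λ e → contradiction (ℕ.+-cancelˡ-≡ a 2 1 (trans e (sym a+1≡c))) λ ())))))
        (trans (minus⇒plus {+ S.rep (a ℕ.+ 2)} (subst (λ k → + S.rep (k ℕ.+ 2) - + T.rep (k ℕ.+ 2) ≡ + 2 * f 2) m≡a
          (expansion 2 (small<D (s≤s (s≤s z≤n))))))
          (trans (cong (λ z → + 2 * z + + T.rep (a ℕ.+ 2)) (r≡-1 r≡ (small<D (s≤s (s≤s z≤n)))))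
            (sym (ℤ.pos-+ 4 (T.rep (a ℕ.+ 2))))))
      go : ∀ d → + 2 * (0ℤ + 0ℤ + 𝟙 d) ≡ + (4 ℕ.+ T.rep (a ℕ.+ 2)) → ⊥
      go (yes _) e = contradiction (ℤ.+-injective e) λ ()
      go (no _)  e = contradiction (ℤ.+-injective e) λ ()

    module FirstCoefficient (r≡1ℤ : r ≡ 1ℤ) (a+1≡α : a ℕ.+ 1 ≡ α) (a+1≢c : a ℕ.+ 1 ≢ c) where

      a+1<a+2 : suc (a ℕ.+ 1) ≡ a ℕ.+ 2
      a+1<a+2 = sym (ℕ.+-suc a 1)

      a+2≤c : a ℕ.+ 2 ℕ.≤ c
      a+2≤c = ℕ.≤-trans (ℕ.≤-reflexive (sym a+1<a+2)) (ℕ.≤∧≢⇒< (ℕ.≤-trans (ℕ.≤-reflexive (ℕ.+-comm a 1)) a<c) a+1≢c)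

      a+2≤γ : a ℕ.+ 2 ℕ.≤ γ
      a+2≤γ = ℕ.≤-trans (ℕ.≤-reflexive (trans (sym a+1<a+2) (cong suc a+1≡α))) α<γ

      fj : ∀ j → j ℕ.≤ 20 → f j ≡ euler j
      fj j j≤20 = r≡1 r≡1ℤ j (small<D j≤20)

      axisT : ∀ j → suc j ℕ.< 3 ℕ.* α → axisCount α (a ℕ.+ suc (suc j)) ≡ 0ℤ
      axisT j j<3α = trans (cong (axisCount α) (trans (sym (ℕ.+-assoc a 1 (suc j))) (cong (ℕ._+ suc j) a+1≡α)))
        (axisCount-none α (α ℕ.+ suc j) (axis-gap α (α ℕ.+ suc j) (ℕ.m<m+n α (s≤s z≤n)) (ℕ.+-monoʳ-< α j<3α)))

      secondRange : Range (a ℕ.+ 2)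
      secondRange = ℕ.<-≤-trans S.a≥1 (ℕ.m≤m+n a 2) ,
        (ℕ.≤-<-trans a+2≤c S.c<a+b+c , ℕ.≤-<-trans a+2≤c S.c<3c) ,
        (ℕ.≤-<-trans a+2≤γ T.c<a+b+c , ℕ.≤-<-trans a+2≤γ T.c<3c)

      -- The coefficient -1 of `q²` needs a surplus of the second form at `a + 2`, so this number is
      -- `γ` and not `c`.
      second : 0ℤ + 𝟙 (a ℕ.+ 2 ℕ.≟ c) + 0ℤ ≡ -1ℤ + (0ℤ + 𝟙 (a ℕ.+ 2 ℕ.≟ γ) + 0ℤ)
      second = values 2 -1ℤ secondRange (s≤s (s≤s z≤n)) (fj 2 (s≤s (s≤s z≤n))) (axisS 1 (ℕ.*-monoʳ-≤ 3 S.a≥1)) refl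
        (no< (corner 2 (s≤s (s≤s z≤n)) a+2≤c)) (axisT 0 (ℕ.≤-trans (s≤s (s≤s z≤n)) (ℕ.*-monoʳ-≤ 3 T.a≥1))) refl
          (no< (ℕ.≤-<-trans a+2≤γ (ℕ.m<m+n γ 1≤δ)))

      γ≡a+2×c≢a+2 : γ ≡ a ℕ.+ 2 × c ≢ a ℕ.+ 2
      γ≡a+2×c≢a+2 = go (a ℕ.+ 2 ℕ.≟ c) (a ℕ.+ 2 ℕ.≟ γ) second
        where
        go : (d₁ : Dec (a ℕ.+ 2 ≡ c)) (d₂ : Dec (a ℕ.+ 2 ≡ γ)) → 0ℤ + 𝟙 d₁ + 0ℤ ≡ -1ℤ + (0ℤ + 𝟙 d₂ + 0ℤ) → γ ≡ a ℕ.+ 2 ×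
          c ≢ a ℕ.+ 2
        go (no ne) (yes e) _ = sym e , λ e′ → ne (sym e′)
        go (yes _) (yes _) ()
        go (yes _) (no _)  ()
        go (no _)  (no _)  ()

      γ≡ : γ ≡ a ℕ.+ 2
      γ≡ = proj₁ γ≡a+2×c≢a+2

      a+3≤c : a ℕ.+ 3 ℕ.≤ c
      a+3≤c = ℕ.≤-trans (ℕ.≤-reflexive (ℕ.+-suc a 2)) (ℕ.≤∧≢⇒< a+2≤c (λ e → proj₂ γ≡a+2×c≢a+2 (sym e)))

      β≤a : β ℕ.≤ a
      β≤a = ℕ.s≤s⁻¹ (ℕ.≤-trans β<α (ℕ.≤-reflexive (trans (sym a+1≡α) (ℕ.+-comm a 1))))

      small : a ℕ.≤ 3 → Conclusion
      small a≤3 with D+1≡ , pair ← smallPair p a b c β S.a≥1 a≤3 S.b≥1 b≤a (b≡a⇒a≡1 p b≤a a≤c disc) T.b≥1 β≤a disc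
          (trans disc′ (cong₂ (λ k l → 4 ℕ.* (k ℕ.* l)) (sym a+1≡α) γ≡)) =
        r≡1ℤ , trans D+1≡ (cong (24 ℕ.*_) (sym m≡a)) ,
        subst (λ Q → SchoenebergPair D S.Q Q) (cong₂ (λ k l → form (+ k) (+ β) (+ l)) a+1≡α (sym γ≡)) pair

      -- For `a ≥ 4` the numbers `a + 3, ..., a + 7` are off both axes, and the coefficients 0, 0,
      -- 1, 0, 1 of `∏(1 - q^n)` are balanced by `c`, `c + d` and `γ + δ` alone. At 3 and 4, `c` and
      -- `γ + δ` can only occur together, which `consecutive-0` and `consecutive-1` refute. At 5
      -- this leaves `c = a + 5` and `δ > 3`; at 6, `d = 1` goes with `δ = 4`, refuted by
      -- `consecutive-2-1`; at 7 it leaves `d = 2` and `δ ≥ 6`, the case of `lastCandidates`.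
      module Large (4≤a : 4 ℕ.≤ a) where

        1≤d : 1 ℕ.≤ S.d
        1≤d = S.b<a⇒1≤d (S.b<a (λ a≡1 → ℕ.<⇒≱ (ℕ.≤-trans (s≤s (s≤s z≤n)) 4≤a) (ℕ.≤-reflexive a≡1)))

        module _ {j : ℕ} (3≤j : 3 ℕ.≤ j) (j≤7 : j ℕ.≤ 7) where

          later<3a : ∀ {k} → k ℕ.≤ 7 → k ℕ.< 3 ℕ.* a
          later<3a k≤7 = ℕ.≤-trans (s≤s k≤7) (ℕ.≤-trans (ℕ.m≤m+n 8 4) (ℕ.*-monoʳ-≤ 3 4≤a))

          laterRange : Range (a ℕ.+ j)
          laterRange = ℕ.<-≤-trans S.a≥1 (ℕ.m≤m+n a j) ,
            (ℕ.≤-trans (ℕ.+-monoʳ-< a (s≤s j≤7)) (ℕ.≤-trans (ℕ.+-monoʳ-≤ a (ℕ.+-mono-≤ S.b≥1 7≤c))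
              (ℕ.≤-reflexive (sym (ℕ.+-assoc a b c)))) , below c 4≤c a+2≤c) ,
            (ℕ.≤-trans (ℕ.+-monoʳ-< a (s≤s j≤7)) (ℕ.≤-trans (ℕ.≤-reflexive (eq a)) (ℕ.+-mono-≤ (ℕ.+-mono-≤ 5≤α T.b≥1)
              a+2≤γ)) , below γ 4≤γ a+2≤γ)
            where
            7≤c : 7 ℕ.≤ c
            7≤c = ℕ.≤-trans (ℕ.+-monoˡ-≤ 3 4≤a) a+3≤c
            4≤c : 4 ℕ.≤ c
            4≤c = ℕ.≤-trans (ℕ.m≤m+n 4 3) 7≤c
            4≤γ : 4 ℕ.≤ γ
            4≤γ = ℕ.≤-trans 4≤a (ℕ.≤-trans (ℕ.m≤m+n a 2) a+2≤γ)
            5≤α : 5 ℕ.≤ α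
            5≤α = ℕ.≤-trans (s≤s 4≤a) a<α
            eq : ∀ a → a ℕ.+ 8 ≡ 5 ℕ.+ 1 ℕ.+ (a ℕ.+ 2)
            eq = ℕRing.solve-∀
            below : ∀ k → 4 ℕ.≤ k → a ℕ.+ 2 ℕ.≤ k → a ℕ.+ j ℕ.< 3 ℕ.* k
            below k 4≤k a+2≤k = ℕ.≤-trans (ℕ.+-monoʳ-< a (s≤s j≤7)) (ℕ.≤-trans (≤-slack 2 (eq′ a))
              (ℕ.+-mono-≤ a+2≤k (ℕ.+-mono-≤ 4≤k (ℕ.+-monoˡ-≤ 0 4≤k))))
              where
              eq′ : ∀ a → a ℕ.+ 2 ℕ.+ (4 ℕ.+ (4 ℕ.+ 0)) ≡ a ℕ.+ 8 ℕ.+ 2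
              eq′ = ℕRing.solve-∀

          later : ∀ z → euler j ≡ z → ∀ {y} → 𝟙 (a ℕ.+ j ℕ.≟ c ℕ.+ S.d) ≡ y → 0ℤ + 𝟙 (a ℕ.+ j ℕ.≟ c) + y ≡ z +
            (0ℤ + 0ℤ + 𝟙 (a ℕ.+ j ℕ.≟ γ ℕ.+ T.d))
          later z e {y} corner = go j refl 3≤j
            where
            go : ∀ i → i ≡ j → 3 ℕ.≤ i → 0ℤ + 𝟙 (a ℕ.+ j ℕ.≟ c) + y ≡ z + (0ℤ + 0ℤ + 𝟙 (a ℕ.+ j ℕ.≟ γ ℕ.+ T.d))
            go 1 _ (s≤s ())
            go (suc (suc i)) refl 3≤i = values j z laterRange (ℕ.≤-trans j≤7 (ℕ.m≤m+n 7 13))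
              (trans (fj j (ℕ.≤-trans j≤7 (ℕ.m≤m+n 7 13))) e)
              (axisS (suc i) (later<3a j≤7)) refl corner
              (axisT i (ℕ.<-trans (later<3a (ℕ.≤-trans (ℕ.n≤1+n (suc i)) j≤7)) (ℕ.*-monoʳ-< 3 a<α)))
              (𝟙-no (a ℕ.+ j ℕ.≟ γ) (λ e → ℕ.<⇒≢ (ℕ.+-monoʳ-< a 3≤i) (sym (trans e γ≡)))) refl

        next : ∀ {j} → a ℕ.+ j ℕ.≤ c → a ℕ.+ j ≢ c → a ℕ.+ suc j ℕ.≤ c
        next {j} le ne = ℕ.≤-trans (ℕ.≤-reflexive (ℕ.+-suc a j)) (ℕ.≤∧≢⇒< le ne)

        beforeCorner : ∀ {j} → a ℕ.+ j ℕ.≤ c → 𝟙 (a ℕ.+ j ℕ.≟ c ℕ.+ S.d) ≡ 0ℤ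
        beforeCorner a+j≤c = no< (ℕ.≤-<-trans a+j≤c (ℕ.m<m+n c 1≤d))

        δ-at : ∀ {j} → a ℕ.+ (2 ℕ.+ j) ≡ γ ℕ.+ T.d → T.d ≡ j
        δ-at {j} e = sym (ℕ.+-cancelˡ-≡ (a ℕ.+ 2) j T.d (trans (ℕ.+-assoc a 2 j) (trans e (cong (ℕ._+ T.d) γ≡))))

        δ-not : ∀ {j} → a ℕ.+ (2 ℕ.+ j) ≢ γ ℕ.+ T.d → T.d ≢ j
        δ-not {j} ne e = ne (trans (sym (ℕ.+-assoc a 2 j)) (cong₂ ℕ._+_ (sym γ≡) (sym e)))

        leading : ∀ {t} → c ≡ a ℕ.+ (3 ℕ.+ t) → ConsecutiveLeading b S.d t β
        leading {t} e = ℕ.+-cancelˡ-≡ (4 ℕ.* (a ℕ.* (a ℕ.+ 3))) _ _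
          (trans (cong (λ k → 4 ℕ.* (a ℕ.* (a ℕ.+ 3)) ℕ.+ (4 ℕ.* (k ℕ.* t) ℕ.+ β ℕ.* β)) S.b+d≡a)
          (trans (eq₁ a t (β ℕ.* β)) (trans (cong (λ k → 4 ℕ.* (a ℕ.* k) ℕ.+ β ℕ.* β) (sym e))
            (trans discriminants (trans (cong₂ (λ k l → 4 ℕ.* (k ℕ.* l) ℕ.+ b ℕ.* b) (sym a+1≡α) γ≡)
              (eq₂ a (b ℕ.* b)))))))
          where
          eq₁ : ∀ a t s → 4 ℕ.* (a ℕ.* (a ℕ.+ 3)) ℕ.+ (4 ℕ.* (a ℕ.* t) ℕ.+ s) ≡ 4 ℕ.* (a ℕ.* (a ℕ.+ (3 ℕ.+ t))) ℕ.+ s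
          eq₁ = ℕRing.solve-∀
          eq₂ : ∀ a s → 4 ℕ.* ((a ℕ.+ 1) ℕ.* (a ℕ.+ 2)) ℕ.+ s ≡ 4 ℕ.* (a ℕ.* (a ℕ.+ 3)) ℕ.+ (s ℕ.+ 8)
          eq₂ = ℕRing.solve-∀

        β+δ : β ℕ.+ T.d ≡ b ℕ.+ S.d ℕ.+ 1
        β+δ = trans T.b+d≡a (trans (sym a+1≡α) (cong (ℕ._+ 1) (sym S.b+d≡a)))

        4≤b+d : 4 ℕ.≤ b ℕ.+ S.d
        4≤b+d = ℕ.≤-trans 4≤a (ℕ.≤-reflexive (sym S.b+d≡a))

        third : c ≡ a ℕ.+ 3 → T.d ≡ 1 → ⊥
        third e δ≡ = consecutive-0 b S.d 1≤d 4≤b+d S.b≥1 (subst (ConsecutiveLeading b S.d 0)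
          (ℕ.+-cancelʳ-≡ 1 β (b ℕ.+ S.d) (trans (cong (β ℕ.+_) (sym δ≡)) β+δ)) (leading e))

        fourth : c ≡ a ℕ.+ 4 → T.d ≡ 2 → ⊥
        fourth e δ≡ = go S.d 1≤d β+δ 4≤b+d (leading e)
          where
          go : ∀ d → 1 ℕ.≤ d → β ℕ.+ T.d ≡ b ℕ.+ d ℕ.+ 1 → 4 ℕ.≤ b ℕ.+ d → ¬ ConsecutiveLeading b d 1 β
          go (suc d) _ e′ 4≤ l = consecutive-1 b d (ℕ.s≤s⁻¹ (ℕ.≤-trans 4≤ (ℕ.≤-reflexive (ℕ.+-suc b d))))
            (subst (ConsecutiveLeading b (suc d) 1) (ℕ.+-cancelʳ-≡ 2 β (b ℕ.+ d) (trans (cong (β ℕ.+_) (sym δ≡))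
              (trans e′ (eq b d)))) l)
            where
            eq : ∀ b d → b ℕ.+ suc d ℕ.+ 1 ≡ b ℕ.+ d ℕ.+ 2
            eq = ℕRing.solve-∀

        sixth : c ≡ a ℕ.+ 5 → S.d ≡ 1 → T.d ≡ 4 → ⊥
        sixth e d≡ δ≡ = consecutive-2-1 β (subst₂ (λ k l → ConsecutiveLeading k l 2 β)
          (ℕ.+-cancelʳ-≡ 2 b (β ℕ.+ 2) (trans
            (sym (trans β+δ (trans (cong (λ k → b ℕ.+ k ℕ.+ 1) d≡) (ℕ.+-assoc b 1 1)))) (trans (cong (β ℕ.+_) δ≡)
            (sym (ℕ.+-assoc β 2 2))))) d≡ (leading e))

        seventh : c ≡ a ℕ.+ 5 → S.d ≡ 2 → 6 ℕ.≤ T.d → ⊥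
        seventh e d≡ 6≤δ with k , δ≡ ← slack 6≤δ = lastCandidates p β (3 ℕ.+ k) (ℕ.m≤m+n 3 k)
          (subst₂ (λ x y → D ℕ.+ x ℕ.* x ≡ 4 ℕ.* (y ℕ.* (y ℕ.+ 5))) b≡ (trans (sym S.b+d≡a) (cong₂ ℕ._+_ b≡ d≡))
            (trans disc (cong (λ z → 4 ℕ.* (a ℕ.* z)) e)))
          (subst₂ (λ x y → ConsecutiveLeading x y 2 β) b≡ d≡ (leading e))
          where
          b≡ : b ≡ β ℕ.+ (3 ℕ.+ k)
          b≡ = ℕ.+-cancelʳ-≡ 3 b _ (trans (sym (trans β+δ (trans (cong (λ k → b ℕ.+ k ℕ.+ 1) d≡) (ℕ.+-assoc b 2 1))))
            (trans (cong (β ℕ.+_) δ≡) (eq β k)))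
            where
            eq : ∀ β k → β ℕ.+ (6 ℕ.+ k) ≡ β ℕ.+ (3 ℕ.+ k) ℕ.+ 3
            eq = ℕRing.solve-∀

        bump : ∀ {k} → k ℕ.≤ T.d → T.d ≢ k → suc k ℕ.≤ T.d
        bump le ne = ℕ.≤∧≢⇒< le (λ e → ne (sym e))

        𝟙-corner : ∀ k → c ≡ a ℕ.+ 5 → 𝟙 (a ℕ.+ (5 ℕ.+ k) ℕ.≟ c ℕ.+ S.d) ≡ 𝟙 (S.d ℕ.≟ k)
        𝟙-corner k c≡ = 𝟙-cong (a ℕ.+ (5 ℕ.+ k) ℕ.≟ c ℕ.+ S.d) (S.d ℕ.≟ k)
          (λ e → sym (ℕ.+-cancelˡ-≡ (a ℕ.+ 5) k S.d (trans (ℕ.+-assoc a 5 k) (trans e (cong (ℕ._+ S.d) c≡)))))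
          (λ e → trans (sym (ℕ.+-assoc a 5 k)) (cong₂ ℕ._+_ (sym c≡) (sym e)))

        notC : ∀ k → c ≡ a ℕ.+ 5 → 𝟙 (a ℕ.+ (6 ℕ.+ k) ℕ.≟ c) ≡ 0ℤ
        notC k c≡ = 𝟙-no (a ℕ.+ (6 ℕ.+ k) ℕ.≟ c) (λ e → contradiction (ℕ.+-cancelˡ-≡ a (6 ℕ.+ k) 5 (trans e c≡)) λ ())

        at7 : c ≡ a ℕ.+ 5 → 5 ℕ.≤ T.d → ⊥
        at7 c≡ 5≤δ = go (S.d ℕ.≟ 2) (a ℕ.+ 7 ℕ.≟ γ ℕ.+ T.d)
          (trans (sym (cong₂ (λ x y → 0ℤ + x + y) (notC 1 c≡) (𝟙-corner 2 c≡))) (later (ℕ.m≤m+n 3 4) ℕ.≤-refl 1ℤ euler-7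
          refl))
          where
          go : (d₁ : Dec (S.d ≡ 2)) (d₂ : Dec (a ℕ.+ 7 ≡ γ ℕ.+ T.d)) → 0ℤ + 0ℤ + 𝟙 d₁ ≡ 1ℤ + (0ℤ + 0ℤ + 𝟙 d₂) → ⊥
          go (yes d≡) (no ne) _ = seventh c≡ d≡ (bump 5≤δ (δ-not ne))
          go (yes _) (yes _) ()
          go (no _)  (yes _) ()
          go (no _)  (no _)  ()

        at6 : c ≡ a ℕ.+ 5 → 4 ℕ.≤ T.d → ⊥
        at6 c≡ 4≤δ = go (S.d ℕ.≟ 1) (a ℕ.+ 6 ℕ.≟ γ ℕ.+ T.d)
          (trans (sym (cong₂ (λ x y → 0ℤ + x + y) (notC 0 c≡) (𝟙-corner 1 c≡))) (later (ℕ.m≤m+n 3 3) (ℕ.n≤1+n 6) 0ℤ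
          euler-6 refl))
          where
          go : (d₁ : Dec (S.d ≡ 1)) (d₂ : Dec (a ℕ.+ 6 ≡ γ ℕ.+ T.d)) → 0ℤ + 0ℤ + 𝟙 d₁ ≡ 0ℤ + (0ℤ + 0ℤ + 𝟙 d₂) → ⊥
          go (yes d≡) (yes e) _ = sixth c≡ d≡ (δ-at e)
          go (no _)   (no ne) _ = at7 c≡ (bump 4≤δ (δ-not ne))
          go (yes _) (no _)  ()
          go (no _)  (yes _) ()

        at5 : a ℕ.+ 5 ℕ.≤ c → 3 ℕ.≤ T.d → ⊥
        at5 a+5≤c 3≤δ = go (a ℕ.+ 5 ℕ.≟ c) (a ℕ.+ 5 ℕ.≟ γ ℕ.+ T.d) (later (ℕ.m≤m+n 3 2) (ℕ.m≤m+n 5 2) 1ℤ euler-5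
          (beforeCorner a+5≤c))
          where
          go : (d₁ : Dec (a ℕ.+ 5 ≡ c)) (d₂ : Dec (a ℕ.+ 5 ≡ γ ℕ.+ T.d)) → 0ℤ + 𝟙 d₁ + 0ℤ ≡ 1ℤ + (0ℤ + 0ℤ + 𝟙 d₂) → ⊥
          go (yes e) (no ne) _ = at6 (sym e) (bump 3≤δ (δ-not ne))
          go (yes _) (yes _) ()
          go (no _)  (yes _) ()
          go (no _)  (no _)  ()

        at4 : a ℕ.+ 4 ℕ.≤ c → 2 ℕ.≤ T.d → ⊥
        at4 a+4≤c 2≤δ = go (a ℕ.+ 4 ℕ.≟ c) (a ℕ.+ 4 ℕ.≟ γ ℕ.+ T.d) (later (ℕ.m≤m+n 3 1) (ℕ.m≤m+n 4 3) 0ℤ euler-4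
          (beforeCorner a+4≤c))
          where
          go : (d₁ : Dec (a ℕ.+ 4 ≡ c)) (d₂ : Dec (a ℕ.+ 4 ≡ γ ℕ.+ T.d)) → 0ℤ + 𝟙 d₁ + 0ℤ ≡ 0ℤ + (0ℤ + 0ℤ + 𝟙 d₂) → ⊥
          go (yes e) (yes e′) _ = fourth (sym e) (δ-at e′)
          go (no ne) (no ne′) _ = at5 (next a+4≤c ne) (bump 2≤δ (δ-not ne′))
          go (yes _) (no _)  ()
          go (no _)  (yes _) ()

        impossible : ⊥
        impossible = go (a ℕ.+ 3 ℕ.≟ c) (a ℕ.+ 3 ℕ.≟ γ ℕ.+ T.d) (later ℕ.≤-refl (ℕ.m≤m+n 3 4) 0ℤ euler-3
          (beforeCorner a+3≤c))
          where
          go : (d₁ : Dec (a ℕ.+ 3 ≡ c)) (d₂ : Dec (a ℕ.+ 3 ≡ γ ℕ.+ T.d)) → 0ℤ + 𝟙 d₁ + 0ℤ ≡ 0ℤ + (0ℤ + 0ℤ + 𝟙 d₂) → ⊥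
          go (yes e) (yes e′) _ = third (sym e) (δ-at e′)
          go (no ne) (no ne′) _ = at4 (next a+3≤c ne) (bump 1≤δ (δ-not ne′))
          go (yes _) (no _)  ()
          go (no _)  (yes _) ()

      conclude : Conclusion
      conclude with a ℕ.≤? 3
      ... | yes a≤3 = small a≤3
      ... | no a≰3  = contradiction (Large.impossible (ℕ.≰⇒> a≰3)) λ ()

    conclude : Conclusion
    conclude = go (a ℕ.+ 1 ℕ.≟ c) (a ℕ.+ 1 ℕ.≟ α)
      where
      go : Dec (a ℕ.+ 1 ≡ c) → Dec (a ℕ.+ 1 ≡ α) → Conclusion
      go (yes e) (yes e′) = contradiction (NoFirstCoefficient.impossible (first 1ℤ 1ℤ (𝟙-yes (a ℕ.+ 1 ℕ.≟ c) e)
        (axis-yes e′))) λ ()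
      go (no ne) (no ne′) = contradiction (NoFirstCoefficient.impossible (first 0ℤ 0ℤ (𝟙-no (a ℕ.+ 1 ℕ.≟ c) ne)
        (axis-no ne′))) λ ()
      go (yes e) (no ne′) = contradiction (negativeExponent (first 1ℤ 0ℤ (𝟙-yes (a ℕ.+ 1 ℕ.≟ c) e) (axis-no ne′)) e)
        λ ()
      go (no ne) (yes e′) = FirstCoefficient.conclude (first 0ℤ 1ℤ (𝟙-no (a ℕ.+ 1 ℕ.≟ c) ne) (axis-yes e′)) e′ ne

  classification : Conclusion
  classification with ℕ.<-cmp a α
  ... | tri> _ _ α<a = contradiction α<a α≮a
  ... | tri< a<α _ _ = SmallerLeading.conclude a<α
  ... | tri≈ _ a≡α _ with ℕ.<-cmp c γ
  ...   | tri< c<γ _ _ = EqualLeading.conclude a≡α c<γ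
  ...   | tri≈ _ c≡γ _ = contradiction c≡γ (EqualLeading.c≢γ a≡α)
  ...   | tri> _ _ γ<c = contradiction γ<c (EqualLeading.γ≮c a≡α)

-- The Schoeneberg pairs

record Leading (E : QSeries) (s r : ℕ → ℕ) : Set where
  field
    m         : ℕ
    order≡    : order E ≡ + (m ℕ.* 24)
    low       : ∀ n → n ℕ.< m → s n ≡ r n
    expansion : ∀ j → + s (m ℕ.+ j) - + r (m ℕ.+ j) ≡ + 2 * series E j

-- Theta series live on nonnegative integral exponents. As the leading coefficient of `E` is 1, the
-- order of `E` must be such an exponent, so it has the form `24m`.
leading : ∀ E Qₛ Qᵣ → series E 0 ≡ 1ℤ → IsHalfDifference E (Θ Qₛ) (Θ Qᵣ) → Leading E (representations Qₛ)
  (representations Qᵣ)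
leading E Qₛ Qᵣ e₀ half = go (order E) refl
  where
  diff : ∀ k → coeff (Θ Qₛ) k - coeff (Θ Qᵣ) k ≡ + 2 * coeff E k
  diff = halfDifference⇒ {E} {Θ Qₛ} {Θ Qᵣ} half
  diff-order : coeff (Θ Qₛ) (order E) - coeff (Θ Qᵣ) (order E) ≡ + 2
  diff-order = trans (diff (order E)) (cong (+ 2 *_) (trans (coeff-≥ E (order E) (ℤ.+-inverseʳ (order E)))
    (trans (dilate-multiple 24 (series E) 0) e₀)))
  nonzero : ∀ {x y : ℤ} → x ≡ 0ℤ → y ≡ 0ℤ → x - y ≢ + 2
  nonzero refl refl ()
  coeff-Θ-none : ∀ Q j → ¬ 24 ∣ j → coeff (Θ Q) (+ j) ≡ 0ℤ
  coeff-Θ-none Q j 24∤j = trans (coeff-≥ (Θ Q) (+ j) (ℤ.+-identityʳ (+ j))) (dilate-nonmultiple 24 _ j 24∤j)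
  go : ∀ o → order E ≡ o → Leading E (representations Qₛ) (representations Qᵣ)
  go -[1+ k ] e = contradiction (subst (λ o → coeff (Θ Qₛ) o - coeff (Θ Qᵣ) o ≡ + 2) e diff-order)
    (nonzero (coeff-< (Θ Qₛ) -[1+ k ] refl) (coeff-< (Θ Qᵣ) -[1+ k ] refl))
  go (+ k) e with 24 ∣? k
  ... | no 24∤k = contradiction (subst (λ o → coeff (Θ Qₛ) o - coeff (Θ Qᵣ) o ≡ + 2) e diff-order)
    (nonzero (coeff-Θ-none Qₛ k 24∤k) (coeff-Θ-none Qᵣ k 24∤k))
  ... | yes (divides m refl) = record
    { m         = m
    ; order≡    = e
    ; low       = λ n n<m → ℤ.+-injective (ℤ.i-j≡0⇒i≡j (+ representations Qₛ n) (+ representations Qᵣ n)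
        (trans (sym (cong₂ _-_ (coeff-Θ Qₛ n) (coeff-Θ Qᵣ n))) (trans (diff (+ (n ℕ.* 24)))
          (cong (+ 2 *_) (below n n<m)))))
    ; expansion = λ j → trans (sym (cong₂ _-_ (coeff-Θ Qₛ (m ℕ.+ j)) (coeff-Θ Qᵣ (m ℕ.+ j))))
      (trans (diff (+ ((m ℕ.+ j) ℕ.* 24))) (cong (+ 2 *_) (coeff-order E {m} j e)))
    }
    where
    below : ∀ n → n ℕ.< m → coeff E (+ (n ℕ.* 24)) ≡ 0ℤ
    below n n<m with k , e′ ← -‿< (ℕ.*-monoˡ-< 24 n<m) = coeff-< E (+ (n ℕ.* 24))
      (trans (cong (λ o → + (n ℕ.* 24) - o) e) e′)

schoenebergPair-mod24 : ∀ {D P P′} → SchoenebergPair D P P′ → D % 24 ≡ 23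
schoenebergPair-mod24 (generic e _) = e
schoenebergPair-mod24 D=23  = refl
schoenebergPair-mod24 D=47  = refl
schoenebergPair-mod24 D=71  = refl
schoenebergPair-mod24 D=95  = refl
schoenebergPair-mod24 D=119 = refl

schoenebergPair-unique : ∀ {D P P′ Q Q′} → SchoenebergPair D P P′ → SchoenebergPair D Q Q′ → P ≡ Q × P′ ≡ Q′
schoenebergPair-unique (generic _ _) (generic _ _) = refl , refl
schoenebergPair-unique D=23  D=23  = refl , refl
schoenebergPair-unique D=47  D=47  = refl , refl
schoenebergPair-unique D=71  D=71  = refl , refl
schoenebergPair-unique D=95  D=95  = refl , refl
schoenebergPair-unique D=119 D=119 = refl , refl
schoenebergPair-unique (generic _ (s≤s ())) D=23
schoenebergPair-unique (generic _ (s≤s (s≤s ()))) D=47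
schoenebergPair-unique (generic _ (s≤s (s≤s (s≤s ())))) D=71
schoenebergPair-unique (generic _ (s≤s (s≤s (s≤s (s≤s ()))))) D=95
schoenebergPair-unique (generic _ (s≤s (s≤s (s≤s (s≤s (s≤s ())))))) D=119
schoenebergPair-unique D=23  (generic _ (s≤s ()))
schoenebergPair-unique D=47  (generic _ (s≤s (s≤s ())))
schoenebergPair-unique D=71  (generic _ (s≤s (s≤s (s≤s ()))))
schoenebergPair-unique D=95  (generic _ (s≤s (s≤s (s≤s (s≤s ())))))
schoenebergPair-unique D=119 (generic _ (s≤s (s≤s (s≤s (s≤s (s≤s ()))))))

module _ {D : ℕ} (p : Prime D) where

  private instance
    D≢0 : ℕ.NonZero D
    D≢0 = prime⇒nonZero p

  etaQuotient-classification : ∀ r Qₛ Qᵣ → HasLevel D Qₛ → HasLevel D Qᵣ → IsHalfDifference (etaQuotient D r) (Θ Qₛ)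
    (Θ Qᵣ) →
    r 1 ≡ 1ℤ × r D ≡ 1ℤ × ∃[ P ] ∃[ P′ ] (SchoenebergPair D P P′ × EquivalentUpToConjugation Qₛ P ×
      EquivalentUpToConjugation Qᵣ P′)
  etaQuotient-classification r Qₛ Qᵣ levelₛ levelᵣ half
    with R , equivₛ , repₛ ← reduction D Qₛ levelₛ with R′ , equivᵣ , repᵣ ← reduction D Qᵣ levelᵣ =
    proj₁ result , rD≡1 , AlmostReduced.toForm R , AlmostReduced.toForm R′ , proj₂ (proj₂ result) , equivₛ , equivᵣ
    where
    E : QSeries
    E = etaQuotient D r
    0<D : 0 ℕ.< D
    0<D = ℕ.<⇒≤ (prime⇒2≤ p)
    E₀ : series E 0 ≡ 1ℤ
    E₀ = trans (etaQuotient-series p r 0 0<D) (proj₁ (series₀₁ p r))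
    L : Leading E (representations Qₛ) (representations Qᵣ)
    L = leading E Qₛ Qᵣ E₀ half
    open Leading L
    open AlmostReduced R
    open AlmostReduced R′ renaming (a to α; b to β; c to γ; b≤a to β≤α; a≤c to α≤γ; D+b²≡4ac to disc′)
    result : r 1 ≡ 1ℤ × D ℕ.+ 1 ≡ 24 ℕ.* m × SchoenebergPair D (AlmostReduced.toForm R) (AlmostReduced.toForm R′)
    result = Classification.classification p b≤a a≤c D+b²≡4ac β≤α α≤γ disc′ m (series E) (r 1)
      (λ n n<m → trans (sym (repₛ n)) (trans (low n n<m) (repᵣ n)))
      (λ j _ → trans (cong₂ (λ x y → + x - + y) (sym (repₛ (m ℕ.+ j))) (sym (repᵣ (m ℕ.+ j)))) (expansion j))
      E₀
      (λ 1<D → trans (etaQuotient-series p r 1 1<D) (proj₂ (series₀₁ p r)))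
      (λ e j 0<j j<D → trans (etaQuotient-series p r j j<D) (series-r≡0 p r e j 0<j))
      (λ e j j<D → trans (etaQuotient-series p r j j<D) (series-r≡1 p r e j))
      (λ e 2<D → trans (etaQuotient-series p r 2 2<D) (series-r≡-1 p r e))
    -- The order `r 1 + r D * D` equals `24m = D + 1`, and `r 1 = 1`.
    rD≡1 : r D ≡ 1ℤ
    rD≡1 = ℤ.*-cancelʳ-≡ (r D) 1ℤ (+ D) (trans (move 1ℤ (r D * + D)) (trans (cong (_- 1ℤ) sum≡) (trans (back 1ℤ (+ D))
      (sym (ℤ.*-identityˡ (+ D))))))
      where
      move : ∀ x y → y ≡ x + y - x
      move = ℤRing.solve-∀
      back : ∀ x y → y + x - x ≡ y
      back = ℤRing.solve-∀
      sum≡ : 1ℤ + r D * + D ≡ + D + 1ℤ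
      sum≡ = trans (cong (_+ r D * + D) (sym (proj₁ result))) (trans (sym (etaQuotient-order p r)) (trans order≡
        (trans (cong +_ (trans (ℕ.*-comm m 24) (sym (proj₁ (proj₂ result))))) (ℤ.pos-+ D 1))))

coeff-Θ-cong : ∀ Q Q′ → (∀ n → representations Q n ≡ representations Q′ n) → ∀ k → coeff (Θ Q) k ≡ coeff (Θ Q′) k
coeff-Θ-cong Q Q′ e = ≈-intro (Θ Q) (Θ Q′) refl (λ n → cong +_ (e n))

-- Existence of the representation

module Existence {D : ℕ} {c : ℕ} (24c≡ : suc D ≡ 24 ℕ.* c) .{{D≢0 : ℕ.NonZero D}} where

  -- These two forms give η(z)η(Dz) also for `c < 6`, where they are not both reduced. For
  -- `D = 23, 47, 71` changes of variables that preserve the representation numbers lead to the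
  -- reduced pairs.
  Q₁ Q₅ : Form
  Q₁ = form (+ 6) (+ 1) (+ c)
  Q₅ = form (+ 6) (+ 5) (+ (c ℕ.+ 1))

  24c : + 24 * + c ≡ + D + + 1
  24c = trans (sym (ℤ.pos-* 24 c)) (trans (cong +_ (trans (sym 24c≡) (ℕ.+-comm 1 D))) (ℤ.pos-+ D 1))

  24c+24 : + 24 * + (c ℕ.+ 1) ≡ + D + + 25
  24c+24 = trans (cong (+ 24 *_) (ℤ.pos-+ c 1)) (trans (ℤ.*-distribˡ-+ (+ 24) (+ c) (+ 1)) (trans (cong (_+ + 24) 24c)
    (ℤ.+-assoc (+ D) (+ 1) (+ 24))))

  disc : ∀ b k → + 24 * k ≡ + D + b * b → b * b - + 4 * (+ 6 * k) ≡ - (+ D)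
  disc b k e = trans (cong (λ z → b * b - z) (trans (sym (ℤ.*-assoc (+ 4) (+ 6) k)) e)) (id (b * b) (+ D))
    where
    id : ∀ s D → s - (D + s) ≡ - D
    id = ℤRing.solve-∀

  pd₁ : PositiveDefinite Q₁
  pd₁ = positiveDefinite 6 (+ 1) (+ c) D (disc (+ 1) (+ c) 24c)

  pd₅ : PositiveDefinite Q₅
  pd₅ = positiveDefinite 6 (+ 5) (+ (c ℕ.+ 1)) D (disc (+ 5) (+ (c ℕ.+ 1)) 24c+24)

  repDifference : ∀ n → + representations Q₁ n - + representations Q₅ n ≡ + 2 * latticeSum D c 24c≡ n
  repDifference n = thetaDifference D n c 24c≡ (+ c) (+ (c ℕ.+ 1)) 24c 24c+24 pd₁ pd₅

  ηη : QSeries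
  ηη = η⟨ 1 ⟩ ⊗ η⟨ D ⟩

  order-ηη : order ηη ≡ + (c ℕ.* 24)
  order-ηη = trans (sym (ℤ.pos-+ 1 D)) (cong +_ (trans 24c≡ (ℕ.*-comm 24 c)))

  series-ηη : ∀ j → series ηη j ≡ latticeSum D c 24c≡ (j ℕ.+ c)
  series-ηη j = trans (⊛-cong {dilate 1 euler} {euler} {dilate D euler} {dilate D euler} j (λ i _ → dilate-1 euler i)
    (λ i _ → refl)) (eulerProduct-latticeSum D c 24c≡ j)

  coeff-ηη : ∀ n → coeff ηη (+ (n ℕ.* 24)) ≡ latticeSum D c 24c≡ n
  coeff-ηη n with n ℕ.<? c
  ... | yes n<c = trans below (sym (latticeSum-small D c 24c≡ n n<c))
    where
    below : coeff ηη (+ (n ℕ.* 24)) ≡ 0ℤ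
    below with k , e ← -‿< (ℕ.*-monoˡ-< 24 n<c) = coeff-< ηη (+ (n ℕ.* 24))
      (trans (cong (λ o → + (n ℕ.* 24) - o) order-ηη) e)
  ... | no n≮c with j , refl ← slack (ℕ.≮⇒≥ n≮c) = trans (coeff-order ηη {c} j order-ηη) (trans (series-ηη j)
    (cong (latticeSum D c 24c≡) (ℕ.+-comm j c)))

  coeff-ηη-none : ∀ j → ¬ 24 ∣ j → coeff ηη (+ j) ≡ 0ℤ
  coeff-ηη-none j 24∤j with j ℕ.<? c ℕ.* 24
  ... | yes j<24c with k , e ← -‿< j<24c = coeff-< ηη (+ j) (trans (cong (λ o → + j - o) order-ηη) e)
  ... | no j≮24c with i , refl ← slack (ℕ.≮⇒≥ j≮24c) = trans (coeff-≥ ηη (+ (c ℕ.* 24 ℕ.+ i))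
      (trans (cong (λ o → + (c ℕ.* 24 ℕ.+ i) - o) order-ηη) (trans (-‿≥ (ℕ.m≤m+n (c ℕ.* 24) i))
        (cong +_ (ℕ.m+n∸m≡n (c ℕ.* 24) i)))))
    (dilate-nonmultiple 24 (series ηη) i
      (λ { (divides q e) → 24∤j (divides (c ℕ.+ q) (trans (cong (c ℕ.* 24 ℕ.+_) e) (sym (ℕ.*-distribʳ-+ 24 c q)))) }))

  coeff-ηη-neg : ∀ k → coeff ηη -[1+ k ] ≡ 0ℤ
  coeff-ηη-neg k = coeff-< ηη -[1+ k ] (trans (cong (λ o → -[1+ k ] - o) order-ηη) (negative (c ℕ.* 24)))
    where
    negative : ∀ n → -[1+ k ] - + n ≡ -[1+ k ℕ.+ n ]
    negative zero    = cong -[1+_] (sym (ℕ.+-identityʳ k))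
    negative (suc n) = cong -[1+_] (sym (ℕ.+-suc k n))

  difference : ∀ k → coeff (Θ Q₁) k - coeff (Θ Q₅) k ≡ + 2 * coeff ηη k
  difference -[1+ k ] = sym (cong (+ 2 *_) (coeff-ηη-neg k))
  difference (+ j) with 24 ∣? j
  ... | yes (divides n refl) = trans (cong₂ _-_ (coeff-Θ Q₁ n) (coeff-Θ Q₅ n)) (trans (repDifference n)
    (cong (+ 2 *_) (sym (coeff-ηη n))))
  ... | no 24∤j = trans (cong₂ _-_ (none Q₁) (none Q₅)) (sym (cong (+ 2 *_) (coeff-ηη-none j 24∤j)))
    where
    none : ∀ Q → coeff (Θ Q) (+ j) ≡ 0ℤ
    none Q = trans (coeff-≥ (Θ Q) (+ j) (ℤ.+-identityʳ (+ j))) (dilate-nonmultiple 24 (λ n → + representations Q n) j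
      24∤j)

  halfDifference : ∀ Qₛ Qᵣ → (∀ n → representations Q₁ n ≡ representations Qₛ n) → (∀ n → representations Q₅ n ≡
    representations Qᵣ n) →
    IsHalfDifference ηη (Θ Qₛ) (Θ Qᵣ)
  halfDifference Qₛ Qᵣ eₛ eᵣ = ⇒halfDifference {ηη} {Θ Qₛ} {Θ Qᵣ}
    (λ k → trans (sym (cong₂ _-_ (coeff-Θ-cong Q₁ Qₛ eₛ k) (coeff-Θ-cong Q₅ Qᵣ eᵣ k))) (difference k))

  genericPair : 6 ℕ.≤ c → IsHalfThetaDifference D ηη Q₁ Q₅
  genericPair 6≤c = record
    { levelₛ   = record { isPrimitive = cong +_ (gcd-zeroˡ c) ; positiveDefinite = pd₁ ; discriminant≡-D = disc (+ 1)
      (+ c) 24c }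
    ; levelᵣ   = record { isPrimitive = cong +_ (gcd-zeroˡ (c ℕ.+ 1)) ; positiveDefinite = pd₅ ; discriminant≡-D = disc
      (+ 5) (+ (c ℕ.+ 1)) 24c+24 }
    ; reducedₛ = record { ∣b∣≤a = +≤+ (s≤s z≤n) ; a≤c = +≤+ 6≤c ; ∣b∣≡a⇒0≤b = λ () ; a≡c⇒0≤b = λ _ → +≤+ z≤n }
    ; reducedᵣ = record { ∣b∣≤a = +≤+ (ℕ.n≤1+n 5) ; a≤c = +≤+ (ℕ.≤-trans 6≤c (ℕ.m≤m+n c 1)) ; ∣b∣≡a⇒0≤b = λ () ;
      a≡c⇒0≤b = λ _ → +≤+ z≤n }
    ; distinct = λ ()
    ; halfDifference = halfDifference Q₁ Q₅ (λ _ → refl) (λ _ → refl)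
    }

swapRepresentations : ∀ a b c → PositiveDefinite (form a b c) → PositiveDefinite (form c b a) → ∀ n → representations
  (form a b c) n ≡ representations (form c b a) n
swapRepresentations a b c pd pd′ = representations-≡ (form a b c) (form c b a) pd pd′ (λ (x , y) → y , x)
  (λ (x , y) → y , x) (λ _ → refl) (λ _ → refl) (id a b c)
  where
  id : ∀ a b c x y → c * (y * y) + b * (y * x) + a * (x * x) ≡ a * (x * x) + b * (x * y) + c * (y * y)
  id = ℤRing.solve-∀

-- (a, b, c) ∼ (c, b - 2c, a - b + c), conjugated if ε = -1.
shearRepresentations : ∀ ε → ε * ε ≡ 1ℤ → ∀ a b c → let b′ = ε * (b - + 2 * c); c′ = a - b + c in
  PositiveDefinite (form a b c) → PositiveDefinite (form c b′ c′) → ∀ n → representations (form a b c) n ≡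
    representations (form c b′ c′) n
shearRepresentations ε ε² a b c pd pd′ = representations-≡ (form a b c) (form c (ε * (b - + 2 * c)) (a - b + c)) pd pd′
  (λ (x , y) → y + x , ε * x) (λ (x , y) → ε * y , x - ε * y)
  (λ (x , y) → cong₂ _,_ (εε x) (trans (cong (λ z → y + x - z) (εε x)) (cancel y x)))
  (λ (x , y) → cong₂ _,_ (restore x (ε * y)) (εε y))
  (λ x y → trans (id₁ ε a b c x y) (trans (cong (λ e → c * ((y + x) * (y + x)) + e * ((b - + 2 * c) * ((y + x) * x)) + e
    * ((a - b + c) * (x * x))) ε²) (id₂ a b c x y)))
  where
  εε : ∀ z → ε * (ε * z) ≡ z
  εε z = trans (sym (ℤ.*-assoc ε ε z)) (trans (cong (_* z) ε²) (ℤ.*-identityˡ z))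
  cancel : ∀ y x → y + x - x ≡ y
  cancel = ℤRing.solve-∀
  restore : ∀ x y → x - y + y ≡ x
  restore = ℤRing.solve-∀
  id₁ : ∀ ε a b c x y → c * ((y + x) * (y + x)) + ε * (b - + 2 * c) * ((y + x) * (ε * x)) + (a - b + c) *
    (ε * x * (ε * x)) ≡
    c * ((y + x) * (y + x)) + ε * ε * ((b - + 2 * c) * ((y + x) * x)) + ε * ε * ((a - b + c) * (x * x))
  id₁ = ℤRing.solve-∀
  id₂ : ∀ a b c x y → c * ((y + x) * (y + x)) + 1ℤ * ((b - + 2 * c) * ((y + x) * x)) + 1ℤ * ((a - b + c) * (x * x)) ≡ a
    * (x * x) + b * (x * y) + c * (y * y)
  id₂ = ℤRing.solve-∀

Schoeneberg : ℕ → Set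
Schoeneberg D = ∃[ Qₛ ] ∃[ Qᵣ ] (SchoenebergPair D Qₛ Qᵣ × IsHalfThetaDifference D (η⟨ 1 ⟩ ⊗ η⟨ D ⟩) Qₛ Qᵣ)

existence-23 : Schoeneberg 23
existence-23 = Q , Q′ , D=23 , record
  { levelₛ   = record { isPrimitive = refl ; positiveDefinite = pd ; discriminant≡-D = refl }
  ; levelᵣ   = record { isPrimitive = refl ; positiveDefinite = pd′ ; discriminant≡-D = refl }
  ; reducedₛ = record { ∣b∣≤a = toWitness {a? = + 1 ℤ.≤? + 1} tt ; a≤c = toWitness {a? = + 1 ℤ.≤? + 6} tt ; ∣b∣≡a⇒0≤b =
    λ _ → +≤+ z≤n ; a≡c⇒0≤b = λ _ → +≤+ z≤n }
  ; reducedᵣ = record { ∣b∣≤a = toWitness {a? = + 1 ℤ.≤? + 2} tt ; a≤c = toWitness {a? = + 2 ℤ.≤? + 3} tt ; ∣b∣≡a⇒0≤b =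
    λ _ → +≤+ z≤n ; a≡c⇒0≤b = λ _ → +≤+ z≤n }
  ; distinct = λ ()
  ; halfDifference = E.halfDifference Q Q′
      (swapRepresentations (+ 6) (+ 1) (+ 1) E.pd₁ pd) (shearRepresentations 1ℤ refl (+ 6) (+ 5) (+ 2) E.pd₅ pd′)
  }
  where
  module E = Existence {23} {1} refl
  Q Q′ : Form
  Q  = form (+ 1) (+ 1) (+ 6)
  Q′ = form (+ 2) (+ 1) (+ 3)
  pd : PositiveDefinite Q
  pd = positiveDefinite 1 (+ 1) (+ 6) 23 refl
  pd′ : PositiveDefinite Q′
  pd′ = positiveDefinite 2 (+ 1) (+ 3) 23 refl

existence-47 : Schoeneberg 47
existence-47 = Q , Q′ , D=47 , record
  { levelₛ   = record { isPrimitive = refl ; positiveDefinite = pd ; discriminant≡-D = refl }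
  ; levelᵣ   = record { isPrimitive = refl ; positiveDefinite = pd′ ; discriminant≡-D = refl }
  ; reducedₛ = record { ∣b∣≤a = toWitness {a? = + 1 ℤ.≤? + 2} tt ; a≤c = toWitness {a? = + 2 ℤ.≤? + 6} tt ; ∣b∣≡a⇒0≤b =
    λ _ → +≤+ z≤n ; a≡c⇒0≤b = λ _ → +≤+ z≤n }
  ; reducedᵣ = record { ∣b∣≤a = toWitness {a? = + 1 ℤ.≤? + 3} tt ; a≤c = toWitness {a? = + 3 ℤ.≤? + 4} tt ; ∣b∣≡a⇒0≤b =
    λ _ → +≤+ z≤n ; a≡c⇒0≤b = λ _ → +≤+ z≤n }
  ; distinct = λ ()
  ; halfDifference = E.halfDifference Q Q′
      (swapRepresentations (+ 6) (+ 1) (+ 2) E.pd₁ pd) (shearRepresentations -1ℤ refl (+ 6) (+ 5) (+ 3) E.pd₅ pd′)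
  }
  where
  module E = Existence {47} {2} refl
  Q Q′ : Form
  Q  = form (+ 2) (+ 1) (+ 6)
  Q′ = form (+ 3) (+ 1) (+ 4)
  pd : PositiveDefinite Q
  pd = positiveDefinite 2 (+ 1) (+ 6) 47 refl
  pd′ : PositiveDefinite Q′
  pd′ = positiveDefinite 3 (+ 1) (+ 4) 47 refl

existence-71 : Schoeneberg 71
existence-71 = Q , Q′ , D=71 , record
  { levelₛ   = record { isPrimitive = refl ; positiveDefinite = pd ; discriminant≡-D = refl }
  ; levelᵣ   = record { isPrimitive = refl ; positiveDefinite = pd′ ; discriminant≡-D = refl }
  ; reducedₛ = record { ∣b∣≤a = toWitness {a? = + 1 ℤ.≤? + 3} tt ; a≤c = toWitness {a? = + 3 ℤ.≤? + 6} tt ; ∣b∣≡a⇒0≤b =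
    λ _ → +≤+ z≤n ; a≡c⇒0≤b = λ _ → +≤+ z≤n }
  ; reducedᵣ = record { ∣b∣≤a = toWitness {a? = + 3 ℤ.≤? + 4} tt ; a≤c = toWitness {a? = + 4 ℤ.≤? + 5} tt ; ∣b∣≡a⇒0≤b =
    λ _ → +≤+ z≤n ; a≡c⇒0≤b = λ _ → +≤+ z≤n }
  ; distinct = λ ()
  ; halfDifference = E.halfDifference Q Q′
      (swapRepresentations (+ 6) (+ 1) (+ 3) E.pd₁ pd) (shearRepresentations -1ℤ refl (+ 6) (+ 5) (+ 4) E.pd₅ pd′)
  }
  where
  module E = Existence {71} {3} refl
  Q Q′ : Form
  Q  = form (+ 3) (+ 1) (+ 6)
  Q′ = form (+ 4) (+ 3) (+ 5)
  pd : PositiveDefinite Q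
  pd = positiveDefinite 3 (+ 1) (+ 6) 71 refl
  pd′ : PositiveDefinite Q′
  pd′ = positiveDefinite 4 (+ 3) (+ 5) 71 refl

existence : ∀ {D} → Prime D → D % 24 ≡ 23 → Schoeneberg D
existence {D} p D%24≡23 = go (D ℕ./ 24) (trans (ℕ.m≡m%n+[m/n]*n D 24) (cong (ℕ._+ D ℕ./ 24 ℕ.* 24) D%24≡23))
  where
  go : ∀ q → D ≡ 23 ℕ.+ q ℕ.* 24 → Schoeneberg D
  go 0 D≡ = subst Schoeneberg (sym D≡) existence-23
  go 1 D≡ = subst Schoeneberg (sym D≡) existence-47
  go 2 D≡ = subst Schoeneberg (sym D≡) existence-71
  go 3 D≡ = contradiction (subst Prime D≡ p) (composite 5 19 (s≤s (s≤s z≤n)) (s≤s (s≤s z≤n)))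
  go 4 D≡ = contradiction (subst Prime D≡ p) (composite 7 17 (s≤s (s≤s z≤n)) (s≤s (s≤s z≤n)))
  go (suc (suc (suc (suc (suc q))))) D≡ = Existence.Q₁ {D} {c} 24c≡ , Existence.Q₅ {D} {c} 24c≡ ,
    schoenebergPair-generic D c (trans (ℕ.+-comm D 1) 24c≡) 6≤c ,
    Existence.genericPair {D} {c} 24c≡ 6≤c
    where
    instance
      D≢0 : ℕ.NonZero D
      D≢0 = prime⇒nonZero p
    c : ℕ
    c = 6 ℕ.+ q
    6≤c : 6 ℕ.≤ c
    6≤c = ℕ.m≤m+n 6 q
    24c≡ : suc D ≡ 24 ℕ.* c
    24c≡ = trans (cong suc D≡) (eq q)
      where
      eq : ∀ q → suc (23 ℕ.+ (5 ℕ.+ q) ℕ.* 24) ≡ 24 ℕ.* (6 ℕ.+ q)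
      eq = ℕRing.solve-∀

≈-sym : ∀ {E shanksSum} → E ≈ shanksSum → shanksSum ≈ E
≈-sym e k = sym (e k)

≈-trans : ∀ {E shanksSum G} → E ≈ shanksSum → shanksSum ≈ G → E ≈ G
≈-trans e e′ k = trans (e k) (e′ k)

theorem1p5 : (D : ℕ) → Prime D →
    ((E : QSeries) → IsEtaQuotient D E →
    (∃[ Qₛ ] ∃[ Qᵣ ] IsHalfThetaDifference D E Qₛ Qᵣ) ⇔ (D % 24 ≡ 23 × E ≈ η⟨ 1 ⟩ ⊗ η⟨ D ⟩))
    × (D % 24 ≡ 23 →
    ∃[ Qₛ₀ ] ∃[ Qᵣ₀ ] SchoenebergPair D Qₛ₀ Qᵣ₀
    × IsHalfThetaDifference D (η⟨ 1 ⟩ ⊗ η⟨ D ⟩) Qₛ₀ Qᵣ₀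
    × ((Qₛ Qᵣ : Form) → HasLevel D Qₛ → HasLevel D Qᵣ →
    IsHalfDifference (η⟨ 1 ⟩ ⊗ η⟨ D ⟩) (Θ Qₛ) (Θ Qᵣ) →
    EquivalentUpToConjugation Qₛ Qₛ₀ × EquivalentUpToConjugation Qᵣ Qᵣ₀))
theorem1p5 D p = (λ E (r , E≈) → mk⇔ (to E r E≈) (from E)) , (λ D%24≡23 → unique (existence p D%24≡23))
  where
  ηη : QSeries
  ηη = η⟨ 1 ⟩ ⊗ η⟨ D ⟩

  to : ∀ E r → E ≈ etaQuotient D r → (∃[ Qₛ ] ∃[ Qᵣ ] IsHalfThetaDifference D E Qₛ Qᵣ) → D % 24 ≡ 23 × E ≈ ηη
  to E r E≈ (Qₛ , Qᵣ , h) = conclude (etaQuotient-classification p r Qₛ Qᵣ levelₛ levelᵣ (halfDifference-resp-≈ {E}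
    {etaQuotient D r} {Θ Qₛ} {Θ Qᵣ} E≈ halfDifference))
    where
    open IsHalfThetaDifference h
    conclude : r 1 ≡ 1ℤ × r D ≡ 1ℤ × ∃[ P ] ∃[ P′ ] (SchoenebergPair D P P′ × EquivalentUpToConjugation Qₛ P ×
      EquivalentUpToConjugation Qᵣ P′) → D % 24 ≡ 23 × E ≈ ηη
    conclude (r₁≡1 , rD≡1 , _ , _ , pair , _) = schoenebergPair-mod24 pair , ≈-trans {E} {etaQuotient D r} {ηη} E≈
      (etaQuotient≈ηη p r r₁≡1 rD≡1)

  from : ∀ E → D % 24 ≡ 23 × E ≈ ηη → ∃[ Qₛ ] ∃[ Qᵣ ] IsHalfThetaDifference D E Qₛ Qᵣ
  from E (D%24≡23 , E≈) = transfer (existence p D%24≡23)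
    where
    transfer : Schoeneberg D → ∃[ Qₛ ] ∃[ Qᵣ ] IsHalfThetaDifference D E Qₛ Qᵣ
    transfer (Qₛ , Qᵣ , _ , h) = Qₛ , Qᵣ , record
      { levelₛ = levelₛ ; levelᵣ = levelᵣ ; reducedₛ = reducedₛ ; reducedᵣ = reducedᵣ ; distinct = distinct
      ; halfDifference = halfDifference-resp-≈ {ηη} {E} {Θ Qₛ} {Θ Qᵣ} (≈-sym {E} {ηη} E≈) halfDifference
      }
      where open IsHalfThetaDifference h

  unique : Schoeneberg D → ∃[ Qₛ₀ ] ∃[ Qᵣ₀ ] SchoenebergPair D Qₛ₀ Qᵣ₀ × IsHalfThetaDifference D ηη Qₛ₀ Qᵣ₀ ×
    ((Qₛ Qᵣ : Form) → HasLevel D Qₛ → HasLevel D Qᵣ → IsHalfDifference ηη (Θ Qₛ) (Θ Qᵣ) →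
      EquivalentUpToConjugation Qₛ Qₛ₀ × EquivalentUpToConjugation Qᵣ Qᵣ₀)
  unique (Qₛ₀ , Qᵣ₀ , pair₀ , h) = Qₛ₀ , Qᵣ₀ , pair₀ , h , λ Qₛ Qᵣ levelₛ levelᵣ half → conclude Qₛ Qᵣ
      (etaQuotient-classification p ones Qₛ Qᵣ levelₛ levelᵣ (halfDifference-resp-≈ {ηη} {etaQuotient D ones} {Θ Qₛ}
        {Θ Qᵣ} (≈-sym {etaQuotient D ones} {ηη} (etaQuotient≈ηη p ones refl refl)) half))
    where
    -- The exponents of η(z)η(Dz) as an eta quotient, which brings it under the classification.
    ones : ℕ → ℤ
    ones _ = 1ℤ
    conclude : ∀ Qₛ Qᵣ → ones 1 ≡ 1ℤ × ones D ≡ 1ℤ × ∃[ P ] ∃[ P′ ] (SchoenebergPair D P P′ × EquivalentUpToConjugation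
      Qₛ P × EquivalentUpToConjugation Qᵣ P′) →
      EquivalentUpToConjugation Qₛ Qₛ₀ × EquivalentUpToConjugation Qᵣ Qᵣ₀
    conclude Qₛ Qᵣ (_ , _ , P , P′ , pair , equivₛ , equivᵣ) =
      subst (EquivalentUpToConjugation Qₛ) (proj₁ P≡) equivₛ , subst (EquivalentUpToConjugation Qᵣ) (proj₂ P≡) equivᵣ
      where
      P≡ : P ≡ Qₛ₀ × P′ ≡ Qᵣ₀
      P≡ = schoenebergPair-unique pair pair₀
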